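{- For every positive integer $b$ there exists $N = N(b)$ such that for all integers $n \geq N$ the polynomial $F_{\lambda_{n,b}}(q) = \sum_{\ell \geq 0} c_{n,b}(\ell)\, q^\ell$ is unimodal, i.e. there is an index $k$ with $c_{n,b}(0) \leq c_{n,b}(1) \leq \cdots \leq c_{n,b}(k) \geq c_{n,b}(k+1) \geq c_{n,b}(k+2) \geq \cdots$.
   Context: For positive integers $n, b$, let $\lambda_{n,b} := (n, n-1, \ldots, n-b+1)$ (a truncated staircase). For an integer $\ell \geq 0$, let $c_{n,b}(\ell)$ be the number of partitions of $\ell$ into distinct parts whose Young diagrams fit inside $\lambda_{n,b}$, i.e. the number of sequences of integers $\lambda_1 > \lambda_2 > \cdots > \lambda_r > 0$ with $0 \leq r \leq b$, $\lambda_1 \leq n$ and $\sum_i \lambda_i = \ell$. The rank-generating function is $F_{\lambda_{n,b}}(q) := \sum_{\ell \geq 0} c_{n,b}(\ell) q^\ell$ (a polynomial). A polynomial is called unimodal if its sequence of coefficients, in increasing order of degree, weakly increases and then weakly decreases. -}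

module Defs where

open import Data.Nat using (ℕ; zero; suc; _+_; _≤_; _<_; _≤?_; _≟_)
open import Data.List using (List; []; _∷_; _++_; map; length; filter)
open import Data.Nat.ListAction using (sum)
open import Data.Product using (_×_; ∃; ∃-syntax)
open import Relation.Nullary using (Dec)
open import Relation.Nullary.Decidable using (_×-dec_)

decSeqs : ℕ → List (List ℕ)
decSeqs zero    = [] ∷ []
decSeqs (suc m) = decSeqs m ++ map (suc m ∷_) (decSeqs m)

c : ℕ → ℕ → ℕ → ℕ
c n b ℓ = length (filter (λ xs → (length xs ≤? b) ×-dec (sum xs ≟ ℓ)) (decSeqs n))

Unimodal : (ℕ → ℕ) → Set
Unimodal a = ∃[ k ] ((∀ i → suc i ≤ k → a i ≤ a (suc i))
                   × (∀ i → k ≤ i → a (suc i) ≤ a i))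

{-# OPTIONS --safe #-}

-- Let e n r be the generating function of partitions into exactly r distinct parts at most n, so that
-- (1 - q^r) e n r = (q^r - q^(n+1)) e n (r-1). Below degree n + 1 the differences of F = e n 0 + ... + e n b
-- are visibly nonnegative; above the degree of e n (b-1) only e n b is left, which is symmetric.
--
-- For b ≥ 5 compare b! F with B^b, where B = q + ... + q^n. Writing r (q^r - q^(n+1))/(1 - q^r) as B plus
-- (1 - q) Z/(1 - q^r), with Z a polynomial of bounded norm, shows that (1 - q)^2 (b! F - B^b) has
-- coefficients of size O(n^(b-4)); the extra factors 1 - q are absorbed by pairs of consecutive denominators.
-- The coefficients of B^b are symmetric and unimodal; their first differences beat the error O(n^(b-3))
-- at a bounded distance from the centre, and in the bounded window around the centre the second
-- differences are negative of order n^(b-3). So the first differences of F are nonnegative, then decrease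
-- through the window, then are nonpositive.
--
-- For b ≤ 4 the first differences are explicit combinations of quasi-polynomials counting partitions
-- into parts at most 4, and the place where they change sign is found by comparing periods.
module Submission where

open import Defs
open import Algebra.Bundles using (CommutativeRing)
open import Algebra.Structures using (IsCommutativeRing)
import Algebra.Solver.Ring as RingSolver
open import Algebra.Solver.Ring.AlmostCommutativeRing using (fromCommutativeRing; _-Raw-AlmostCommutative⟶_)
open import Data.Integer as ℤ using (ℤ; +_; -[1+_]; 0ℤ; 1ℤ; -1ℤ; ∣_∣; _+_; _-_; _*_; -_; _≤_)
import Data.Integer.Properties as ℤₚ
open import Data.Integer.Tactic.RingSolver using (solve-∀)
open import Data.List using (List; []; _∷_; map; length; filter)
import Data.List.Properties as Listₚ
open import Data.Maybe using (Maybe; just; nothing)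
open import Data.Nat as ℕ using (ℕ; zero; suc; z≤n; s≤s; _≤?_; _!; NonZero)
open import Data.Nat.DivMod using (_/_; m≡m%n+[m/n]*n; m/n*n≤m; m%n<n; /-monoˡ-≤; m*n/n≡m)
open import Data.Nat.Induction using (<-rec)
open import Data.Nat.ListAction using (sum)
import Data.Nat.Properties as ℕₚ
open import Data.Nat.Tactic.RingSolver using () renaming (solve-∀ to ℕ-solve)
open import Data.Product using (_×_; _,_; proj₁; proj₂; ∃-syntax)
open import Data.Sum using (inj₁; inj₂)
open import Function using (_∘_)
open import Relation.Binary.PropositionalEquality using (_≡_; refl; sym; trans; cong; cong₂; subst; subst₂; module ≡-Reasoning)
import Relation.Binary.Reasoning.Setoid as SetoidReasoning
open import Relation.Nullary using (Dec; yes; no; contradiction)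
open import Relation.Nullary.Decidable using (_×-dec_; from-yes)

-- Formal power series

-- The summands `e n r` of F are symmetric about different centres, r (n + 1) / 2, so F itself has
-- no symmetry and there is no obvious index for its peak. For b ≥ 5 the peak is therefore never
-- located, only enclosed in a window whose length does not depend on n. Two comparisons make this
-- possible. With w proportional to n, the first difference of B^b at distance T / 2 below its
-- centre is at least T w^(b-3), while the error is at most K w^(b-3) with K independent of T; the
-- choice T = K suffices. Nearer to the centre the main term may be smaller than the error, so the
-- sign there comes from second differences, where the main term is of order n^(b-3) and the error
-- only of order n^(b-4). Hence the error has to be controlled after two differences. The bounds are
-- uniform in n because powers of q^(n+1) in numerators only shift coefficients; only denominators
-- cost powers of the index.

+-congˡ : ∀ x {y z} → y ≡ z → x ℤ.+ y ≡ x ℤ.+ z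
+-congˡ x = cong (λ u → x ℤ.+ u)

Series : Set
Series = ℕ → ℤ

infix 4 _≈_
record _≈_ (a b : Series) : Set where
  constructor pointwise
  field at : ∀ ℓ → a ℓ ≡ b ℓ
open _≈_

conv : Series → Series → ℕ → ℤ
conv a b zero    = a 0 ℤ.* b 0
conv a b (suc ℓ) = a 0 ℤ.* b (suc ℓ) ℤ.+ conv (a ∘ suc) b ℓ

const : ℤ → Series
const z zero    = z
const z (suc _) = 0ℤ

infixl 6 _⊕_ _⊖_
infixl 7 _⊛_
infix 8 ⊝_

conv-cong : ∀ {a a′ b b′} → (∀ ℓ → a ℓ ≡ a′ ℓ) → (∀ ℓ → b ℓ ≡ b′ ℓ) → ∀ ℓ → conv a b ℓ ≡ conv a′ b′ ℓ
conv-cong p r zero    = cong₂ ℤ._*_ (p 0) (r 0)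
conv-cong p r (suc ℓ) = cong₂ ℤ._+_ (cong₂ ℤ._*_ (p 0) (r (suc ℓ))) (conv-cong (p ∘ suc) r ℓ)

conv-zeroˡ : ∀ b ℓ → conv (λ _ → 0ℤ) b ℓ ≡ 0ℤ
conv-zeroˡ b zero    = refl
conv-zeroˡ b (suc ℓ) = trans (ℤₚ.+-identityˡ _) (conv-zeroˡ b ℓ)

conv-const : ∀ z b ℓ → conv (const z) b ℓ ≡ z ℤ.* b ℓ
conv-const z b zero    = refl
conv-const z b (suc ℓ) = trans (+-congˡ (z ℤ.* b (suc ℓ)) (conv-zeroˡ b ℓ)) (ℤₚ.+-identityʳ (z ℤ.* b (suc ℓ)))

-- The mirror of the defining recursion, peeling off the constant term of the second factor; with
-- both recursions at hand commutativity is an induction.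
conv-snoc : ∀ a b ℓ → conv a b (suc ℓ) ≡ a (suc ℓ) ℤ.* b 0 ℤ.+ conv a (b ∘ suc) ℓ
conv-snoc a b zero    = ℤₚ.+-comm (a 0 ℤ.* b 1) _
conv-snoc a b (suc ℓ) = trans (+-congˡ (a 0 ℤ.* b (suc (suc ℓ))) (conv-snoc (a ∘ suc) b ℓ)) (swap (a 0 ℤ.* b (suc (suc ℓ))) (a (suc (suc ℓ)) ℤ.* b 0) (conv (a ∘ suc) (b ∘ suc) ℓ))
  where
  swap : ∀ x y z → x ℤ.+ (y ℤ.+ z) ≡ y ℤ.+ (x ℤ.+ z)
  swap = solve-∀

conv-comm : ∀ a b ℓ → conv a b ℓ ≡ conv b a ℓ
conv-comm a b zero    = ℤₚ.*-comm (a 0) (b 0)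
conv-comm a b (suc ℓ) = trans (cong₂ ℤ._+_ (ℤₚ.*-comm (a 0) (b (suc ℓ))) (conv-comm (a ∘ suc) b ℓ)) (sym (conv-snoc b a ℓ))

conv-distribʳ : ∀ c a b ℓ → conv (λ i → a i ℤ.+ b i) c ℓ ≡ conv a c ℓ ℤ.+ conv b c ℓ
conv-distribʳ c a b zero    = ℤₚ.*-distribʳ-+ (c 0) (a 0) (b 0)
conv-distribʳ c a b (suc ℓ) = trans (+-congˡ ((a 0 ℤ.+ b 0) ℤ.* c (suc ℓ)) (conv-distribʳ c (a ∘ suc) (b ∘ suc) ℓ))
  (regroup (a 0) (b 0) (c (suc ℓ)) (conv (a ∘ suc) c ℓ) (conv (b ∘ suc) c ℓ))
  where
  regroup : ∀ x y z u v → (x ℤ.+ y) ℤ.* z ℤ.+ (u ℤ.+ v) ≡ x ℤ.* z ℤ.+ u ℤ.+ (y ℤ.* z ℤ.+ v)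
  regroup = solve-∀

conv-scale : ∀ z a b ℓ → conv (λ i → z ℤ.* a i) b ℓ ≡ z ℤ.* conv a b ℓ
conv-scale z a b zero    = ℤₚ.*-assoc z (a 0) (b 0)
conv-scale z a b (suc ℓ) = trans (+-congˡ (z ℤ.* a 0 ℤ.* b (suc ℓ)) (conv-scale z (a ∘ suc) b ℓ)) (factor z (a 0) (b (suc ℓ)) (conv (a ∘ suc) b ℓ))
  where
  factor : ∀ z x y u → z ℤ.* x ℤ.* y ℤ.+ z ℤ.* u ≡ z ℤ.* (x ℤ.* y ℤ.+ u)
  factor = solve-∀

conv-assoc : ∀ a b c ℓ → conv (conv a b) c ℓ ≡ conv a (conv b c) ℓ
conv-assoc a b c zero    = ℤₚ.*-assoc (a 0) (b 0) (c 0)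
conv-assoc a b c (suc ℓ) = begin
  a 0 ℤ.* b 0 ℤ.* c (suc ℓ) ℤ.+ conv (λ i → a 0 ℤ.* b (suc i) ℤ.+ conv (a ∘ suc) b i) c ℓ
    ≡⟨ +-congˡ (a 0 ℤ.* b 0 ℤ.* c (suc ℓ)) (conv-distribʳ c (λ i → a 0 ℤ.* b (suc i)) (conv (a ∘ suc) b) ℓ) ⟩
  a 0 ℤ.* b 0 ℤ.* c (suc ℓ) ℤ.+ (conv (λ i → a 0 ℤ.* b (suc i)) c ℓ ℤ.+ conv (conv (a ∘ suc) b) c ℓ)
    ≡⟨ cong₂ (λ u v → a 0 ℤ.* b 0 ℤ.* c (suc ℓ) ℤ.+ (u ℤ.+ v)) (conv-scale (a 0) (b ∘ suc) c ℓ) (conv-assoc (a ∘ suc) b c ℓ) ⟩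
  a 0 ℤ.* b 0 ℤ.* c (suc ℓ) ℤ.+ (a 0 ℤ.* conv (b ∘ suc) c ℓ ℤ.+ conv (a ∘ suc) (conv b c) ℓ)
    ≡⟨ factor (a 0) (b 0) (c (suc ℓ)) (conv (b ∘ suc) c ℓ) (conv (a ∘ suc) (conv b c) ℓ) ⟩
  a 0 ℤ.* (b 0 ℤ.* c (suc ℓ) ℤ.+ conv (b ∘ suc) c ℓ) ℤ.+ conv (a ∘ suc) (conv b c) ℓ ∎
  where
  open ≡-Reasoning
  factor : ∀ x y z u v → x ℤ.* y ℤ.* z ℤ.+ (x ℤ.* u ℤ.+ v) ≡ x ℤ.* (y ℤ.* z ℤ.+ u) ℤ.+ v
  factor = solve-∀

≈-refl : ∀ {a} → a ≈ a
≈-refl = pointwise λ _ → refl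

≈-sym : ∀ {a b} → a ≈ b → b ≈ a
≈-sym p = pointwise λ ℓ → sym (at p ℓ)

≈-trans : ∀ {a b c} → a ≈ b → b ≈ c → a ≈ c
≈-trans p r = pointwise λ ℓ → trans (at p ℓ) (at r ℓ)

opaque
  _⊕_ : Series → Series → Series
  (a ⊕ b) ℓ = a ℓ ℤ.+ b ℓ

  ⊝_ : Series → Series
  (⊝ a) ℓ = ℤ.- a ℓ

  ⊕-at : ∀ a b ℓ → (a ⊕ b) ℓ ≡ a ℓ ℤ.+ b ℓ
  ⊕-at a b ℓ = refl

  ⊝-at : ∀ a ℓ → (⊝ a) ℓ ≡ ℤ.- a ℓ
  ⊝-at a ℓ = refl

  ⊕-cong : ∀ {a a′ b b′} → a ≈ a′ → b ≈ b′ → a ⊕ b ≈ a′ ⊕ b′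
  ⊕-cong p r = pointwise λ ℓ → cong₂ ℤ._+_ (at p ℓ) (at r ℓ)

  ⊝-cong : ∀ {a b} → a ≈ b → ⊝ a ≈ ⊝ b
  ⊝-cong p = pointwise λ ℓ → cong ℤ.-_ (at p ℓ)

  _⊛_ : Series → Series → Series
  a ⊛ b = conv a b

  ⊛-suc : ∀ a b ℓ → (a ⊛ b) (suc ℓ) ≡ a 0 ℤ.* b (suc ℓ) ℤ.+ ((a ∘ suc) ⊛ b) ℓ
  ⊛-suc a b ℓ = refl

  ⊛-zero : ∀ a b → (a ⊛ b) 0 ≡ a 0 ℤ.* b 0
  ⊛-zero a b = refl

  const-⊛ : ∀ z b ℓ → (const z ⊛ b) ℓ ≡ z ℤ.* b ℓ
  const-⊛ = conv-const

  ⊛-cong : ∀ {a a′ b b′} → a ≈ a′ → b ≈ b′ → a ⊛ b ≈ a′ ⊛ b′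
  ⊛-cong p r = pointwise (conv-cong (at p) (at r))

  ⊛-comm : ∀ a b → a ⊛ b ≈ b ⊛ a
  ⊛-comm a b = pointwise (conv-comm a b)

  ⊛-assoc : ∀ a b c → (a ⊛ b) ⊛ c ≈ a ⊛ (b ⊛ c)
  ⊛-assoc a b c = pointwise (conv-assoc a b c)

  ⊛-distribʳ : ∀ c a b → (a ⊕ b) ⊛ c ≈ a ⊛ c ⊕ b ⊛ c
  ⊛-distribʳ c a b = pointwise (conv-distribʳ c a b)

_⊖_ : Series → Series → Series
a ⊖ b = a ⊕ ⊝ b

opaque
  unfolding _⊕_

  series-isCommutativeRing : IsCommutativeRing _≈_ _⊕_ _⊛_ ⊝_ (const 0ℤ) (const 1ℤ)
  series-isCommutativeRing = record
    { isRing = record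
      { +-isAbelianGroup = record
        { isGroup = record
          { isMonoid = record
            { isSemigroup = record
              { isMagma = record
                { isEquivalence = record { refl = ≈-refl ; sym = ≈-sym ; trans = ≈-trans }
                ; ∙-cong = ⊕-cong }
              ; assoc = λ a b c → pointwise λ ℓ → ℤₚ.+-assoc (a ℓ) (b ℓ) (c ℓ) }
            ; identity = (λ a → pointwise (idˡ a)) , (λ a → pointwise λ ℓ → trans (ℤₚ.+-comm (a ℓ) _) (idˡ a ℓ)) }
          ; inverse = (λ a → pointwise λ ℓ → trans (ℤₚ.+-inverseˡ (a ℓ)) (zeroes ℓ))
                    , (λ a → pointwise λ ℓ → trans (ℤₚ.+-inverseʳ (a ℓ)) (zeroes ℓ))
          ; ⁻¹-cong = ⊝-cong }
        ; comm = λ a b → pointwise λ ℓ → ℤₚ.+-comm (a ℓ) (b ℓ) }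
      ; *-cong = ⊛-cong
      ; *-assoc = ⊛-assoc
      ; *-identity = 1ˡ , (λ a → ≈-trans (⊛-comm a _) (1ˡ a))
      ; distrib = (λ c a b → ≈-trans (⊛-comm c _) (≈-trans (⊛-distribʳ c a b) (⊕-cong (⊛-comm a c) (⊛-comm b c)))) , ⊛-distribʳ
      }
    ; *-comm = ⊛-comm
    }
    where
    zeroes : ∀ ℓ → 0ℤ ≡ const 0ℤ ℓ
    zeroes zero    = refl
    zeroes (suc ℓ) = refl
    idˡ : ∀ (a : Series) ℓ → const 0ℤ ℓ ℤ.+ a ℓ ≡ a ℓ
    idˡ a ℓ = trans (cong (ℤ._+ a ℓ) (sym (zeroes ℓ))) (ℤₚ.+-identityˡ (a ℓ))
    1ˡ : ∀ (a : Series) → const 1ℤ ⊛ a ≈ a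
    1ˡ a = pointwise λ ℓ → trans (const-⊛ 1ℤ a ℓ) (ℤₚ.*-identityˡ (a ℓ))

  const-+ : ∀ x y → const (x ℤ.+ y) ≈ const x ⊕ const y
  const-+ x y = pointwise λ { zero → refl ; (suc ℓ) → refl }

  const-* : ∀ x y → const (x ℤ.* y) ≈ const x ⊛ const y
  const-* x y = pointwise λ { zero → sym (const-⊛ x (const y) 0) ; (suc ℓ) → sym (trans (const-⊛ x (const y) (suc ℓ)) (ℤₚ.*-zeroʳ x)) }

  const-neg : ∀ x → const (ℤ.- x) ≈ ⊝ const x
  const-neg x = pointwise λ { zero → refl ; (suc ℓ) → refl }

seriesRing : CommutativeRing _ _
seriesRing = record { isCommutativeRing = series-isCommutativeRing }

const-homo : CommutativeRing.rawRing ℤₚ.+-*-commutativeRing -Raw-AlmostCommutative⟶ fromCommutativeRing seriesRing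
const-homo = record
  { ⟦_⟧ = const ; +-homo = const-+ ; *-homo = const-* ; -‿homo = const-neg ; 0-homo = ≈-refl ; 1-homo = ≈-refl }

const-≟ : ∀ x y → Maybe (const x ≈ const y)
const-≟ x y with x ℤ.≟ y
... | yes refl = just ≈-refl
... | no  _    = nothing

open RingSolver (CommutativeRing.rawRing ℤₚ.+-*-commutativeRing) (fromCommutativeRing seriesRing) const-homo const-≟ using (solve; con; _:=_; _:+_; _:*_; _:-_; :-_; _:^_)

X : Series
X 1 = 1ℤ
X _ = 0ℤ

q^ : ℕ → Series
q^ zero    = const 1ℤ
q^ (suc s) = X ⊛ q^ s

module ≈-Reasoning = SetoidReasoning (CommutativeRing.setoid seriesRing)
⊕-congˡ : ∀ {a b c} → b ≈ c → a ⊕ b ≈ a ⊕ c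
⊕-congˡ = ⊕-cong ≈-refl

⊛-congˡ : ∀ {a b c} → b ≈ c → a ⊛ b ≈ a ⊛ c
⊛-congˡ = ⊛-cong ≈-refl

⊛-congʳ : ∀ {a b c} → a ≈ b → a ⊛ c ≈ b ⊛ c
⊛-congʳ p = ⊛-cong p ≈-refl

𝟙 : Series
𝟙 = const 1ℤ

X⊛-zero : ∀ a → (X ⊛ a) 0 ≡ 0ℤ
X⊛-zero a = ⊛-zero X a

X⊛-suc : ∀ a ℓ → (X ⊛ a) (suc ℓ) ≡ a ℓ
X⊛-suc a ℓ = trans (⊛-suc X a ℓ) (trans (ℤₚ.+-identityˡ _) (trans (at (⊛-congʳ shifted) ℓ) (trans (const-⊛ 1ℤ a ℓ) (ℤₚ.*-identityˡ (a ℓ)))))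
  where
  shifted : X ∘ suc ≈ 𝟙
  shifted = pointwise λ { zero → refl ; (suc _) → refl }

1⊛ : ∀ a → 𝟙 ⊛ a ≈ a
1⊛ a = pointwise λ ℓ → trans (const-⊛ 1ℤ a ℓ) (ℤₚ.*-identityˡ (a ℓ))

q^⊛-+ : ∀ s a x → (q^ s ⊛ a) (s ℕ.+ x) ≡ a x
q^⊛-+ zero    a x = at (1⊛ a) x
q^⊛-+ (suc s) a x = trans (at (⊛-assoc X (q^ s) a) (suc (s ℕ.+ x))) (trans (X⊛-suc (q^ s ⊛ a) (s ℕ.+ x)) (q^⊛-+ s a x))

q^⊛-< : ∀ s a {ℓ} → ℓ ℕ.< s → (q^ s ⊛ a) ℓ ≡ 0ℤ
q^⊛-< (suc s) a {zero}  _         = trans (at (⊛-assoc X (q^ s) a) 0) (X⊛-zero (q^ s ⊛ a))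
q^⊛-< (suc s) a {suc ℓ} (s≤s ℓ<s) = trans (at (⊛-assoc X (q^ s) a) (suc ℓ)) (trans (X⊛-suc (q^ s ⊛ a) ℓ) (q^⊛-< s a ℓ<s))

-- The index `j` is the number of zeros still to come before the next 1. Coefficients are thus
-- visibly 0 or 1, and no divisibility by `suc k` has to be decided.
countdown : ℕ → ℕ → Series
countdown k zero    zero    = 1ℤ
countdown k zero    (suc ℓ) = countdown k k ℓ
countdown k (suc j) zero    = 0ℤ
countdown k (suc j) (suc ℓ) = countdown k j ℓ

-- 1/(1 − q^{k+1}), indexed by k so that the exponent is never 0.
G : ℕ → Series
G k = countdown k 0

countdown-≈ : ∀ k j → countdown k j ≈ q^ j ⊛ G k
countdown-≈ k zero    = ≈-sym (1⊛ (G k))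
countdown-≈ k (suc j) = ≈-trans step (≈-trans (⊛-congˡ (countdown-≈ k j)) (≈-sym (⊛-assoc X (q^ j) (G k))))
  where
  step : countdown k (suc j) ≈ X ⊛ countdown k j
  step = pointwise λ { zero → sym (X⊛-zero (countdown k j)) ; (suc ℓ) → sym (X⊛-suc (countdown k j) ℓ) }

G-unfold : ∀ k → G k ≈ 𝟙 ⊕ q^ (suc k) ⊛ G k
G-unfold k = ≈-trans step (⊕-congˡ (≈-trans (⊛-congˡ (countdown-≈ k k)) (≈-sym (⊛-assoc X (q^ k) (G k)))))
  where
  step : G k ≈ 𝟙 ⊕ X ⊛ countdown k k
  step = pointwise λ { zero → sym (trans (⊕-at 𝟙 (X ⊛ countdown k k) 0) (+-congˡ 1ℤ (X⊛-zero (countdown k k))))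
                     ; (suc ℓ) → sym (trans (⊕-at 𝟙 (X ⊛ countdown k k) (suc ℓ)) (trans (ℤₚ.+-identityˡ _) (X⊛-suc (countdown k k) ℓ))) }

G-inverse : ∀ k → (𝟙 ⊖ q^ (suc k)) ⊛ G k ≈ 𝟙
G-inverse k = begin
  (𝟙 ⊖ Q) ⊛ G k              ≈⟨ solve 2 (λ Q g → (con 1ℤ :- Q) :* g := g :- Q :* g) ≈-refl Q (G k) ⟩
  G k ⊖ Q ⊛ G k              ≈⟨ ⊕-cong (G-unfold k) ≈-refl ⟩
  𝟙 ⊕ Q ⊛ G k ⊖ Q ⊛ G k      ≈⟨ solve 1 (λ y → con 1ℤ :+ y :- y := con 1ℤ) ≈-refl (Q ⊛ G k) ⟩
  𝟙                          ∎
  where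
  open ≈-Reasoning
  Q = q^ (suc k)

-- Partitions into exactly r distinct parts

e : ℕ → ℕ → Series
e n       zero    = 𝟙
e zero    (suc r) = const 0ℤ
e (suc n) (suc r) = e n (suc r) ⊕ q^ (suc n) ⊛ e n r

f : ℕ → ℕ → Series
f n zero    = e n zero
f n (suc b) = f n b ⊕ e n (suc b)

-- `e n r` is q^(r(r+1)/2) times the Gaussian binomial coefficient of n over r, and this is its
-- quotient rule. In the induction on n the instance for `suc r` replaces `e₂` by `e₁`, and the
-- instance for `r` replaces the surplus of `e₁` by `e₀`; both results carry the factor
-- `X ⊛ v ⊖ X ⊛ u`.
e-ratio : ∀ n r → (𝟙 ⊖ q^ (suc r)) ⊛ e n (suc r) ≈ (q^ (suc r) ⊖ q^ (suc n)) ⊛ e n r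
e-ratio zero zero = solve 1 (λ x → (con 1ℤ :- x) :* con 0ℤ := (x :- x) :* con 1ℤ) ≈-refl (q^ 1)
e-ratio zero (suc r) = solve 2 (λ x y → (con 1ℤ :- x) :* con 0ℤ := (x :- y) :* con 0ℤ) ≈-refl (q^ (suc (suc r))) (q^ 1)
e-ratio (suc n) zero = begin
  (𝟙 ⊖ q) ⊛ (e n 1 ⊕ Q ⊛ 𝟙)         ≈⟨ solve 3 (λ q Q a → (con 1ℤ :- q) :* (a :+ Q :* con 1ℤ) := (con 1ℤ :- q) :* a :+ (con 1ℤ :- q) :* Q) ≈-refl q Q (e n 1) ⟩
  (𝟙 ⊖ q) ⊛ e n 1 ⊕ (𝟙 ⊖ q) ⊛ Q     ≈⟨ ⊕-cong (e-ratio n 0) ≈-refl ⟩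
  (q ⊖ Q) ⊛ 𝟙 ⊕ (𝟙 ⊖ q) ⊛ Q         ≈⟨ solve 2 (λ X Q → (X :* con 1ℤ :- Q) :* con 1ℤ :+ (con 1ℤ :- X :* con 1ℤ) :* Q := (X :* con 1ℤ :- X :* Q) :* con 1ℤ) ≈-refl X Q ⟩
  (q ⊖ X ⊛ Q) ⊛ 𝟙                   ∎
  where
  open ≈-Reasoning
  q = q^ 1
  Q = q^ (suc n)
e-ratio (suc n) (suc r) = begin
  (𝟙 ⊖ X ⊛ v) ⊛ (e₂ ⊕ u ⊛ e₁)                    ≈⟨ solve 5 (λ X v u a b → (con 1ℤ :- X :* v) :* (a :+ u :* b) := (con 1ℤ :- X :* v) :* a :+ (con 1ℤ :- X :* v) :* u :* b) ≈-refl X v u e₂ e₁ ⟩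
  (𝟙 ⊖ X ⊛ v) ⊛ e₂ ⊕ (𝟙 ⊖ X ⊛ v) ⊛ u ⊛ e₁        ≈⟨ ⊕-cong (e-ratio n (suc r)) ≈-refl ⟩
  (X ⊛ v ⊖ u) ⊛ e₁ ⊕ (𝟙 ⊖ X ⊛ v) ⊛ u ⊛ e₁        ≈⟨ solve 4 (λ X v u b → (X :* v :- u) :* b :+ (con 1ℤ :- X :* v) :* u :* b := (X :* v :- X :* u) :* b :+ X :* u :* ((con 1ℤ :- v) :* b)) ≈-refl X v u e₁ ⟩
  (X ⊛ v ⊖ X ⊛ u) ⊛ e₁ ⊕ X ⊛ u ⊛ ((𝟙 ⊖ v) ⊛ e₁)  ≈⟨ ⊕-congˡ (⊛-congˡ (e-ratio n r)) ⟩
  (X ⊛ v ⊖ X ⊛ u) ⊛ e₁ ⊕ X ⊛ u ⊛ ((v ⊖ u) ⊛ e₀)  ≈⟨ solve 5 (λ X v u b a → (X :* v :- X :* u) :* b :+ X :* u :* ((v :- u) :* a) := (X :* v :- X :* u) :* (b :+ u :* a)) ≈-refl X v u e₁ e₀ ⟩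
  (X ⊛ v ⊖ X ⊛ u) ⊛ (e₁ ⊕ u ⊛ e₀)                ∎
  where
  open ≈-Reasoning
  u = q^ (suc n)
  v = q^ (suc r)
  e₂ = e n (suc (suc r))
  e₁ = e n (suc r)
  e₀ = e n r

e-suc : ∀ n r → e n (suc r) ≈ (q^ (suc r) ⊖ q^ (suc n)) ⊛ (G r ⊛ e n r)
e-suc n r = begin
  e n (suc r)                          ≈⟨ ≈-sym (1⊛ _) ⟩
  𝟙 ⊛ e n (suc r)                      ≈⟨ ⊛-congʳ (≈-sym (G-inverse r)) ⟩
  (𝟙 ⊖ v) ⊛ G r ⊛ e n (suc r)          ≈⟨ solve 3 (λ v g a → (con 1ℤ :- v) :* g :* a := g :* ((con 1ℤ :- v) :* a)) ≈-refl v (G r) (e n (suc r)) ⟩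
  G r ⊛ ((𝟙 ⊖ v) ⊛ e n (suc r))        ≈⟨ ⊛-congˡ (e-ratio n r) ⟩
  G r ⊛ ((v ⊖ u) ⊛ e n r)              ≈⟨ solve 4 (λ v u g a → g :* ((v :- u) :* a) := (v :- u) :* (g :* a)) ≈-refl v u (G r) (e n r) ⟩
  (v ⊖ u) ⊛ (G r ⊛ e n r)              ∎
  where
  open ≈-Reasoning
  u = q^ (suc n)
  v = q^ (suc r)

-- Subtracting 1 from each of the `suc r` parts leaves distinct parts at most `n`, unless the
-- smallest has become 0 and disappears. This second recursion is the mirror image of the one that
-- removes the largest part.
e-removeOne : ∀ n r → e (suc n) (suc r) ≈ q^ (suc r) ⊛ (e n (suc r) ⊕ e n r)
e-removeOne n r = begin
  a ⊕ u ⊛ b                               ≈⟨ solve 4 (λ v u a b → a :+ u :* b := (con 1ℤ :- v) :* a :+ v :* a :+ u :* b) ≈-refl v u a b ⟩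
  (𝟙 ⊖ v) ⊛ a ⊕ v ⊛ a ⊕ u ⊛ b             ≈⟨ ⊕-cong (⊕-cong (e-ratio n r) ≈-refl) ≈-refl ⟩
  (v ⊖ u) ⊛ b ⊕ v ⊛ a ⊕ u ⊛ b             ≈⟨ solve 4 (λ v u a b → (v :- u) :* b :+ v :* a :+ u :* b := v :* (a :+ b)) ≈-refl v u a b ⟩
  v ⊛ (a ⊕ b)                             ∎
  where
  open ≈-Reasoning
  u = q^ (suc n)
  v = q^ (suc r)
  a = e n (suc r)
  b = e n r

const0 : ∀ ℓ → const 0ℤ ℓ ≡ 0ℤ
const0 zero    = refl
const0 (suc ℓ) = refl

data Split (s : ℕ) : ℕ → Set where
  below : ∀ {ℓ} → ℓ ℕ.< s → Split s ℓ
  above : ∀ x → Split s (s ℕ.+ x)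

split : ∀ s ℓ → Split s ℓ
split zero    ℓ       = above ℓ
split (suc s) zero    = below (s≤s z≤n)
split (suc s) (suc ℓ) with split s ℓ
... | below ℓ<s = below (s≤s ℓ<s)
... | above x   = above x

-- The bound is not the exact degree but the reflection constant of `e-sym`: indices beyond it are
-- those without a mirror image.
e-vanish : ∀ n r {x} → r ℕ.* suc n ℕ.< x → e n r x ≡ 0ℤ
e-vanish n zero {suc x} _ = refl
e-vanish zero (suc r) {x} _ = const0 x
e-vanish (suc n) (suc r) {x} lt with split (suc n) x
... | below x<1+n = contradiction (ℕₚ.≤-trans x<1+n (ℕₚ.≤-trans (ℕₚ.n≤1+n (suc n)) (ℕₚ.m≤m+n (suc (suc n)) (r ℕ.* suc (suc n))))) (ℕₚ.<⇒≯ lt)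
... | above y = trans (⊕-at (e n (suc r)) (q^ (suc n) ⊛ e n r) _) (cong₂ ℤ._+_ (e-vanish n (suc r) (ℕₚ.≤-trans (s≤s (ℕₚ.*-monoʳ-≤ (suc r) (ℕₚ.n≤1+n (suc n)))) lt)) (trans (q^⊛-+ (suc n) (e n r) y) (e-vanish n r small)))
  where
  small : r ℕ.* suc n ℕ.< y
  small = ℕₚ.+-cancelˡ-< (suc n) _ _ (ℕₚ.≤-<-trans (ℕₚ.+-mono-≤ (ℕₚ.n≤1+n (suc n)) (ℕₚ.*-monoʳ-≤ r (ℕₚ.n≤1+n (suc n)))) lt)

e-sym : ∀ n r {x y} → x ℕ.+ y ≡ r ℕ.* suc n → e n r x ≡ e n r y
e-sym n zero {zero} {zero} eq = refl
e-sym zero (suc r) {x} {y} eq = trans (const0 x) (sym (const0 y))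
e-sym (suc n) (suc r) {x} {y} eq = trans (⊕-at (e n (suc r)) (q^ (suc n) ⊛ e n r) x) (trans (helper (split (suc n) x) (split (suc r) y) eq) (sym (at (e-removeOne n r) y)))
  where
  helper : ∀ {x y} → Split (suc n) x → Split (suc r) y → x ℕ.+ y ≡ suc r ℕ.* suc (suc n) →
           e n (suc r) x ℤ.+ (q^ (suc n) ⊛ e n r) x ≡ (q^ (suc r) ⊛ (e n (suc r) ⊕ e n r)) y
  helper {x} (below x<) (above y) eq = trans
    (cong₂ ℤ._+_ (e-sym n (suc r) {x} {y} total) (trans (q^⊛-< (suc n) (e n r) x<) (sym (e-vanish n r big))))
    (sym (trans (q^⊛-+ (suc r) (e n (suc r) ⊕ e n r) y) (⊕-at (e n (suc r)) (e n r) y)))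
    where
    total : x ℕ.+ y ≡ suc r ℕ.* suc n
    total = ℕₚ.+-cancelˡ-≡ (suc r) _ _ (trans (lhs x y r) (trans eq (rhs n r)))
      where
      lhs : ∀ x y r → suc r ℕ.+ (x ℕ.+ y) ≡ x ℕ.+ (suc r ℕ.+ y)
      lhs = ℕ-solve
      rhs : ∀ n r → suc r ℕ.* suc (suc n) ≡ suc r ℕ.+ suc r ℕ.* suc n
      rhs = ℕ-solve
    big : r ℕ.* suc n ℕ.< y
    big = ℕₚ.+-cancelˡ-< x _ _ (subst (x ℕ.+ r ℕ.* suc n ℕ.<_) (sym total) (ℕₚ.+-monoˡ-< (r ℕ.* suc n) x<))
  helper (above x) (above y) eq = trans
    (cong₂ ℤ._+_ (e-sym n (suc r) total₁) (trans (q^⊛-+ (suc n) (e n r) x) (e-sym n r total₂)))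
    (sym (trans (q^⊛-+ (suc r) (e n (suc r) ⊕ e n r) y) (⊕-at (e n (suc r)) (e n r) y)))
    where
    total₁ : suc n ℕ.+ x ℕ.+ y ≡ suc r ℕ.* suc n
    total₁ = ℕₚ.+-cancelˡ-≡ (suc r) _ _ (trans (lhs n x y r) (trans eq (rhs n r)))
      where
      lhs : ∀ n x y r → suc r ℕ.+ (suc n ℕ.+ x ℕ.+ y) ≡ suc n ℕ.+ x ℕ.+ (suc r ℕ.+ y)
      lhs = ℕ-solve
      rhs : ∀ n r → suc r ℕ.* suc (suc n) ≡ suc r ℕ.+ suc r ℕ.* suc n
      rhs = ℕ-solve
    total₂ : x ℕ.+ y ≡ r ℕ.* suc n
    total₂ = ℕₚ.+-cancelˡ-≡ (suc n) _ _ (trans (sym (ℕₚ.+-assoc (suc n) x y)) total₁)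
  helper {x} {y} s (below y<) eq = trans (cong₂ ℤ._+_ (e-vanish n (suc r) big) (zero-part s)) (sym (q^⊛-< (suc r) (e n (suc r) ⊕ e n r) y<))
    where
    big : suc r ℕ.* suc n ℕ.< x
    big = ℕₚ.+-cancelʳ-< y _ _ (subst (suc r ℕ.* suc n ℕ.+ y ℕ.<_) (trans (rhs n r) (sym eq)) (ℕₚ.+-monoʳ-< (suc r ℕ.* suc n) y<))
      where
      rhs : ∀ n r → suc r ℕ.* suc n ℕ.+ suc r ≡ suc r ℕ.* suc (suc n)
      rhs = ℕ-solve
    zero-part : Split (suc n) x → (q^ (suc n) ⊛ e n r) x ≡ 0ℤ
    zero-part (below x<) = q^⊛-< (suc n) (e n r) x<
    zero-part (above x′) = trans (q^⊛-+ (suc n) (e n r) x′) (e-vanish n r (ℕₚ.+-cancelˡ-< (suc n) _ _ big))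

-- The counting sequence as coefficients

filter-map : ∀ {A B : Set} {P : B → Set} (P? : ∀ x → Dec (P x)) (g : A → B) xs → filter P? (map g xs) ≡ map g (filter (P? ∘ g) xs)
filter-map P? g []       = refl
filter-map P? g (x ∷ xs) with P? (g x)
... | yes _ = cong (g x ∷_) (filter-map P? g xs)
... | no  _ = filter-map P? g xs

fits : (b ℓ : ℕ) (xs : List ℕ) → Dec ((length xs ℕ.≤ b) × (sum xs ≡ ℓ))
fits b ℓ xs = (length xs ≤? b) ×-dec (sum xs ℕ.≟ ℓ)

c-suc : ∀ n b ℓ → c (suc n) b ℓ ≡ c n b ℓ ℕ.+ length (filter (fits b ℓ ∘ (suc n ∷_)) (decSeqs n))
c-suc n b ℓ = trans (cong length (Listₚ.filter-++ (fits b ℓ) (decSeqs n) _))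
  (trans (Listₚ.length-++ (filter (fits b ℓ) (decSeqs n)))
    (cong (c n b ℓ ℕ.+_) (trans (cong length (filter-map (fits b ℓ) (suc n ∷_) (decSeqs n))) (Listₚ.length-map (suc n ∷_) (filter (fits b ℓ ∘ (suc n ∷_)) (decSeqs n))))))

length-filter-none : ∀ {A : Set} {P : A → Set} (P? : ∀ x → Dec (P x)) xs → (∀ x → P x → 0 ≡ 1) → length (filter P? xs) ≡ 0
length-filter-none P? [] _ = refl
length-filter-none P? (x ∷ xs) none with P? x
... | yes p = contradiction (none x p) λ ()
... | no _ = length-filter-none P? xs none

counts : ℕ → ℕ → Series
counts n b ℓ = + c n b ℓ

counts-suc-suc : ∀ n b → counts (suc n) (suc b) ≈ counts n (suc b) ⊕ q^ (suc n) ⊛ counts n b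
counts-suc-suc n b = pointwise λ ℓ → trans (cong +_ (c-suc n (suc b) ℓ)) (trans (+-congˡ (+ c n (suc b) ℓ) (helper (split (suc n) ℓ))) (sym (⊕-at (counts n (suc b)) (q^ (suc n) ⊛ counts n b) ℓ)))
  where
  helper : ∀ {ℓ} → Split (suc n) ℓ → + length (filter (fits (suc b) ℓ ∘ (suc n ∷_)) (decSeqs n)) ≡ (q^ (suc n) ⊛ counts n b) ℓ
  helper (below ℓ<) = trans (cong +_ (length-filter-none _ (decSeqs n) λ xs (_ , eq) → contradiction ℓ< (ℕₚ.≤⇒≯ (subst (suc n ℕ.≤_) eq (ℕₚ.m≤m+n (suc n) (sum xs)))))) (sym (q^⊛-< (suc n) (counts n b) ℓ<))
  helper (above x) = trans (cong (+_ ∘ length) (Listₚ.filter-≐ (fits (suc b) (suc n ℕ.+ x) ∘ (suc n ∷_)) (fits b x)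
      ((λ { (s≤s p , eq) → p , ℕₚ.+-cancelˡ-≡ (suc n) _ _ eq }) , (λ { (p , eq) → s≤s p , cong (suc n ℕ.+_) eq })) (decSeqs n)))
    (sym (q^⊛-+ (suc n) (counts n b) x))

counts-suc-zero : ∀ n → counts (suc n) 0 ≈ counts n 0
counts-suc-zero n = pointwise λ ℓ → trans (cong +_ (c-suc n 0 ℓ)) (trans (cong (λ u → + (c n 0 ℓ ℕ.+ u)) (length-filter-none (fits 0 ℓ ∘ (suc n ∷_)) (decSeqs n) λ { xs (() , _) })) (cong +_ (ℕₚ.+-identityʳ _)))

counts-zero : ∀ b → counts 0 b ≈ 𝟙
counts-zero b = pointwise λ { zero → refl ; (suc ℓ) → refl }

f-zero : ∀ b → f 0 b ≈ 𝟙
f-zero zero    = ≈-refl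
f-zero (suc b) = ≈-trans (⊕-cong (f-zero b) ≈-refl) (solve 0 (con 1ℤ :+ con 0ℤ := con 1ℤ) ≈-refl)

f-suc-suc : ∀ n b → f (suc n) (suc b) ≈ f n (suc b) ⊕ q^ (suc n) ⊛ f n b
f-suc-suc n zero    = solve 2 (λ a u → con 1ℤ :+ (a :+ u) := con 1ℤ :+ a :+ u) ≈-refl (e n 1) (q^ (suc n) ⊛ 𝟙)
f-suc-suc n (suc b) = ≈-trans (⊕-cong (f-suc-suc n b) ≈-refl)
  (solve 5 (λ x y z u v → x :+ u :* y :+ (z :+ u :* v) := x :+ z :+ u :* (y :+ v)) ≈-refl (f n (suc b)) (f n b) (e n (suc (suc b))) (q^ (suc n)) (e n (suc b)))

-- Both sides obey the recursion on whether n + 1 occurs, in which using n + 1 lowers the bound on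
-- the number of parts by one.
counts≈f : ∀ n b → counts n b ≈ f n b
counts≈f zero    b       = ≈-trans (counts-zero b) (≈-sym (f-zero b))
counts≈f (suc n) zero    = ≈-trans (counts-suc-zero n) (counts≈f n zero)
counts≈f (suc n) (suc b) = ≈-trans (counts-suc-suc n b) (≈-trans (⊕-cong (counts≈f n (suc b)) (⊛-congˡ (counts≈f n b))) (≈-sym (f-suc-suc n b)))

-- First differences and unimodality

⊖-at : ∀ a b ℓ → (a ⊖ b) ℓ ≡ a ℓ ℤ.- b ℓ
⊖-at a b ℓ = trans (⊕-at a (⊝ b) ℓ) (+-congˡ (a ℓ) (⊝-at b ℓ))

δ : Series → Series
δ a = (𝟙 ⊖ X) ⊛ a

δ-cong : ∀ {a b} → a ≈ b → δ a ≈ δ b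
δ-cong = ⊛-congˡ

δ-⊕ : ∀ a b → δ (a ⊕ b) ≈ δ a ⊕ δ b
δ-⊕ a b = solve 3 (λ x a b → x :* (a :+ b) := x :* a :+ x :* b) ≈-refl (𝟙 ⊖ X) a b

δ-unfold : ∀ a → δ a ≈ a ⊖ X ⊛ a
δ-unfold a = solve 2 (λ x a → (con 1ℤ :- x) :* a := a :- x :* a) ≈-refl X a

δ-suc : ∀ a ℓ → δ a (suc ℓ) ≡ a (suc ℓ) ℤ.- a ℓ
δ-suc a ℓ = trans (at (δ-unfold a) (suc ℓ)) (trans (⊖-at a (X ⊛ a) (suc ℓ)) (cong (λ u → a (suc ℓ) ℤ.- u) (X⊛-suc a ℓ)))

δ-zero : ∀ a → δ a 0 ≡ a 0
δ-zero a = trans (at (δ-unfold a) 0) (trans (⊖-at a (X ⊛ a) 0) (trans (cong (λ u → a 0 ℤ.- u) (X⊛-zero a)) (ℤₚ.+-identityʳ (a 0))))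

d : ℕ → ℕ → Series
d n r = δ (e n r)

D : ℕ → ℕ → Series
D n b = δ (f n b)

D-suc : ∀ n b → D n (suc b) ≈ D n b ⊕ d n (suc b)
D-suc n b = δ-⊕ (f n b) (e n (suc b))

d-suc : ∀ n r → d n (suc r) ≈ (q^ (suc r) ⊖ q^ (suc n)) ⊛ (G r ⊛ d n r)
d-suc n r = ≈-trans (δ-cong (e-suc n r))
  (solve 4 (λ x p g a → x :* (p :* (g :* a)) := p :* (g :* (x :* a))) ≈-refl (𝟙 ⊖ X) (q^ (suc r) ⊖ q^ (suc n)) (G r) (e n r))

d-one : ∀ n → d n 1 ≈ X ⊖ q^ (suc n)
d-one n = begin
  d n 1                                                ≈⟨ d-suc n 0 ⟩
  (X ⊛ 𝟙 ⊖ Q) ⊛ (G 0 ⊛ ((𝟙 ⊖ X) ⊛ 𝟙))                  ≈⟨ solve 3 (λ X Q g → (X :* con 1ℤ :- Q) :* (g :* ((con 1ℤ :- X) :* con 1ℤ)) := (X :- Q) :* ((con 1ℤ :- X :* con 1ℤ) :* g)) ≈-refl X Q (G 0) ⟩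
  (X ⊖ Q) ⊛ ((𝟙 ⊖ X ⊛ 𝟙) ⊛ G 0)                        ≈⟨ ⊛-congˡ (G-inverse 0) ⟩
  (X ⊖ Q) ⊛ 𝟙                                          ≈⟨ solve 1 (λ a → a :* con 1ℤ := a) ≈-refl (X ⊖ Q) ⟩
  X ⊖ Q                                                ∎
  where
  open ≈-Reasoning
  Q = q^ (suc n)

D-one : ∀ n → D n 1 ≈ 𝟙 ⊖ q^ (suc n)
D-one n = ≈-trans (D-suc n 0) (≈-trans (⊕-congˡ (d-one n))
  (solve 2 (λ X Q → (con 1ℤ :- X) :* con 1ℤ :+ (X :- Q) := con 1ℤ :- Q) ≈-refl X (q^ (suc n))))

⊛-nonneg : ∀ {a b} ℓ → (∀ i → 0ℤ ℤ.≤ a i) → (∀ i → i ℕ.≤ ℓ → 0ℤ ℤ.≤ b i) → 0ℤ ℤ.≤ (a ⊛ b) ℓ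
⊛-nonneg {a} {b} ℓ 0≤a 0≤b = go a ℓ 0≤a 0≤b
  where
  *-nonneg : ∀ {x y} → 0ℤ ℤ.≤ x → 0ℤ ℤ.≤ y → 0ℤ ℤ.≤ x ℤ.* y
  *-nonneg {+ x} {+ y} _ _ = subst (0ℤ ℤ.≤_) (ℤₚ.pos-* x y) (ℤ.+≤+ z≤n)
  go : ∀ a ℓ → (∀ i → 0ℤ ℤ.≤ a i) → (∀ i → i ℕ.≤ ℓ → 0ℤ ℤ.≤ b i) → 0ℤ ℤ.≤ (a ⊛ b) ℓ
  go a zero    0≤a 0≤b = subst (0ℤ ℤ.≤_) (sym (⊛-zero a b)) (*-nonneg (0≤a 0) (0≤b 0 z≤n))
  go a (suc ℓ) 0≤a 0≤b = subst (0ℤ ℤ.≤_) (sym (⊛-suc a b ℓ))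
    (ℤₚ.+-mono-≤ (*-nonneg (0≤a 0) (0≤b (suc ℓ) ℕₚ.≤-refl)) (go (a ∘ suc) ℓ (0≤a ∘ suc) (λ i i≤ℓ → 0≤b i (ℕₚ.m≤n⇒m≤1+n i≤ℓ))))

countdown-nonneg : ∀ k j ℓ → 0ℤ ℤ.≤ countdown k j ℓ
countdown-nonneg k zero    zero    = ℤ.+≤+ z≤n
countdown-nonneg k zero    (suc ℓ) = countdown-nonneg k k ℓ
countdown-nonneg k (suc j) zero    = ℤ.+≤+ z≤n
countdown-nonneg k (suc j) (suc ℓ) = countdown-nonneg k j ℓ

G-nonneg : ∀ k ℓ → 0ℤ ℤ.≤ G k ℓ
G-nonneg k = countdown-nonneg k 0

const-nonneg : ∀ z → 0ℤ ℤ.≤ z → ∀ ℓ → 0ℤ ℤ.≤ const z ℓ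
const-nonneg z p zero    = p
const-nonneg z p (suc ℓ) = ℤₚ.≤-refl

q^⊛-nonneg : ∀ s {a} ℓ → (∀ i → i ℕ.≤ ℓ → 0ℤ ℤ.≤ a i) → 0ℤ ℤ.≤ (q^ s ⊛ a) ℓ
q^⊛-nonneg s {a} ℓ 0≤a with split s ℓ
... | below ℓ<s = ℤₚ.≤-reflexive (sym (q^⊛-< s a ℓ<s))
... | above x   = subst (0ℤ ℤ.≤_) (sym (q^⊛-+ s a x)) (0≤a x (ℕₚ.m≤n+m x s))

[q^-q^]⊛-< : ∀ s m a {ℓ} → ℓ ℕ.< m → ((q^ s ⊖ q^ m) ⊛ a) ℓ ≡ (q^ s ⊛ a) ℓ
[q^-q^]⊛-< s m a {ℓ} ℓ<m = begin
  ((q^ s ⊖ q^ m) ⊛ a) ℓ                ≡⟨ at (solve 3 (λ p r a → (p :- r) :* a := p :* a :- r :* a) ≈-refl (q^ s) (q^ m) a) ℓ ⟩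
  (q^ s ⊛ a ⊖ q^ m ⊛ a) ℓ              ≡⟨ ⊖-at (q^ s ⊛ a) (q^ m ⊛ a) ℓ ⟩
  (q^ s ⊛ a) ℓ ℤ.- (q^ m ⊛ a) ℓ        ≡⟨ cong (λ u → (q^ s ⊛ a) ℓ ℤ.- u) (q^⊛-< m a ℓ<m) ⟩
  (q^ s ⊛ a) ℓ ℤ.+ 0ℤ                  ≡⟨ ℤₚ.+-identityʳ _ ⟩
  (q^ s ⊛ a) ℓ                         ∎
  where open ≡-Reasoning

q^-at-< : ∀ s {ℓ} → ℓ ℕ.< s → q^ s ℓ ≡ 0ℤ
q^-at-< s {ℓ} ℓ<s = trans (at (solve 1 (λ x → x := x :* con 1ℤ) ≈-refl (q^ s)) ℓ) (q^⊛-< s 𝟙 ℓ<s)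

q^-at-+ : ∀ s x → q^ s (s ℕ.+ x) ≡ 𝟙 x
q^-at-+ s x = trans (at (solve 1 (λ x → x := x :* con 1ℤ) ≈-refl (q^ s)) (s ℕ.+ x)) (q^⊛-+ s 𝟙 x)

-- Below degree `suc n` each factor `q^ (suc r) ⊖ q^ (suc n)` of `d-suc` acts as `q^ (suc r)`, and
-- the factor 1 - q has been cancelled by the denominator of the first part, as `d-one` shows. Only
-- nonnegative series remain.
d-nonneg-low : ∀ n r ℓ → ℓ ℕ.≤ n → 0ℤ ℤ.≤ d n (suc r) ℓ
d-nonneg-low n zero ℓ ℓ≤n = subst (0ℤ ℤ.≤_) (sym value) (X-nonneg ℓ)
  where
  X-nonneg : ∀ ℓ → 0ℤ ℤ.≤ X ℓ
  X-nonneg 0             = ℤ.+≤+ z≤n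
  X-nonneg 1             = ℤ.+≤+ z≤n
  X-nonneg (suc (suc _)) = ℤ.+≤+ z≤n
  value : d n 1 ℓ ≡ X ℓ
  value = trans (at (d-one n) ℓ) (trans (⊖-at X (q^ (suc n)) ℓ)
    (trans (cong (λ u → X ℓ ℤ.- u) (q^-at-< (suc n) (s≤s ℓ≤n))) (ℤₚ.+-identityʳ (X ℓ))))
d-nonneg-low n (suc r) ℓ ℓ≤n = subst (0ℤ ℤ.≤_)
  (sym (trans (at (d-suc n (suc r)) ℓ) ([q^-q^]⊛-< (suc (suc r)) (suc n) (G (suc r) ⊛ d n (suc r)) (s≤s ℓ≤n))))
  (q^⊛-nonneg (suc (suc r)) ℓ λ i i≤ℓ → ⊛-nonneg i (G-nonneg (suc r)) λ j j≤i → d-nonneg-low n r j (ℕₚ.≤-trans j≤i (ℕₚ.≤-trans i≤ℓ ℓ≤n)))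

-- At least one part is allowed, since the negative coefficient of `d n 0`, which is 1 - q, is
-- cancelled by the q in `d n 1`.
D-nonneg-low : ∀ n b ℓ → ℓ ℕ.≤ n → 0ℤ ℤ.≤ D n (suc b) ℓ
D-nonneg-low n zero ℓ ℓ≤n = subst (0ℤ ℤ.≤_) (sym value) (const-nonneg 1ℤ (ℤ.+≤+ z≤n) ℓ)
  where
  value : D n 1 ℓ ≡ 𝟙 ℓ
  value = trans (at (D-one n) ℓ) (trans (⊖-at 𝟙 (q^ (suc n)) ℓ)
    (trans (cong (λ u → 𝟙 ℓ ℤ.- u) (q^-at-< (suc n) (s≤s ℓ≤n))) (ℤₚ.+-identityʳ (𝟙 ℓ))))
D-nonneg-low n (suc b) ℓ ℓ≤n = subst (0ℤ ℤ.≤_) (sym (trans (at (D-suc n (suc b)) ℓ) (⊕-at (D n (suc b)) (d n (suc (suc b))) ℓ)))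
  (ℤₚ.+-mono-≤ (D-nonneg-low n b ℓ ℓ≤n) (d-nonneg-low n (suc b) ℓ ℓ≤n))

-- Differencing moves the centre of symmetry by one half, hence the `suc`. At index 0 the difference
-- is the coefficient itself; its mirror index is one beyond the range of `e-sym`, where `e-vanish`
-- supplies the missing 0.
d-antisym : ∀ n r {x y} → x ℕ.+ y ≡ suc (r ℕ.* suc n) → d n r x ≡ ℤ.- d n r y
d-antisym n r {zero} {suc y} eq = begin
  δ (e n r) 0                        ≡⟨ δ-zero (e n r) ⟩
  e n r 0                            ≡⟨ e-sym n r {0} {y} y≡ ⟩
  e n r y                            ≡⟨ flip (e n r y) ⟩
  ℤ.- (0ℤ ℤ.- e n r y)               ≡⟨ cong (λ u → ℤ.- (u ℤ.- e n r y)) (sym (e-vanish n r {suc y} (s≤s (ℕₚ.≤-reflexive (sym y≡))))) ⟩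
  ℤ.- (e n r (suc y) ℤ.- e n r y)    ≡⟨ cong ℤ.-_ (sym (δ-suc (e n r) y)) ⟩
  ℤ.- δ (e n r) (suc y)              ∎
  where
  open ≡-Reasoning
  y≡ : y ≡ r ℕ.* suc n
  y≡ = ℕₚ.suc-injective eq
  flip : ∀ u → u ≡ ℤ.- (0ℤ ℤ.- u)
  flip = solve-∀
d-antisym n r {suc x} {zero} eq = trans (sym (ℤₚ.neg-involutive (d n r (suc x)))) (cong ℤ.-_ (sym (d-antisym n r {0} {suc x} (trans (ℕₚ.+-comm 0 (suc x)) eq))))
d-antisym n r {suc x} {suc y} eq = begin
  δ (e n r) (suc x)                        ≡⟨ δ-suc (e n r) x ⟩
  e n r (suc x) ℤ.- e n r x                ≡⟨ cong₂ ℤ._-_ (e-sym n r {suc x} {y} sum₁) (e-sym n r {x} {suc y} sum₂) ⟩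
  e n r y ℤ.- e n r (suc y)                ≡⟨ flip (e n r y) (e n r (suc y)) ⟩
  ℤ.- (e n r (suc y) ℤ.- e n r y)          ≡⟨ cong ℤ.-_ (sym (δ-suc (e n r) y)) ⟩
  ℤ.- δ (e n r) (suc y)                    ∎
  where
  open ≡-Reasoning
  sum₂ : x ℕ.+ suc y ≡ r ℕ.* suc n
  sum₂ = ℕₚ.suc-injective eq
  sum₁ : suc x ℕ.+ y ≡ r ℕ.* suc n
  sum₁ = trans (sym (ℕₚ.+-suc x y)) sum₂
  flip : ∀ u v → u ℤ.- v ≡ ℤ.- (v ℤ.- u)
  flip = solve-∀

d-vanish : ∀ n r {ℓ} → suc (r ℕ.* suc n) ℕ.< ℓ → d n r ℓ ≡ 0ℤ
d-vanish n r {suc ℓ} (s≤s lt) = trans (δ-suc (e n r) ℓ) (cong₂ ℤ._-_ (e-vanish n r (ℕₚ.m<n⇒m<1+n lt)) (e-vanish n r lt))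

-- A bound on the lower half of the symmetric polynomial e n r gives the opposite bound on the upper half.
d-nonpos : ∀ n r ℓ → (∀ y → ℓ ℕ.+ y ≡ suc (r ℕ.* suc n) → 0ℤ ℤ.≤ d n r y) → d n r ℓ ℤ.≤ 0ℤ
d-nonpos n r ℓ low with ℕₚ.≤-total ℓ (suc (r ℕ.* suc n))
... | inj₁ ℓ≤ with ℕₚ.m≤n⇒∃[o]m+o≡n ℓ≤
...   | y , eq = subst (ℤ._≤ 0ℤ) (sym (d-antisym n r eq)) (ℤₚ.neg-mono-≤ (low y eq))
d-nonpos n r ℓ low | inj₂ ℓ≥ with ℕₚ.m≤n⇒m<n∨m≡n ℓ≥
...   | inj₁ lt   = ℤₚ.≤-reflexive (d-vanish n r lt)
...   | inj₂ refl = subst (ℤ._≤ 0ℤ) (sym (d-antisym n r {y = 0} (ℕₚ.+-identityʳ _))) (ℤₚ.neg-mono-≤ (low 0 (ℕₚ.+-identityʳ _)))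

D-vanish : ∀ n b {ℓ} → suc (b ℕ.* suc n) ℕ.< ℓ → D n b ℓ ≡ 0ℤ
D-vanish n zero    lt = d-vanish n zero lt
D-vanish n (suc b) {ℓ} lt = trans (at (D-suc n b) ℓ) (trans (⊕-at (D n b) (d n (suc b)) ℓ)
  (cong₂ ℤ._+_ (D-vanish n b (ℕₚ.≤-<-trans (s≤s (ℕₚ.m≤n+m (b ℕ.* suc n) (suc n))) lt)) (d-vanish n (suc b) lt)))

D-nonpos-high : ∀ n b ℓ → suc (b ℕ.* suc n) ℕ.< ℓ → D n (suc b) ℓ ℤ.≤ 0ℤ
D-nonpos-high n b ℓ lt = subst (ℤ._≤ 0ℤ) (sym value) (d-nonpos n (suc b) ℓ λ y eq → d-nonneg-low n b y (small eq))
  where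
  value : D n (suc b) ℓ ≡ d n (suc b) ℓ
  value = trans (at (D-suc n b) ℓ) (trans (⊕-at (D n b) (d n (suc b)) ℓ) (trans (cong (ℤ._+ d n (suc b) ℓ) (D-vanish n b lt)) (ℤₚ.+-identityˡ _)))
  small : ∀ {y} → ℓ ℕ.+ y ≡ suc (suc b ℕ.* suc n) → y ℕ.≤ n
  small {y} eq = ℕₚ.+-cancelˡ-≤ (suc (suc (b ℕ.* suc n))) y n (ℕₚ.≤-trans (ℕₚ.+-monoˡ-≤ y lt) (ℕₚ.≤-reflexive (trans eq (shuffle n (b ℕ.* suc n)))))
    where
    shuffle : ∀ n t → suc (suc n ℕ.+ t) ≡ suc (suc t) ℕ.+ n
    shuffle = ℕ-solve

c≡f : ∀ n b ℓ → + c n b ℓ ≡ f n b ℓ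
c≡f n b ℓ = at (counts≈f n b) ℓ

D≡Δc : ∀ n b ℓ → D n b (suc ℓ) ≡ + c n b (suc ℓ) ℤ.- + c n b ℓ
D≡Δc n b ℓ = trans (δ-suc (f n b) ℓ) (cong₂ ℤ._-_ (sym (c≡f n b (suc ℓ))) (sym (c≡f n b ℓ)))

unimodal-cut : ∀ n b L → (∀ ℓ → ℓ ℕ.≤ L → 0ℤ ℤ.≤ D n b ℓ) → (∀ ℓ → L ℕ.< ℓ → D n b ℓ ℤ.≤ 0ℤ) → Unimodal (c n b)
unimodal-cut n b L up down =
    L
  , (λ i i<L → ℤₚ.drop‿+≤+ (ℤₚ.0≤i-j⇒j≤i (subst (0ℤ ℤ.≤_) (D≡Δc n b i) (up (suc i) i<L))))
  , (λ i L≤i → ℤₚ.drop‿+≤+ (ℤₚ.i-j≤0⇒i≤j (subst (ℤ._≤ 0ℤ) (D≡Δc n b i) (down (suc i) (s≤s L≤i)))))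

-- The sign change is found by search: the left end advances while the difference is nonnegative,
-- and at the first negative one `mono` keeps all later differences of the window nonpositive.
unimodal-window : ∀ n b w L → (∀ ℓ → ℓ ℕ.≤ L → 0ℤ ℤ.≤ D n b ℓ) → (∀ ℓ → w ℕ.+ L ℕ.< ℓ → D n b ℓ ℤ.≤ 0ℤ) →
                  (∀ ℓ → L ℕ.< ℓ → ℓ ℕ.< w ℕ.+ L → D n b (suc ℓ) ℤ.≤ D n b ℓ) → Unimodal (c n b)
unimodal-window n b zero    L up down mono = unimodal-cut n b L up down
unimodal-window n b (suc w) L up down mono with 0ℤ ℤ.≤? D n b (suc L)
... | yes 0≤D = unimodal-window n b w (suc L) up′
  (λ ℓ lt → down ℓ (subst (ℕ._< ℓ) (ℕₚ.+-suc w L) lt))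
  (λ ℓ lt₁ lt₂ → mono ℓ (ℕₚ.<-trans (ℕₚ.n<1+n L) lt₁) (subst (ℓ ℕ.<_) (ℕₚ.+-suc w L) lt₂))
  where
  up′ : ∀ ℓ → ℓ ℕ.≤ suc L → 0ℤ ℤ.≤ D n b ℓ
  up′ ℓ ℓ≤ with ℕₚ.m≤n⇒m<n∨m≡n ℓ≤
  ... | inj₁ (s≤s lt) = up ℓ lt
  ... | inj₂ refl     = 0≤D
... | no 0≰D = unimodal-cut n b L up down′
  where
  descend : ∀ j → suc L ℕ.+ j ℕ.≤ suc w ℕ.+ L → D n b (suc L ℕ.+ j) ℤ.≤ 0ℤ
  descend zero    _  = subst (λ u → D n b u ℤ.≤ 0ℤ) (sym (ℕₚ.+-identityʳ (suc L))) (ℤₚ.<⇒≤ (ℤₚ.≰⇒> 0≰D))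
  descend (suc j) le = subst (λ u → D n b u ℤ.≤ 0ℤ) (sym (ℕₚ.+-suc (suc L) j))
    (ℤₚ.≤-trans (mono (suc L ℕ.+ j) (s≤s (ℕₚ.m≤m+n L j)) le′) (descend j (ℕₚ.<⇒≤ le′)))
    where
    le′ : suc L ℕ.+ j ℕ.< suc w ℕ.+ L
    le′ = subst (ℕ._≤ suc w ℕ.+ L) (ℕₚ.+-suc (suc L) j) le
  down′ : ∀ ℓ → L ℕ.< ℓ → D n b ℓ ℤ.≤ 0ℤ
  down′ ℓ lt with ℓ ≤? suc w ℕ.+ L
  ... | no ℓ≰ = down ℓ (ℕₚ.≰⇒> ℓ≰)
  ... | yes ℓ≤ with ℕₚ.m≤n⇒∃[o]m+o≡n lt
  ...   | j , refl = descend j ℓ≤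

-- Growth of coefficients, uniformly in n

Family : Set
Family = ℕ → Series

infixr 4 _by_
-- One factor serves all `n`. The base is `suc ℓ` so that the bound stays meaningful at index 0 and
-- a larger exponent gives a weaker bound.
record Bounded (j : ℕ) (a : Family) : Set where
  constructor _by_
  field
    factor : ℕ
    bound  : ∀ n ℓ → ∣ a n ℓ ∣ ℕ.≤ factor ℕ.* suc ℓ ℕ.^ j

bounded-≈ : ∀ {j a b} → (∀ n → a n ≈ b n) → Bounded j a → Bounded j b
bounded-≈ {j} a≈b (K by bound) = K by λ n ℓ → subst (λ u → ∣ u ∣ ℕ.≤ K ℕ.* suc ℓ ℕ.^ j) (at (a≈b n) ℓ) (bound n ℓ)

bounded-suc : ∀ {j a} → Bounded j a → Bounded (suc j) a
bounded-suc {j} (K by bound) = K by λ n ℓ → ℕₚ.≤-trans (bound n ℓ) (ℕₚ.*-monoʳ-≤ K (ℕₚ.m≤m+n (suc ℓ ℕ.^ j) _))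

bounded-⊕ : ∀ {j a b} → Bounded j a → Bounded j b → Bounded j (λ n → a n ⊕ b n)
bounded-⊕ {j} {a} {b} (K by p) (L by r) = K ℕ.+ L by λ n ℓ → subst (λ u → ∣ u ∣ ℕ.≤ (K ℕ.+ L) ℕ.* suc ℓ ℕ.^ j) (sym (⊕-at (a n) (b n) ℓ))
  (ℕₚ.≤-trans (ℤₚ.∣i+j∣≤∣i∣+∣j∣ (a n ℓ) (b n ℓ))
    (ℕₚ.≤-trans (ℕₚ.+-mono-≤ (p n ℓ) (r n ℓ)) (ℕₚ.≤-reflexive (sym (ℕₚ.*-distribʳ-+ (suc ℓ ℕ.^ j) K L)))))

bounded-⊝ : ∀ {j a} → Bounded j a → Bounded j (λ n → ⊝ a n)
bounded-⊝ {j} {a} (K by p) = K by λ n ℓ → subst (ℕ._≤ K ℕ.* suc ℓ ℕ.^ j) (sym (trans (cong ∣_∣ (⊝-at (a n) ℓ)) (ℤₚ.∣-i∣≡∣i∣ (a n ℓ)))) (p n ℓ)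

bounded-const : ∀ {j a} z → Bounded j a → Bounded j (λ n → const z ⊛ a n)
bounded-const {j} {a} z (K by p) = ∣ z ∣ ℕ.* K by λ n ℓ → subst (ℕ._≤ ∣ z ∣ ℕ.* K ℕ.* suc ℓ ℕ.^ j)
  (sym (trans (cong ∣_∣ (const-⊛ z (a n) ℓ)) (ℤₚ.abs-* z (a n ℓ))))
  (ℕₚ.≤-trans (ℕₚ.*-monoʳ-≤ ∣ z ∣ (p n ℓ)) (ℕₚ.≤-reflexive (sym (ℕₚ.*-assoc ∣ z ∣ K _))))

-- A shift, even by an amount depending on `n`, only evaluates `a` at a smaller index, so the factor
-- is unchanged. Uniformity in `n` rests on this.
bounded-q^ : ∀ {j a} (s : ℕ → ℕ) → Bounded j a → Bounded j (λ n → q^ (s n) ⊛ a n)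
bounded-q^ {j} {a} s (K by p) = K by bound
  where
  bound : ∀ n ℓ → ∣ (q^ (s n) ⊛ a n) ℓ ∣ ℕ.≤ K ℕ.* suc ℓ ℕ.^ j
  bound n ℓ with split (s n) ℓ
  ... | below lt = subst (λ u → ∣ u ∣ ℕ.≤ K ℕ.* suc ℓ ℕ.^ j) (sym (q^⊛-< (s n) (a n) lt)) z≤n
  ... | above x  = subst (λ u → ∣ u ∣ ℕ.≤ K ℕ.* suc (s n ℕ.+ x) ℕ.^ j) (sym (q^⊛-+ (s n) (a n) x))
    (ℕₚ.≤-trans (p n x) (ℕₚ.*-monoʳ-≤ K (ℕₚ.^-monoˡ-≤ j (s≤s (ℕₚ.m≤n+m x (s n))))))

∣⊛∣-bound : ∀ a b ℓ K → (∀ i → ∣ a i ∣ ℕ.≤ 1) → (∀ i → i ℕ.≤ ℓ → ∣ b i ∣ ℕ.≤ K) → ∣ (a ⊛ b) ℓ ∣ ℕ.≤ K ℕ.* suc ℓ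
∣⊛∣-bound a b ℓ K p = go a ℓ p
  where
  term : ∀ x y → ∣ x ∣ ℕ.≤ 1 → ∣ y ∣ ℕ.≤ K → ∣ x ℤ.* y ∣ ℕ.≤ K
  term x y p r = subst (ℕ._≤ K) (sym (ℤₚ.abs-* x y)) (ℕₚ.≤-trans (ℕₚ.*-mono-≤ p r) (ℕₚ.≤-reflexive (ℕₚ.*-identityˡ K)))
  go : ∀ a ℓ → (∀ i → ∣ a i ∣ ℕ.≤ 1) → (∀ i → i ℕ.≤ ℓ → ∣ b i ∣ ℕ.≤ K) → ∣ (a ⊛ b) ℓ ∣ ℕ.≤ K ℕ.* suc ℓ
  go a zero p r = subst (λ u → ∣ u ∣ ℕ.≤ K ℕ.* 1) (sym (⊛-zero a b)) (subst (∣ a 0 ℤ.* b 0 ∣ ℕ.≤_) (sym (ℕₚ.*-identityʳ K)) (term (a 0) (b 0) (p 0) (r 0 z≤n)))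
  go a (suc ℓ) p r = subst (λ u → ∣ u ∣ ℕ.≤ K ℕ.* suc (suc ℓ)) (sym (⊛-suc a b ℓ))
    (ℕₚ.≤-trans (ℤₚ.∣i+j∣≤∣i∣+∣j∣ (a 0 ℤ.* b (suc ℓ)) (((a ∘ suc) ⊛ b) ℓ))
      (ℕₚ.≤-trans (ℕₚ.+-mono-≤ (term (a 0) (b (suc ℓ)) (p 0) (r (suc ℓ) ℕₚ.≤-refl)) (go (a ∘ suc) ℓ (p ∘ suc) (λ i i≤ → r i (ℕₚ.m≤n⇒m≤1+n i≤))))
        (ℕₚ.≤-reflexive (sym (ℕₚ.*-suc K (suc ℓ))))))

∣countdown∣≤1 : ∀ k j ℓ → ∣ countdown k j ℓ ∣ ℕ.≤ 1
∣countdown∣≤1 k zero    zero    = ℕₚ.≤-refl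
∣countdown∣≤1 k zero    (suc ℓ) = ∣countdown∣≤1 k k ℓ
∣countdown∣≤1 k (suc j) zero    = z≤n
∣countdown∣≤1 k (suc j) (suc ℓ) = ∣countdown∣≤1 k j ℓ

bounded-G⊛ : ∀ {j a} k → Bounded j a → Bounded (suc j) (λ n → G k ⊛ a n)
bounded-G⊛ {j} {a} k (K by p) = K by λ n ℓ → ℕₚ.≤-trans
  (∣⊛∣-bound (G k) (a n) ℓ (K ℕ.* suc ℓ ℕ.^ j) (∣countdown∣≤1 k 0) (λ i i≤ℓ → ℕₚ.≤-trans (p n i) (ℕₚ.*-monoʳ-≤ K (ℕₚ.^-monoˡ-≤ j (s≤s i≤ℓ)))))
  (ℕₚ.≤-reflexive (shuffle K (suc ℓ ℕ.^ j) (suc ℓ)))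
  where
  shuffle : ∀ K x y → K ℕ.* x ℕ.* y ≡ K ℕ.* (y ℕ.* x)
  shuffle = ℕ-solve

bounded-G : ∀ k → Bounded 0 (λ _ → G k)
bounded-G k = 1 by λ _ ℓ → ∣countdown∣≤1 k 0 ℓ

bounded-𝟙 : Bounded 0 (λ _ → 𝟙)
bounded-𝟙 = 1 by λ { _ zero → ℕₚ.≤-refl ; _ (suc _) → z≤n }

-- Multiplication by z raises the growth exponent by at most k.
record Raises (k : ℕ) (z : Family) : Set where
  constructor raising
  field raise : ∀ {j a} → Bounded j a → Bounded (k ℕ.+ j) (λ n → z n ⊛ a n)
open Raises

raises-≈ : ∀ {k z w} → (∀ n → z n ≈ w n) → Raises k z → Raises k w
raises-≈ z≈w p = raising λ bd → bounded-≈ (λ n → ⊛-congʳ (z≈w n)) (raise p bd)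

raises-⊕ : ∀ {k z w} → Raises k z → Raises k w → Raises k (λ n → z n ⊕ w n)
raises-⊕ {z = z} {w} p r = raising λ {_} {a} bd → bounded-≈ (λ n → ≈-sym (⊛-distribʳ (a n) (z n) (w n))) (bounded-⊕ (raise p bd) (raise r bd))

raises-⊝ : ∀ {k z} → Raises k z → Raises k (λ n → ⊝ z n)
raises-⊝ {z = z} p = raising λ {_} {a} bd → bounded-≈ (λ n → solve 2 (λ z a → :- (z :* a) := (:- z) :* a) ≈-refl (z n) (a n)) (bounded-⊝ (raise p bd))

raises-⊖ : ∀ {k z w} → Raises k z → Raises k w → Raises k (λ n → z n ⊖ w n)
raises-⊖ p r = raises-⊕ p (raises-⊝ r)

raises-⊛ : ∀ {k l z w} → Raises k z → Raises l w → Raises (k ℕ.+ l) (λ n → z n ⊛ w n)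
raises-⊛ {k} {l} {z} {w} p r = raising λ {j} {a} bd → bounded-≈ (λ n → ≈-sym (⊛-assoc (z n) (w n) (a n)))
  (subst (λ u → Bounded u (λ n → z n ⊛ (w n ⊛ a n))) (sym (ℕₚ.+-assoc k l j)) (raise p (raise r bd)))

raises-const : ∀ z → Raises 0 (λ _ → const z)
raises-const z = raising (bounded-const z)

raises-q^ : ∀ s → Raises 0 (λ n → q^ (s n))
raises-q^ s = raising (bounded-q^ s)

raises-X : Raises 0 (λ _ → X)
raises-X = raises-≈ (λ _ → solve 1 (λ x → x :* con 1ℤ := x) ≈-refl X) (raises-q^ (λ _ → 1))

raises-G : ∀ k → Raises 1 (λ _ → G k)
raises-G k = raising (bounded-G⊛ k)

-- Comparison of r! e n r with the powers of B

S : ℕ → Series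
S zero    = const 0ℤ
S (suc i) = 𝟙 ⊕ X ⊛ S i

-- The quotient of i - `S i` by 1 - q, which is a polynomial because `S i` has the value i at q = 1.
R : ℕ → Series
R zero    = const 0ℤ
R (suc i) = R i ⊕ S i

raises-S : ∀ i → Raises 0 (λ _ → S i)
raises-S zero    = raises-const 0ℤ
raises-S (suc i) = raises-⊕ (raises-const 1ℤ) (raises-⊛ raises-X (raises-S i))

raises-R : ∀ i → Raises 0 (λ _ → R i)
raises-R zero    = raises-const 0ℤ
raises-R (suc i) = raises-⊕ (raises-R i) (raises-S i)

S-closed : ∀ i → (𝟙 ⊖ X) ⊛ S i ≈ 𝟙 ⊖ q^ i
S-closed zero    = solve 1 (λ X → (con 1ℤ :- X) :* con 0ℤ := con 1ℤ :- con 1ℤ) ≈-refl X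
S-closed (suc i) = begin
  (𝟙 ⊖ X) ⊛ (𝟙 ⊕ X ⊛ S i)          ≈⟨ solve 2 (λ X s → (con 1ℤ :- X) :* (con 1ℤ :+ X :* s) := con 1ℤ :- X :+ X :* ((con 1ℤ :- X) :* s)) ≈-refl X (S i) ⟩
  𝟙 ⊖ X ⊕ X ⊛ ((𝟙 ⊖ X) ⊛ S i)      ≈⟨ ⊕-congˡ (⊛-congˡ (S-closed i)) ⟩
  𝟙 ⊖ X ⊕ X ⊛ (𝟙 ⊖ q^ i)           ≈⟨ solve 2 (λ X p → con 1ℤ :- X :+ X :* (con 1ℤ :- p) := con 1ℤ :- X :* p) ≈-refl X (q^ i) ⟩
  𝟙 ⊖ X ⊛ q^ i                     ∎
  where open ≈-Reasoning

R-closed : ∀ i → (𝟙 ⊖ X) ⊛ R i ≈ const (+ i) ⊖ S i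
R-closed zero    = solve 1 (λ X → (con 1ℤ :- X) :* con 0ℤ := con 0ℤ :- con 0ℤ) ≈-refl X
R-closed (suc i) = begin
  (𝟙 ⊖ X) ⊛ (R i ⊕ S i)                             ≈⟨ solve 3 (λ X r s → (con 1ℤ :- X) :* (r :+ s) := (con 1ℤ :- X) :* r :+ (con 1ℤ :- X) :* s) ≈-refl X (R i) (S i) ⟩
  (𝟙 ⊖ X) ⊛ R i ⊕ (𝟙 ⊖ X) ⊛ S i                     ≈⟨ ⊕-cong (R-closed i) ≈-refl ⟩
  const (+ i) ⊖ S i ⊕ (𝟙 ⊖ X) ⊛ S i                 ≈⟨ solve 3 (λ X c s → c :- s :+ (con 1ℤ :- X) :* s := con 1ℤ :+ c :- (con 1ℤ :+ X :* s)) ≈-refl X (const (+ i)) (S i) ⟩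
  const 1ℤ ⊕ const (+ i) ⊖ (𝟙 ⊕ X ⊛ S i)            ≈⟨ ⊕-cong (≈-sym (const-+ 1ℤ (+ i))) ≈-refl ⟩
  const (+ suc i) ⊖ (𝟙 ⊕ X ⊛ S i)                   ∎
  where open ≈-Reasoning

G₀≈SG : ∀ k → G 0 ≈ S (suc k) ⊛ G k
G₀≈SG k = begin
  G 0                                             ≈⟨ ≈-sym (1⊛ (G 0)) ⟩
  𝟙 ⊛ G 0                                         ≈⟨ ⊛-congʳ (≈-sym (G-inverse k)) ⟩
  (𝟙 ⊖ q^ (suc k)) ⊛ G k ⊛ G 0                    ≈⟨ ⊛-congʳ (⊛-congʳ (≈-sym (S-closed (suc k)))) ⟩
  (𝟙 ⊖ X) ⊛ S (suc k) ⊛ G k ⊛ G 0                 ≈⟨ solve 4 (λ X s g h → (con 1ℤ :- X) :* s :* g :* h := (con 1ℤ :- X :* con 1ℤ) :* h :* (s :* g)) ≈-refl X (S (suc k)) (G k) (G 0) ⟩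
  (𝟙 ⊖ q^ 1) ⊛ G 0 ⊛ (S (suc k) ⊛ G k)            ≈⟨ ⊛-congʳ (G-inverse 0) ⟩
  𝟙 ⊛ (S (suc k) ⊛ G k)                           ≈⟨ 1⊛ _ ⟩
  S (suc k) ⊛ G k                                 ∎
  where open ≈-Reasoning

-- 1 − q = (1 − q^{k+2}) − q (1 − q^{k+1}): a factor 1 − q absorbs the pole that two consecutive denominators share.
δ-GG : ∀ k → (𝟙 ⊖ X) ⊛ (G k ⊛ G (suc k)) ≈ G k ⊖ X ⊛ G (suc k)
δ-GG k = begin
  (𝟙 ⊖ X) ⊛ (G k ⊛ G (suc k))
    ≈⟨ solve 4 (λ X p g h → (con 1ℤ :- X) :* (g :* h) := (con 1ℤ :- X :* p) :* h :* g :- X :* ((con 1ℤ :- p) :* g :* h)) ≈-refl X (q^ (suc k)) (G k) (G (suc k)) ⟩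
  (𝟙 ⊖ q^ (suc (suc k))) ⊛ G (suc k) ⊛ G k ⊖ X ⊛ ((𝟙 ⊖ q^ (suc k)) ⊛ G k ⊛ G (suc k))
    ≈⟨ ⊕-cong (⊛-congʳ (G-inverse (suc k))) (⊝-cong (⊛-congˡ (⊛-congʳ (G-inverse k)))) ⟩
  𝟙 ⊛ G k ⊖ X ⊛ (𝟙 ⊛ G (suc k))
    ≈⟨ solve 3 (λ X g h → con 1ℤ :* g :- X :* (con 1ℤ :* h) := g :- X :* h) ≈-refl X (G k) (G (suc k)) ⟩
  G k ⊖ X ⊛ G (suc k) ∎
  where open ≈-Reasoning

bounded-δGG : ∀ k → Bounded 0 (λ _ → G k ⊖ X ⊛ G (suc k))
bounded-δGG k = bounded-⊕ (bounded-G k) (bounded-⊝ (raise raises-X (bounded-G (suc k))))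

raises-δGG : ∀ k → Raises 1 (λ _ → G k ⊖ X ⊛ G (suc k))
raises-δGG k = raises-⊖ (raises-G k) (raises-⊛ raises-X (raises-G (suc k)))

v : Family
v n = X ⊖ q^ (suc n)

B : Family
B n = v n ⊛ G 0

_^B_ : ℕ → ℕ → Series
n ^B zero  = 𝟙
n ^B suc k = B n ⊛ n ^B k

δB : ∀ n → (𝟙 ⊖ X) ⊛ B n ≈ v n
δB n = begin
  (𝟙 ⊖ X) ⊛ (v n ⊛ G 0)              ≈⟨ solve 3 (λ X v g → (con 1ℤ :- X) :* (v :* g) := v :* ((con 1ℤ :- X :* con 1ℤ) :* g)) ≈-refl X (v n) (G 0) ⟩
  v n ⊛ ((𝟙 ⊖ q^ 1) ⊛ G 0)           ≈⟨ ⊛-congˡ (G-inverse 0) ⟩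
  v n ⊛ 𝟙                            ≈⟨ solve 1 (λ v → v :* con 1ℤ := v) ≈-refl (v n) ⟩
  v n                                ∎
  where open ≈-Reasoning

raises-v : Raises 0 v
raises-v = raises-⊖ raises-X (raises-q^ suc)

raises-B : Raises 1 B
raises-B = raises-⊛ raises-v (raises-G 0)

raises-^B : ∀ k → Raises k (λ n → n ^B k)
raises-^B zero    = raises-const 1ℤ
raises-^B (suc k) = raises-⊛ raises-B (raises-^B k)

u : ℕ → Family
u r n = q^ (suc r) ⊖ q^ (suc n)

raises-u : ∀ r → Raises 0 (u r)
raises-u r = raises-⊖ (raises-q^ (λ _ → suc r)) (raises-q^ suc)

N : ℕ → Series
N r = const (+ suc r)

-- (suc r)! e n (suc r) = A 0 ⋯ A r, and up to the Z term of A-split every factor equals B.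
A : ℕ → Family
A r n = N r ⊛ u r n ⊛ G r

raises-A : ∀ r → Raises 1 (A r)
raises-A r = raises-⊛ (raises-⊛ (raises-const (+ suc r)) (raises-u r)) (raises-G r)

Z : ℕ → Family
Z r n = v n ⊛ R (suc r) ⊖ N r ⊛ (X ⊛ S r)

raises-Z : ∀ r → Raises 0 (Z r)
raises-Z r = raises-⊖ (raises-⊛ raises-v (raises-R (suc r))) (raises-⊛ (raises-const (+ suc r)) (raises-⊛ raises-X (raises-S r)))

-- Over the denominator 1 - q^(r+1) the numerator of `B n` is `v n ⊛ S (suc r)`. The difference of
-- the numerators is `v n ⊛ (N r ⊖ S (suc r)) ⊖ N r ⊛ (X ⊛ (𝟙 ⊖ q^
-- r))`, and `R-closed` and `S-closed` take a factor 1 - q out of each term; `Z r n` is what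
-- remains.
A-split : ∀ r n → A r n ≈ B n ⊕ (𝟙 ⊖ X) ⊛ (Z r n ⊛ G r)
A-split r n = begin
  N r ⊛ (X ⊛ q^ r ⊖ Q) ⊛ G r
    ≈⟨ solve 6 (λ X p Q c s g → c :* (X :* p :- Q) :* g := (X :- Q) :* (s :* g) :+ ((X :- Q) :* (c :- s) :- c :* (X :* (con 1ℤ :- p))) :* g) ≈-refl X (q^ r) Q (N r) (S (suc r)) (G r) ⟩
  v n ⊛ (S (suc r) ⊛ G r) ⊕ (v n ⊛ (N r ⊖ S (suc r)) ⊖ N r ⊛ (X ⊛ (𝟙 ⊖ q^ r))) ⊛ G r
    ≈⟨ ⊕-cong (⊛-congˡ (≈-sym (G₀≈SG r))) (⊛-congʳ (⊕-cong (⊛-congˡ (≈-sym (R-closed (suc r)))) (⊝-cong (⊛-congˡ (⊛-congˡ (≈-sym (S-closed r))))))) ⟩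
  v n ⊛ G 0 ⊕ (v n ⊛ ((𝟙 ⊖ X) ⊛ R (suc r)) ⊖ N r ⊛ (X ⊛ ((𝟙 ⊖ X) ⊛ S r))) ⊛ G r
    ≈⟨ ⊕-congˡ (solve 6 (λ X v ρ c s g → (v :* ((con 1ℤ :- X) :* ρ) :- c :* (X :* ((con 1ℤ :- X) :* s))) :* g := (con 1ℤ :- X) :* ((v :* ρ :- c :* (X :* s)) :* g)) ≈-refl X (v n) (R (suc r)) (N r) (S r) (G r)) ⟩
  B n ⊕ (𝟙 ⊖ X) ⊛ (Z r n ⊛ G r) ∎
  where
  open ≈-Reasoning
  Q = q^ (suc n)

!e : ℕ → Family
!e r n = const (+ (r !)) ⊛ e n r

!e-suc : ∀ r n → !e (suc r) n ≈ A r n ⊛ !e r n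
!e-suc r n = begin
  const (+ (suc r ℕ.* r !)) ⊛ e n (suc r)                   ≈⟨ ⊛-cong (subst (λ z → const z ≈ N r ⊛ const (+ (r !))) (sym (ℤₚ.pos-* (suc r) (r !))) (const-* (+ suc r) (+ (r !)))) (e-suc n r) ⟩
  N r ⊛ const (+ (r !)) ⊛ (u r n ⊛ (G r ⊛ e n r))           ≈⟨ solve 5 (λ c d p g a → c :* d :* (p :* (g :* a)) := c :* p :* g :* (d :* a)) ≈-refl (N r) (const (+ (r !))) (u r n) (G r) (e n r) ⟩
  A r n ⊛ !e r n                                            ∎
  where open ≈-Reasoning

δδ : Series → Series
δδ a = (𝟙 ⊖ X) ⊛ ((𝟙 ⊖ X) ⊛ a)

δδ-cong : ∀ {a b} → a ≈ b → δδ a ≈ δδ b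
δδ-cong p = ⊛-congˡ (⊛-congˡ p)

δδ-⊕ : ∀ a b → δδ (a ⊕ b) ≈ δδ a ⊕ δδ b
δδ-⊕ a b = solve 3 (λ x a b → x :* (x :* (a :+ b)) := x :* (x :* a) :+ x :* (x :* b)) ≈-refl (𝟙 ⊖ X) a b

!e-5 : ∀ n → !e 5 n ≈ A 4 n ⊛ (A 3 n ⊛ (A 2 n ⊛ (A 1 n ⊛ B n)))
!e-5 n = ≈-trans (!e-suc 4 n) (⊛-congˡ (≈-trans (!e-suc 3 n) (⊛-congˡ (≈-trans (!e-suc 2 n) (⊛-congˡ (≈-trans (!e-suc 1 n) (⊛-congˡ
  (≈-trans (!e-suc 0 n) (solve 3 (λ X Q g → con 1ℤ :* (X :* con 1ℤ :- Q) :* g :* (con 1ℤ :* con 1ℤ) := (X :- Q) :* g) ≈-refl X (q^ (suc n)) (G 0))))))))))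

!e-5-error : ∀ n → δδ (!e 5 n ⊖ n ^B 5) ≈
    N 2 ⊛ N 3 ⊛ N 4 ⊛ v n ⊛ Z 1 n ⊛ u 2 n ⊛ u 3 n ⊛ u 4 n ⊛ (G 1 ⊖ X ⊛ G 2) ⊛ (G 3 ⊖ X ⊛ G 4)
  ⊕ N 3 ⊛ N 4 ⊛ v n ⊛ v n ⊛ Z 2 n ⊛ u 3 n ⊛ u 4 n ⊛ G 2 ⊛ (G 3 ⊖ X ⊛ G 4)
  ⊕ N 4 ⊛ v n ⊛ v n ⊛ v n ⊛ Z 3 n ⊛ u 4 n ⊛ G 3 ⊛ G 4
  ⊕ v n ⊛ v n ⊛ v n ⊛ Z 4 n ⊛ B n ⊛ G 4
!e-5-error n = begin
  x ⊛ (x ⊛ (!e 5 n ⊖ n ^B 5))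
    ≈⟨ ⊛-congˡ (⊛-congˡ (⊕-cong (!e-5 n) ≈-refl)) ⟩
  x ⊛ (x ⊛ (A 4 n ⊛ (A 3 n ⊛ (A 2 n ⊛ (A 1 n ⊛ b))) ⊖ n ^B 5))
    ≈⟨ solve 6 (λ x b a₁ a₂ a₃ a₄ → x :* (x :* (a₄ :* (a₃ :* (a₂ :* (a₁ :* b))) :- b :* (b :* (b :* (b :* (b :* con 1ℤ)))))) :=
         x :* x :* b :* (a₂ :* a₃ :* a₄) :* (a₁ :- b) :+ x :* x :* b :* b :* (a₃ :* a₄) :* (a₂ :- b) :+ x :* x :* b :* b :* b :* a₄ :* (a₃ :- b) :+ x :* x :* b :* b :* b :* b :* (a₄ :- b)) ≈-refl
         x b (A 1 n) (A 2 n) (A 3 n) (A 4 n) ⟩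
  x ⊛ x ⊛ b ⊛ (A 2 n ⊛ A 3 n ⊛ A 4 n) ⊛ (A 1 n ⊖ b) ⊕ x ⊛ x ⊛ b ⊛ b ⊛ (A 3 n ⊛ A 4 n) ⊛ (A 2 n ⊖ b) ⊕ x ⊛ x ⊛ b ⊛ b ⊛ b ⊛ A 4 n ⊛ (A 3 n ⊖ b) ⊕ x ⊛ x ⊛ b ⊛ b ⊛ b ⊛ b ⊛ (A 4 n ⊖ b)
    ≈⟨ ⊕-cong (⊕-cong (⊕-cong (⊛-congˡ (diff 1)) (⊛-congˡ (diff 2))) (⊛-congˡ (diff 3))) (⊛-congˡ (diff 4)) ⟩
  x ⊛ x ⊛ b ⊛ (A 2 n ⊛ A 3 n ⊛ A 4 n) ⊛ (x ⊛ (Z 1 n ⊛ G 1)) ⊕ x ⊛ x ⊛ b ⊛ b ⊛ (A 3 n ⊛ A 4 n) ⊛ (x ⊛ (Z 2 n ⊛ G 2)) ⊕ x ⊛ x ⊛ b ⊛ b ⊛ b ⊛ A 4 n ⊛ (x ⊛ (Z 3 n ⊛ G 3)) ⊕ x ⊛ x ⊛ b ⊛ b ⊛ b ⊛ b ⊛ (x ⊛ (Z 4 n ⊛ G 4))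
    ≈⟨ ⊕-cong (⊕-cong (⊕-cong term₁ term₂) term₃) term₄ ⟩
  _ ∎
  where
  open ≈-Reasoning
  x = 𝟙 ⊖ X
  b = B n
  diff : ∀ r → A r n ⊖ b ≈ x ⊛ (Z r n ⊛ G r)
  diff r = ≈-trans (⊕-cong (A-split r n) ≈-refl) (solve 2 (λ b y → b :+ y :- b := y) ≈-refl b (x ⊛ (Z r n ⊛ G r)))
  term₁ : x ⊛ x ⊛ b ⊛ (A 2 n ⊛ A 3 n ⊛ A 4 n) ⊛ (x ⊛ (Z 1 n ⊛ G 1)) ≈ N 2 ⊛ N 3 ⊛ N 4 ⊛ v n ⊛ Z 1 n ⊛ u 2 n ⊛ u 3 n ⊛ u 4 n ⊛ (G 1 ⊖ X ⊛ G 2) ⊛ (G 3 ⊖ X ⊛ G 4)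
  term₁ = ≈-trans
    (solve 13 (λ x b c₂ c₃ c₄ u₂ u₃ u₄ g₁ g₂ g₃ g₄ z → x :* x :* b :* ((c₂ :* u₂ :* g₂) :* (c₃ :* u₃ :* g₃) :* (c₄ :* u₄ :* g₄)) :* (x :* (z :* g₁))
        := c₂ :* c₃ :* c₄ :* (x :* b) :* z :* u₂ :* u₃ :* u₄ :* (x :* (g₁ :* g₂)) :* (x :* (g₃ :* g₄))) ≈-refl
        x b (N 2) (N 3) (N 4) (u 2 n) (u 3 n) (u 4 n) (G 1) (G 2) (G 3) (G 4) (Z 1 n))
    (⊛-cong (⊛-cong (⊛-congʳ (⊛-congʳ (⊛-congʳ (⊛-congʳ (⊛-congˡ (δB n)))))) (δ-GG 1)) (δ-GG 3))
  term₂ : x ⊛ x ⊛ b ⊛ b ⊛ (A 3 n ⊛ A 4 n) ⊛ (x ⊛ (Z 2 n ⊛ G 2)) ≈ N 3 ⊛ N 4 ⊛ v n ⊛ v n ⊛ Z 2 n ⊛ u 3 n ⊛ u 4 n ⊛ G 2 ⊛ (G 3 ⊖ X ⊛ G 4)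
  term₂ = ≈-trans
    (solve 10 (λ x b c₃ c₄ u₃ u₄ g₂ g₃ g₄ z → x :* x :* b :* b :* ((c₃ :* u₃ :* g₃) :* (c₄ :* u₄ :* g₄)) :* (x :* (z :* g₂))
        := c₃ :* c₄ :* (x :* b) :* (x :* b) :* z :* u₃ :* u₄ :* g₂ :* (x :* (g₃ :* g₄))) ≈-refl
        x b (N 3) (N 4) (u 3 n) (u 4 n) (G 2) (G 3) (G 4) (Z 2 n))
    (⊛-cong (⊛-congʳ (⊛-congʳ (⊛-congʳ (⊛-congʳ (⊛-cong (⊛-congˡ (δB n)) (δB n)))))) (δ-GG 3))
  term₃ : x ⊛ x ⊛ b ⊛ b ⊛ b ⊛ A 4 n ⊛ (x ⊛ (Z 3 n ⊛ G 3)) ≈ N 4 ⊛ v n ⊛ v n ⊛ v n ⊛ Z 3 n ⊛ u 4 n ⊛ G 3 ⊛ G 4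
  term₃ = ≈-trans
    (solve 7 (λ x b c₄ u₄ g₃ g₄ z → x :* x :* b :* b :* b :* (c₄ :* u₄ :* g₄) :* (x :* (z :* g₃))
        := c₄ :* (x :* b) :* (x :* b) :* (x :* b) :* z :* u₄ :* g₃ :* g₄) ≈-refl
        x b (N 4) (u 4 n) (G 3) (G 4) (Z 3 n))
    (⊛-congʳ (⊛-congʳ (⊛-congʳ (⊛-congʳ (⊛-cong (⊛-cong (⊛-congˡ (δB n)) (δB n)) (δB n))))))
  term₄ : x ⊛ x ⊛ b ⊛ b ⊛ b ⊛ b ⊛ (x ⊛ (Z 4 n ⊛ G 4)) ≈ v n ⊛ v n ⊛ v n ⊛ Z 4 n ⊛ b ⊛ G 4
  term₄ = ≈-trans
    (solve 4 (λ x b g₄ z → x :* x :* b :* b :* b :* b :* (x :* (z :* g₄)) := (x :* b) :* (x :* b) :* (x :* b) :* z :* b :* g₄) ≈-refl x b (G 4) (Z 4 n))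
    (⊛-congʳ (⊛-congʳ (⊛-congʳ (⊛-cong (⊛-cong (δB n) (δB n)) (δB n)))))

bounded-error-5 : Bounded 1 (λ n → δδ (!e 5 n ⊖ n ^B 5))
bounded-error-5 = bounded-≈ (λ n → ≈-sym (!e-5-error n)) (bounded-⊕ (bounded-⊕ (bounded-⊕
  (raise (ns 2 ⊠ ns 3 ⊠ ns 4 ⊠ raises-v ⊠ raises-Z 1 ⊠ raises-u 2 ⊠ raises-u 3 ⊠ raises-u 4 ⊠ raises-δGG 1) (bounded-δGG 3))
  (raise (ns 3 ⊠ ns 4 ⊠ raises-v ⊠ raises-v ⊠ raises-Z 2 ⊠ raises-u 3 ⊠ raises-u 4 ⊠ raises-G 2) (bounded-δGG 3)))
  (raise (ns 4 ⊠ raises-v ⊠ raises-v ⊠ raises-v ⊠ raises-Z 3 ⊠ raises-u 4 ⊠ raises-G 3) (bounded-G 4)))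
  (raise (raises-v ⊠ raises-v ⊠ raises-v ⊠ raises-Z 4 ⊠ raises-B) (bounded-G 4)))
  where
  infixl 7 _⊠_
  _⊠_ : ∀ {k l z w} → Raises k z → Raises l w → Raises (k ℕ.+ l) (λ n → z n ⊛ w n)
  _⊠_ = raises-⊛
  ns : ∀ r → Raises 0 (λ _ → N r)
  ns r = raises-const (+ suc r)

-- From five parts on no further pairing occurs: the new error is `A r` times the old one, plus
-- (`A r` - `B`) times `B`^r, whose three factors 1 - q are absorbed by three of the factors `B`.
bounded-error : ∀ j → Bounded (suc j) (λ n → δδ (!e (5 ℕ.+ j) n ⊖ n ^B (5 ℕ.+ j)))
bounded-error zero    = bounded-error-5
bounded-error (suc j) = bounded-≈ (≈-sym ∘ step) (bounded-⊕
  (raise (raises-A r) (bounded-error j))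
  (bounded-cast (ℕₚ.+-identityʳ (2 ℕ.+ j)) (raise (raises-⊛ (raises-⊛ (raises-⊛ (raises-⊛ raises-v raises-v) raises-v) (raises-Z r)) (raises-^B (2 ℕ.+ j))) (bounded-G r))))
  where
  bounded-cast : ∀ {i j a} → i ≡ j → Bounded i a → Bounded j a
  bounded-cast refl bd = bd
  r = 5 ℕ.+ j
  x = 𝟙 ⊖ X
  step : ∀ n → δδ (!e (suc r) n ⊖ n ^B (suc r)) ≈ A r n ⊛ δδ (!e r n ⊖ n ^B r) ⊕ v n ⊛ v n ⊛ v n ⊛ Z r n ⊛ n ^B (2 ℕ.+ j) ⊛ G r
  step n = begin
    δδ (!e (suc r) n ⊖ b ⊛ n ^B r)
      ≈⟨ δδ-cong (⊕-cong (!e-suc r n) ≈-refl) ⟩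
    δδ (A r n ⊛ !e r n ⊖ b ⊛ n ^B r)
      ≈⟨ solve 5 (λ x a e b p → x :* (x :* (a :* e :- b :* p)) := a :* (x :* (x :* (e :- p))) :+ x :* x :* (a :- b) :* p) ≈-refl x (A r n) (!e r n) b (n ^B r) ⟩
    A r n ⊛ δδ (!e r n ⊖ n ^B r) ⊕ x ⊛ x ⊛ (A r n ⊖ b) ⊛ n ^B r
      ≈⟨ ⊕-congˡ (⊛-congʳ (⊛-congˡ (≈-trans (⊕-cong (A-split r n) ≈-refl) (solve 2 (λ b y → b :+ y :- b := y) ≈-refl b (x ⊛ (Z r n ⊛ G r)))))) ⟩
    A r n ⊛ δδ (!e r n ⊖ n ^B r) ⊕ x ⊛ x ⊛ (x ⊛ (Z r n ⊛ G r)) ⊛ (b ⊛ (b ⊛ (b ⊛ n ^B (2 ℕ.+ j))))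
      ≈⟨ ⊕-congˡ (solve 5 (λ x b z g p → x :* x :* (x :* (z :* g)) :* (b :* (b :* (b :* p))) := (x :* b) :* (x :* b) :* (x :* b) :* z :* p :* g) ≈-refl x b (Z r n) (G r) (n ^B (2 ℕ.+ j))) ⟩
    A r n ⊛ δδ (!e r n ⊖ n ^B r) ⊕ (x ⊛ b) ⊛ (x ⊛ b) ⊛ (x ⊛ b) ⊛ Z r n ⊛ n ^B (2 ℕ.+ j) ⊛ G r
      ≈⟨ ⊕-congˡ (⊛-congʳ (⊛-congʳ (⊛-congʳ (⊛-cong (⊛-cong (δB n) (δB n)) (δB n))))) ⟩
    A r n ⊛ δδ (!e r n ⊖ n ^B r) ⊕ v n ⊛ v n ⊛ v n ⊛ Z r n ⊛ n ^B (2 ℕ.+ j) ⊛ G r ∎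
    where
    open ≈-Reasoning
    b = B n

-- The summands with fewer parts

δ-e-1 : ∀ n → (𝟙 ⊖ X) ⊛ e n 1 ≈ v n
δ-e-1 n = d-one n

δ-e-2 : ∀ n → (𝟙 ⊖ X) ⊛ e n 2 ≈ u 1 n ⊛ v n ⊛ G 1
δ-e-2 n = ≈-trans (d-suc n 1) (≈-trans (⊛-congˡ (⊛-congˡ (d-one n))) (solve 3 (λ u g v → u :* (g :* v) := u :* v :* g) ≈-refl (u 1 n) (G 1) (v n)))

δδ-e-3 : ∀ n → δδ (e n 3) ≈ u 2 n ⊛ u 1 n ⊛ v n ⊛ (G 1 ⊖ X ⊛ G 2)
δδ-e-3 n = begin
  x ⊛ (x ⊛ e n 3)                                  ≈⟨ ⊛-congˡ (d-suc n 2) ⟩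
  x ⊛ (u 2 n ⊛ (G 2 ⊛ (x ⊛ e n 2)))                ≈⟨ ⊛-congˡ (⊛-congˡ (⊛-congˡ (δ-e-2 n))) ⟩
  x ⊛ (u 2 n ⊛ (G 2 ⊛ (u 1 n ⊛ v n ⊛ G 1)))        ≈⟨ solve 6 (λ x u₂ g₂ u₁ v g₁ → x :* (u₂ :* (g₂ :* (u₁ :* v :* g₁))) := u₂ :* u₁ :* v :* (x :* (g₁ :* g₂))) ≈-refl x (u 2 n) (G 2) (u 1 n) (v n) (G 1) ⟩
  u 2 n ⊛ u 1 n ⊛ v n ⊛ (x ⊛ (G 1 ⊛ G 2))          ≈⟨ ⊛-congˡ (δ-GG 1) ⟩
  u 2 n ⊛ u 1 n ⊛ v n ⊛ (G 1 ⊖ X ⊛ G 2)            ∎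
  where
  open ≈-Reasoning
  x = 𝟙 ⊖ X

raises-δ : Raises 0 (λ _ → 𝟙 ⊖ X)
raises-δ = raises-⊖ (raises-const 1ℤ) raises-X

bounded-δδ : ∀ {j} (a : Family) → Bounded j (λ n → (𝟙 ⊖ X) ⊛ a n) → Bounded j (λ n → δδ (a n))
bounded-δδ a = raise raises-δ

-- One factor 1 - q cancels the denominator of the first part, the other is absorbed by the pair 1 -
-- q^2, 1 - q^3. Of the 3 + j denominators 1 + j remain, and their product grows with exponent j.
bounded-δδe : ∀ j → Bounded j (λ n → δδ (e n (3 ℕ.+ j)))
bounded-δδe zero    = bounded-≈ (≈-sym ∘ δδ-e-3) (raise (raises-⊛ (raises-⊛ (raises-u 2) (raises-u 1)) raises-v) (bounded-δGG 1))
bounded-δδe (suc j) = bounded-≈ (≈-sym ∘ step) (raise (raises-⊛ (raises-u r) (raises-G r)) (bounded-δδe j))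
  where
  r = 3 ℕ.+ j
  step : ∀ n → δδ (e n (suc r)) ≈ u r n ⊛ G r ⊛ δδ (e n r)
  step n = ≈-trans (δδ-cong (e-suc n r)) (solve 4 (λ x u g a → x :* (x :* (u :* (g :* a))) := u :* g :* (x :* (x :* a))) ≈-refl (𝟙 ⊖ X) (u r n) (G r) (e n r))

bounded-δδf₂ : Bounded 0 (λ n → δδ (f n 2))
bounded-δδf₂ = bounded-≈ (λ n → ≈-sym (≈-trans (δδ-⊕ (f n 1) (e n 2)) (⊕-cong (δδ-⊕ (e n 0) (e n 1)) ≈-refl)))
  (bounded-⊕ (bounded-⊕ (bounded-δδ (λ _ → 𝟙) (raise raises-δ bounded-𝟙))
    (bounded-δδ (λ n → e n 1) (bounded-≈ (≈-sym ∘ δ-e-1) (bounded-≈ (λ n → solve 1 (λ v → v :* con 1ℤ := v) ≈-refl (v n)) (raise raises-v bounded-𝟙)))))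
    (bounded-δδ (λ n → e n 2) (bounded-≈ (≈-sym ∘ δ-e-2) (raise (raises-⊛ (raises-u 1) raises-v) (bounded-G 1)))))

-- For b = 5 + j the polynomial `f n (b - 1)` gets the exponent 1 + j, the same as in
-- `bounded-error`. All summands with fewer than b parts can therefore be counted as error.
bounded-δδf : ∀ j → Bounded j (λ n → δδ (f n (3 ℕ.+ j)))
bounded-δδf zero    = bounded-≈ (λ n → ≈-sym (δδ-⊕ (f n 2) (e n 3))) (bounded-⊕ bounded-δδf₂ (bounded-δδe 0))
bounded-δδf (suc j) = bounded-≈ (λ n → ≈-sym (δδ-⊕ (f n (3 ℕ.+ j)) (e n (4 ℕ.+ j)))) (bounded-⊕ (bounded-suc (bounded-δδf j)) (bounded-δδe (suc j)))

Err : ℕ → Family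
Err b n = const (+ (b !)) ⊛ f n b ⊖ n ^B b

bounded-δδErr : ∀ j → Bounded (suc j) (λ n → δδ (Err (5 ℕ.+ j) n))
bounded-δδErr j = bounded-≈ (≈-sym ∘ step) (bounded-⊕ (bounded-const (+ (b !)) (bounded-δδf (suc j))) (bounded-error j))
  where
  b = 5 ℕ.+ j
  step : ∀ n → δδ (Err b n) ≈ const (+ (b !)) ⊛ δδ (f n (4 ℕ.+ j)) ⊕ δδ (!e b n ⊖ n ^B b)
  step n = solve 5 (λ x c f e p → x :* (x :* (c :* (f :+ e) :- p)) := c :* (x :* (x :* f)) :+ x :* (x :* (c :* e :- p))) ≈-refl
    (𝟙 ⊖ X) (const (+ (b !))) (f n (4 ℕ.+ j)) (e n b) (n ^B b)

-- First differences are partial sums of second differences, at the price of one power.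
bounded-δErr : ∀ j → Bounded (2 ℕ.+ j) (λ n → δ (Err (5 ℕ.+ j) n))
bounded-δErr j = bounded-≈ step (raise (raises-G 0) (bounded-δδErr j))
  where
  step : ∀ n → G 0 ⊛ δδ (Err (5 ℕ.+ j) n) ≈ δ (Err (5 ℕ.+ j) n)
  step n = ≈-trans (solve 3 (λ g X a → g :* ((con 1ℤ :- X) :* ((con 1ℤ :- X) :* a)) := (con 1ℤ :- X :* con 1ℤ) :* g :* ((con 1ℤ :- X) :* a)) ≈-refl (G 0) X (Err (5 ℕ.+ j) n))
    (≈-trans (⊛-congʳ (G-inverse 0)) (1⊛ _))

-- The model B^b

nn : ∀ {x y} → x ≤ y → 0ℤ ≤ y - x
nn = ℤₚ.i≤j⇒0≤j-i

infixl 6 _⊞_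
_⊞_ : ∀ {x y} → 0ℤ ≤ x → 0ℤ ≤ y → 0ℤ ≤ x + y
_⊞_ = ℤₚ.+-mono-≤

-- The pattern for linear inequalities below: `t` is a sum of nonnegative slacks of the hypotheses,
-- and the ring solver checks that it equals the required difference.
≤-by : ∀ {x y t} → 0ℤ ≤ t → y - x ≡ t → x ≤ y
≤-by 0≤t eq = ℤₚ.0≤i-j⇒j≤i (subst (0ℤ ≤_) (sym eq) 0≤t)

0≤+ : ∀ n → 0ℤ ≤ + n
0≤+ n = ℤ.+≤+ z≤n

difference : ∀ {x y} → x ≤ y → ∃[ k ] y ≡ x + + k
difference {x} {y} x≤y with y - x in eq | nn x≤y
... | + k | _ = k , trans (back x y) (+-congˡ x eq)
  where
  back : ∀ x y → y ≡ x + (y - x)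
  back = solve-∀

-- The centre of symmetry is C/2.
record SymmetricUnimodal (C : ℤ) (a : ℤ → ℤ) : Set where
  field
    symmetric : ∀ x y → x + y ≡ C → a x ≡ a y
    monotone  : ∀ x y → x ≤ y → x + y ≤ C → a x ≤ a y
open SymmetricUnimodal

-- `step` says in difference form that b is a times q + ... + q^(m-1), so each value of b is a sum
-- of a over a window of m - 1 indices.
module Window (m C : ℤ) (1≤m : 1ℤ ≤ m) (a b : ℤ → ℤ) (su : SymmetricUnimodal C a) (step : ∀ x → b x - b (x - 1ℤ) ≡ a (x - 1ℤ) - a (x - m)) where

  -- The centre of b is (C + m) / 2, and the step from x - 1 to x lies half a unit below x; hence
  -- the bound `C + m + 1`.
  rise : ∀ x → x + x ≤ C + m + 1ℤ → b (x - 1ℤ) ≤ b x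
  rise x le = ≤-by (nn (monotone su (x - m) (x - 1ℤ) (≤-by (nn 1≤m) (eq₁ x m)) (≤-by (nn le) (eq₂ x m C)))) (step x)
    where
    eq₁ : ∀ x m → x - 1ℤ - (x - m) ≡ m - 1ℤ
    eq₁ = solve-∀
    eq₂ : ∀ x m C → C - (x - m + (x - 1ℤ)) ≡ C + m + 1ℤ - (x + x)
    eq₂ = solve-∀

  climb : ∀ k x → x + + k + (x + + k) ≤ C + m + 1ℤ → b x ≤ b (x + + k)
  climb zero    x le = ℤₚ.≤-reflexive (cong b (sym (ℤₚ.+-identityʳ x)))
  climb (suc k) x le = ℤₚ.≤-trans (climb k x (≤-by (nn le ⊞ 0≤+ 2) (eq x (+ k) (C + m))))
                                  (subst (λ z → b z ≤ b (x + + suc k)) (pred x (+ k)) (rise (x + + suc k) le))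
    where
    eq : ∀ x k c → c + 1ℤ - (x + k + (x + k)) ≡ c + 1ℤ - (x + (1ℤ + k) + (x + (1ℤ + k))) + + 2
    eq = solve-∀
    pred : ∀ x k → x + (1ℤ + k) - 1ℤ ≡ x + k
    pred = solve-∀

  move : ∀ {x y} → y - x ≡ 0ℤ → x ≡ y
  move {x} {y} eq = sym (ℤₚ.i-j≡0⇒i≡j y x eq)

  -- Induction on the distance y - x in steps of two. Moving both points inward by one changes b x
  -- and b y by differences of a that are mirror images of each other about C / 2.
  mirror : ∀ d x y → y ≡ x + + d → x + y ≡ C + m → b x ≡ b y
  mirror zero x y y≡ sum = cong b (sym (trans y≡ (ℤₚ.+-identityʳ x)))
  mirror (suc zero) x y y≡ sum = move (begin
    b y - b x                         ≡⟨ cong (λ z → b y - b z) (trans (eq₁ x) (cong (_- 1ℤ) (sym y≡))) ⟩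
    b y - b (y - 1ℤ)                  ≡⟨ step y ⟩
    a (y - 1ℤ) - a (y - m)            ≡⟨ cong (λ t → a (y - 1ℤ) - t) (symmetric su (y - m) (y - 1ℤ) (trans (cong (λ z → z - m + (y - 1ℤ)) y≡) (trans (eq₂ x y m) (trans (cong (_- m) sum) (eq₃ C m))))) ⟩
    a (y - 1ℤ) - a (y - 1ℤ)           ≡⟨ ℤₚ.+-inverseʳ (a (y - 1ℤ)) ⟩
    0ℤ                                ∎)
    where
    open ≡-Reasoning
    eq₁ : ∀ x → x ≡ x + 1ℤ - 1ℤ
    eq₁ = solve-∀
    eq₂ : ∀ x y m → x + 1ℤ - m + (y - 1ℤ) ≡ x + y - m
    eq₂ = solve-∀
    eq₃ : ∀ C m → C + m - m ≡ C
    eq₃ = solve-∀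
  mirror (suc (suc d)) x y y≡ sum = move (begin
    b y - b x
      ≡⟨ eq₁ (b y) (b (y - 1ℤ)) (b (x + 1ℤ)) (b x) ⟩
    (b y - b (y - 1ℤ)) + (b (y - 1ℤ) - b (x + 1ℤ)) + (b (x + 1ℤ) - b x)
      ≡⟨ cong₂ _+_ (cong₂ _+_ (step y) (trans (cong (λ t → b (y - 1ℤ) - t) (mirror d (x + 1ℤ) (y - 1ℤ) inner (trans (eq₂ x y) sum))) (ℤₚ.+-inverseʳ (b (y - 1ℤ)))))
                   (trans (cong (λ z → b (x + 1ℤ) - b z) (eq₃ x)) (step (x + 1ℤ))) ⟩
    (a (y - 1ℤ) - a (y - m)) + 0ℤ + (a (x + 1ℤ - 1ℤ) - a (x + 1ℤ - m))
      ≡⟨ cong₂ (λ s t → (s - t) + 0ℤ + (a (x + 1ℤ - 1ℤ) - a (x + 1ℤ - m)))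
           (symmetric su (y - 1ℤ) (x + 1ℤ - m) (trans (eq₄ x y m) (trans (cong (_- m) sum) (eq₅ C m))))
           (symmetric su (y - m) (x + 1ℤ - 1ℤ) (trans (eq₆ x y m) (trans (cong (_- m) sum) (eq₅ C m)))) ⟩
    (a (x + 1ℤ - m) - a (x + 1ℤ - 1ℤ)) + 0ℤ + (a (x + 1ℤ - 1ℤ) - a (x + 1ℤ - m))
      ≡⟨ eq₇ (a (x + 1ℤ - m)) (a (x + 1ℤ - 1ℤ)) ⟩
    0ℤ ∎)
    where
    open ≡-Reasoning
    eq₁ : ∀ s t u v → s - v ≡ (s - t) + (t - u) + (u - v)
    eq₁ = solve-∀
    eq₂ : ∀ x y → x + 1ℤ + (y - 1ℤ) ≡ x + y
    eq₂ = solve-∀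
    eq₃ : ∀ x → x ≡ x + 1ℤ - 1ℤ
    eq₃ = solve-∀
    eq₄ : ∀ x y m → y - 1ℤ + (x + 1ℤ - m) ≡ x + y - m
    eq₄ = solve-∀
    eq₅ : ∀ C m → C + m - m ≡ C
    eq₅ = solve-∀
    eq₆ : ∀ x y m → y - m + (x + 1ℤ - 1ℤ) ≡ x + y - m
    eq₆ = solve-∀
    eq₇ : ∀ s t → (s - t) + 0ℤ + (t - s) ≡ 0ℤ
    eq₇ = solve-∀
    inner : y - 1ℤ ≡ x + 1ℤ + + d
    inner = trans (cong (_- 1ℤ) y≡) (eq₈ x (+ d))
      where
      eq₈ : ∀ x d → x + (+ 2 + d) - 1ℤ ≡ x + 1ℤ + d
      eq₈ = solve-∀

  window-symmetric : ∀ x y → x + y ≡ C + m → b x ≡ b y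
  window-symmetric x y sum with ℤₚ.≤-total x y
  ... | inj₁ x≤y = let k , eq = difference x≤y in mirror k x y eq sum
  ... | inj₂ y≤x = let k , eq = difference y≤x in sym (mirror k y x eq (trans (ℤₚ.+-comm y x) sum))

  climb′ : ∀ x y → x ≤ y → y + y ≤ C + m + 1ℤ → b x ≤ b y
  climb′ x y x≤y le with difference x≤y
  ... | k , refl = climb k x le

  -- If y lies beyond the range of `rise`, it is replaced by its mirror image, which is still at
  -- least x.
  window-monotone : ∀ x y → x ≤ y → x + y ≤ C + m → b x ≤ b y
  window-monotone x y x≤y le with ℤₚ.≤-total (y + y) (C + m + 1ℤ)
  ... | inj₁ small = climb′ x y x≤y small
  ... | inj₂ large = subst (b x ≤_) (window-symmetric (C + m - y) y (eq₁ (C + m) y))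
        (climb′ x (C + m - y) (≤-by (nn le) (eq₂ (C + m) x y)) (≤-by (nn large ⊞ 0≤+ 2) (eq₃ (C + m) y)))
    where
    eq₁ : ∀ c y → c - y + y ≡ c
    eq₁ = solve-∀
    eq₂ : ∀ c x y → c - y - x ≡ c - (x + y)
    eq₂ = solve-∀
    eq₃ : ∀ c y → c + 1ℤ - (c - y + (c - y)) ≡ y + y - (c + 1ℤ) + + 2
    eq₃ = solve-∀

  window : SymmetricUnimodal (C + m) b
  window = record { symmetric = window-symmetric ; monotone = window-monotone }

-- The upper end hi bounds x + x, since centres may be half-integers.
Slope : ℤ → ℤ → ℤ → (ℤ → ℤ) → Set
Slope lo hi K a = ∀ x → lo ≤ x → x + x ≤ hi → a (x - 1ℤ) + K ≤ a x

gap : ∀ {lo hi K a} → Slope lo hi K a → ∀ s z → lo ≤ z + 1ℤ → z + + s + (z + + s) ≤ hi → a z + + s * K ≤ a (z + + s)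
gap {lo} {hi} {K} {a} slope zero z _ _ = ℤₚ.≤-reflexive (trans (+-congˡ (a z) (ℤₚ.*-zeroˡ K)) (trans (ℤₚ.+-identityʳ (a z)) (cong a (sym (ℤₚ.+-identityʳ z)))))
gap {lo} {hi} {K} {a} slope (suc s) z lo≤ ≤hi =
  ≤-by (nn (gap {lo} {hi} {K} {a} slope s z lo≤ (≤-by (nn ≤hi ⊞ 0≤+ 2) (eq₁ z (+ s) hi))) ⊞
        nn (subst (λ t → a t + K ≤ a (z + + suc s)) (eq₂ z (+ s)) (slope (z + + suc s) (≤-by (nn lo≤ ⊞ 0≤+ s) (eq₃ lo z (+ s))) ≤hi)))
       (eq₄ (a z) (a (z + + s)) (a (z + + suc s)) (+ s) K)
  where
  eq₁ : ∀ z s hi → hi - (z + s + (z + s)) ≡ hi - (z + (1ℤ + s) + (z + (1ℤ + s))) + + 2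
  eq₁ = solve-∀
  eq₂ : ∀ z s → z + (1ℤ + s) - 1ℤ ≡ z + s
  eq₂ = solve-∀
  eq₃ : ∀ lo z s → z + (1ℤ + s) - lo ≡ z + 1ℤ - lo + s
  eq₃ = solve-∀
  eq₄ : ∀ p r t s K → t - (p + (1ℤ + s) * K) ≡ r - (p + s * K) + (t - (r + K))
  eq₄ = solve-∀

-- x - m is the farther from the centre of the two points, and the segment between x - m and the
-- mirror image of x - 1 has room for s steps of slope K.
drop : ∀ {lo w m C K a} → SymmetricUnimodal C a → Slope lo (C - w) K a → ∀ s x →
       1ℤ ≤ w → + s + w ≤ m → lo + lo + (+ s + + s + w + m) ≤ C → lo + + s ≤ x → x + x ≤ C + m - + s →
       a (x - m) + + s * K ≤ a (x - 1ℤ)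
drop {lo} {w} {m} {C} {K} {a} su slope s x 1≤w s+w≤m room lo+s≤x 2x≤ with ℤₚ.≤-total lo (x - m + 1ℤ)
... | inj₁ lo≤ = ℤₚ.≤-trans
  (gap {lo} {C - w} {K} {a} slope s (x - m) lo≤ (≤-by (nn 2x≤ ⊞ nn s+w≤m) (eq₁ x m (+ s) w C)))
  (monotone su (x - m + + s) (x - 1ℤ) (≤-by (nn s+w≤m ⊞ nn 1≤w) (eq₂ x m (+ s) w)) (≤-by (nn 2x≤ ⊞ 0≤+ 1) (eq₃ x m (+ s) C)))
  where
  eq₁ : ∀ x m s w C → C - w - (x - m + s + (x - m + s)) ≡ C + m - s - (x + x) + (m - (s + w))
  eq₁ = solve-∀
  eq₂ : ∀ x m s w → x - 1ℤ - (x - m + s) ≡ m - (s + w) + (w - 1ℤ)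
  eq₂ = solve-∀
  eq₃ : ∀ x m s C → C - (x - m + s + (x - 1ℤ)) ≡ C + m - s - (x + x) + 1ℤ
  eq₃ = solve-∀
... | inj₂ ≤lo = ℤₚ.≤-trans
  (ℤₚ.+-monoˡ-≤ (+ s * K) (monotone su (x - m) (lo - 1ℤ) (≤-by (nn ≤lo) (eq₁ x m lo)) (≤-by (nn room ⊞ nn ≤lo ⊞ 0≤m ⊞ 0≤s ⊞ 0≤s ⊞ nn 1≤w ⊞ 0≤+ 3) (eq₂ x m lo (+ s) w C))))
  (ℤₚ.≤-trans
    (gap {lo} {C - w} {K} {a} slope s (lo - 1ℤ) (≤-by (0≤+ 0) (eq₃ lo)) (≤-by (nn room ⊞ 0≤m ⊞ 0≤+ 2) (eq₄ m lo (+ s) w C)))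
    (monotone su (lo - 1ℤ + + s) (x - 1ℤ) (≤-by (nn lo+s≤x) (eq₅ x lo (+ s))) (≤-by (nn room ⊞ nn ≤lo ⊞ 0≤s ⊞ nn 1≤w ⊞ 0≤+ 4) (eq₆ x m lo (+ s) w C))))
  where
  0≤s : 0ℤ ≤ + s
  0≤s = 0≤+ s
  eq₀ : ∀ m s w → m - 0ℤ ≡ m - (s + w) + s + (w - 1ℤ) + 1ℤ
  eq₀ = solve-∀
  0≤m : 0ℤ ≤ m
  0≤m = ≤-by (nn s+w≤m ⊞ 0≤s ⊞ nn 1≤w ⊞ 0≤+ 1) (eq₀ m (+ s) w)
  eq₁ : ∀ x m lo → lo - 1ℤ - (x - m) ≡ lo - (x - m + 1ℤ)
  eq₁ = solve-∀
  eq₂ : ∀ x m lo s w C → C - (x - m + (lo - 1ℤ)) ≡ C - (lo + lo + (s + s + w + m)) + (lo - (x - m + 1ℤ)) + m + s + s + (w - 1ℤ) + + 3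
  eq₂ = solve-∀
  eq₃ : ∀ lo → lo - 1ℤ + 1ℤ - lo ≡ 0ℤ
  eq₃ = solve-∀
  eq₄ : ∀ m lo s w C → C - w - (lo - 1ℤ + s + (lo - 1ℤ + s)) ≡ C - (lo + lo + (s + s + w + m)) + m + + 2
  eq₄ = solve-∀
  eq₅ : ∀ x lo s → x - 1ℤ - (lo - 1ℤ + s) ≡ x - (lo + s)
  eq₅ = solve-∀
  eq₆ : ∀ x m lo s w C → C - (lo - 1ℤ + s + (x - 1ℤ)) ≡ C - (lo + lo + (s + s + w + m)) + (lo - (x - m + 1ℤ)) + s + (w - 1ℤ) + + 4
  eq₆ = solve-∀

-- Of the `2 w` steps that lead up to z, the first w lie where the slope bound holds, since 2 (z -
-- w) ≤ C - w. In the last w the centre may be passed, but z is still no farther from it than z - w,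
-- so `monotone` covers them.
peak : ∀ {lo C K a} → SymmetricUnimodal C a → ∀ w → Slope lo (C - + w) K a → ∀ z y →
       y ≤ z - (+ w + + w) → z + z ≤ C + + w → lo ≤ z - (+ w + + w) + 1ℤ → a y + + w * K ≤ a z
peak {lo} {C} {K} {a} su w slope z y y≤ 2z≤ lo≤ = ℤₚ.≤-trans
  (ℤₚ.+-monoˡ-≤ (+ w * K) (monotone su y z₀ y≤ (≤-by (nn y≤ ⊞ nn 2z≤ ⊞ 0≤w ⊞ 0≤w ⊞ 0≤w) (eq₁ y z (+ w) C))))
  (ℤₚ.≤-trans
    (gap {lo} {C - + w} {K} {a} slope w z₀ lo≤ (≤-by (nn 2z≤) (eq₂ z (+ w) C)))
    (monotone su (z₀ + + w) z (≤-by 0≤w (eq₃ z (+ w))) (≤-by (nn 2z≤ ⊞ 0≤+ 0) (eq₄ z (+ w) C))))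
  where
  0≤w : 0ℤ ≤ + w
  0≤w = 0≤+ w
  z₀ : ℤ
  z₀ = z - (+ w + + w)
  eq₁ : ∀ y z w C → C - (y + (z - (w + w))) ≡ z - (w + w) - y + (C + w - (z + z)) + w + w + w
  eq₁ = solve-∀
  eq₂ : ∀ z w C → C - w - (z - (w + w) + w + (z - (w + w) + w)) ≡ C + w - (z + z)
  eq₂ = solve-∀
  eq₃ : ∀ z w → z - (z - (w + w) + w) ≡ w
  eq₃ = solve-∀
  eq₄ : ∀ z w C → C - (z - (w + w) + w + z) ≡ C + w - (z + z) + 0ℤ
  eq₄ = solve-∀

-- Extension by 0 to negative indices, so that shifts by m and reflections in the centre need no
-- case distinctions.
ext : Series → ℤ → ℤ
ext a (+ ℓ)    = a ℓ
ext a -[1+ _ ] = 0ℤ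

ext-≈ : ∀ {a b} → a ≈ b → ∀ x → ext a x ≡ ext b x
ext-≈ p (+ ℓ)    = at p ℓ
ext-≈ p -[1+ _ ] = refl

ext-⊖ : ∀ a b x → ext (a ⊖ b) x ≡ ext a x - ext b x
ext-⊖ a b (+ ℓ)    = ⊖-at a b ℓ
ext-⊖ a b -[1+ _ ] = refl

ext-X : ∀ a x → ext (X ⊛ a) x ≡ ext a (x - 1ℤ)
ext-X a (+ zero)  = X⊛-zero a
ext-X a (+ suc ℓ) = X⊛-suc a ℓ
ext-X a -[1+ _ ]  = refl

ext-q^ : ∀ s a x → ext (q^ s ⊛ a) x ≡ ext a (x - + s)
ext-q^ zero    a x = trans (ext-≈ (1⊛ a) x) (cong (ext a) (sym (ℤₚ.+-identityʳ x)))
ext-q^ (suc s) a x = begin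
  ext (X ⊛ q^ s ⊛ a) x        ≡⟨ ext-≈ (⊛-assoc X (q^ s) a) x ⟩
  ext (X ⊛ (q^ s ⊛ a)) x      ≡⟨ ext-X (q^ s ⊛ a) x ⟩
  ext (q^ s ⊛ a) (x - 1ℤ)     ≡⟨ ext-q^ s a (x - 1ℤ) ⟩
  ext a (x - 1ℤ - + s)        ≡⟨ cong (ext a) (eq x (+ s)) ⟩
  ext a (x - + suc s)         ∎
  where
  open ≡-Reasoning
  eq : ∀ x s → x - 1ℤ - s ≡ x - (1ℤ + s)
  eq = solve-∀

ext-δ : ∀ a x → ext (δ a) x ≡ ext a x - ext a (x - 1ℤ)
ext-δ a x = trans (ext-≈ (δ-unfold a) x) (trans (ext-⊖ a (X ⊛ a) x) (cong (λ t → ext a x - t) (ext-X a x)))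

ext-v : ∀ n a x → ext (v n ⊛ a) x ≡ ext a (x - 1ℤ) - ext a (x - + suc n)
ext-v n a x = trans (ext-≈ (solve 3 (λ X Q a → (X :- Q) :* a := X :* a :- Q :* a) ≈-refl X (q^ (suc n)) a) x)
  (trans (ext-⊖ (X ⊛ a) (q^ (suc n) ⊛ a) x) (cong₂ _-_ (ext-X a x) (ext-q^ (suc n) a x)))

δ-^B : ∀ n k → δ (n ^B suc k) ≈ v n ⊛ n ^B k
δ-^B n k = ≈-trans (≈-sym (⊛-assoc (𝟙 ⊖ X) (B n) (n ^B k))) (⊛-congʳ (δB n))

δδ-^B : ∀ n k → δ (δ (n ^B suc (suc k))) ≈ v n ⊛ (v n ⊛ n ^B k)
δδ-^B n k = ≈-trans (δ-cong (δ-^B n (suc k))) (≈-trans (solve 3 (λ x v p → x :* (v :* p) := v :* (x :* p)) ≈-refl (𝟙 ⊖ X) (v n) (n ^B suc k)) (⊛-congˡ (δ-^B n k)))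

G₀≡1 : ∀ ℓ → G 0 ℓ ≡ 1ℤ
G₀≡1 zero    = refl
G₀≡1 (suc ℓ) = G₀≡1 ℓ

module Model (n w : ℕ) (1≤w : 1 ℕ.≤ w) (7w≤m : 7 ℕ.* w ℕ.≤ suc n) where

  m : ℕ
  m = suc n

  a : ℕ → ℤ → ℤ
  a k = ext (n ^B k)

  step : ∀ k x → a (suc k) x - a (suc k) (x - 1ℤ) ≡ a k (x - 1ℤ) - a k (x - + m)
  step k x = trans (sym (ext-δ (n ^B suc k) x)) (trans (ext-≈ (δ-^B n k) x) (ext-v n (n ^B k) x))

  symmetricUnimodal : ∀ k → SymmetricUnimodal (+ (k ℕ.* m)) (a k)
  symmetricUnimodal zero = record { symmetric = symm ; monotone = mono }
    where
    symm : ∀ x y → x + y ≡ 0ℤ → ext 𝟙 x ≡ ext 𝟙 y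
    symm (+ zero)  (+ zero)  _ = refl
    symm (+ suc x) (+ suc y) _ = refl
    symm (+ suc x) -[1+ y ]  _ = refl
    symm -[1+ x ]  (+ suc y) _ = refl
    symm -[1+ x ]  -[1+ y ]  _ = refl
    0≤ext : ∀ y → 0ℤ ≤ ext 𝟙 y
    0≤ext (+ zero)  = ℤ.+≤+ z≤n
    0≤ext (+ suc _) = ℤₚ.≤-refl
    0≤ext -[1+ _ ]  = ℤₚ.≤-refl
    mono : ∀ x y → x ≤ y → x + y ≤ 0ℤ → ext 𝟙 x ≤ ext 𝟙 y
    mono -[1+ x ]  y         _ _ = 0≤ext y
    mono (+ suc x) y         _ _ = 0≤ext y
    mono (+ zero)  (+ zero)  _ _ = ℤₚ.≤-refl
    mono (+ zero)  (+ suc y) _ (ℤ.+≤+ ())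
  symmetricUnimodal (suc k) = subst (λ C → SymmetricUnimodal C (a (suc k))) (ℤₚ.+-comm (+ (k ℕ.* m)) (+ m))
    (Window.window (+ m) (+ (k ℕ.* m)) (ℤ.+≤+ (s≤s z≤n)) (a k) (a (suc k)) (symmetricUnimodal k) (step k))

  B-zero : B n 0 ≡ 0ℤ
  B-zero = trans (ext-v n (G 0) 0ℤ) refl

  B-one : ∀ ℓ → ℓ ℕ.< n → B n (suc ℓ) ≡ 1ℤ
  B-one ℓ ℓ<n = trans (at (⊛-congʳ (⊕-cong (solve 1 (λ X → X := X :* con 1ℤ) ≈-refl X) ≈-refl)) (suc ℓ))
    (trans ([q^-q^]⊛-< 1 (suc n) (G 0) (s≤s ℓ<n)) (trans (q^⊛-+ 1 (G 0) ℓ) (G₀≡1 ℓ)))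

  a₁≡ext-B : ∀ x → a 1 x ≡ ext (B n) x
  a₁≡ext-B = ext-≈ (solve 1 (λ b → b :* con 1ℤ := b) ≈-refl (B n))

  a₁-nonpos : ∀ x → x ≤ 0ℤ → a 1 x ≡ 0ℤ
  a₁-nonpos (+ zero)  _ = trans (a₁≡ext-B 0ℤ) B-zero
  a₁-nonpos (+ suc x) (ℤ.+≤+ ())
  a₁-nonpos -[1+ x ]  _ = refl

  a₁-one : ∀ x → 1ℤ ≤ x → x ≤ + n → a 1 x ≡ 1ℤ
  a₁-one (+ suc ℓ) _ (ℤ.+≤+ lt) = trans (a₁≡ext-B (+ suc ℓ)) (B-one ℓ lt)
  a₁-one (+ zero) (ℤ.+≤+ ()) _

  half-nonneg : ∀ x → 0ℤ ≤ x + x → 0ℤ ≤ x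
  half-nonneg (+ x) _ = 0≤+ x

  -- The condition of `drop` for lower end (2 + j) w. For j = 0 it reads 4 w + 3 w + m ≤ 2 m, the
  -- origin of the 7; larger j leave 5 j w to spare.
  room : ∀ j → (2 ℕ.+ j) ℕ.* w ℕ.+ (2 ℕ.+ j) ℕ.* w ℕ.+ (w ℕ.+ w ℕ.+ w ℕ.+ m) ℕ.≤ (2 ℕ.+ j) ℕ.* m
  room j = begin
    (2 ℕ.+ j) ℕ.* w ℕ.+ (2 ℕ.+ j) ℕ.* w ℕ.+ (w ℕ.+ w ℕ.+ w ℕ.+ m)                   ≤⟨ ℕₚ.m≤m+n _ (5 ℕ.* (j ℕ.* w)) ⟩
    (2 ℕ.+ j) ℕ.* w ℕ.+ (2 ℕ.+ j) ℕ.* w ℕ.+ (w ℕ.+ w ℕ.+ w ℕ.+ m) ℕ.+ 5 ℕ.* (j ℕ.* w) ≡⟨ eq₁ j w m ⟩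
    (1 ℕ.+ j) ℕ.* (7 ℕ.* w) ℕ.+ m                                                  ≤⟨ ℕₚ.+-monoˡ-≤ m (ℕₚ.*-monoʳ-≤ (1 ℕ.+ j) 7w≤m) ⟩
    (1 ℕ.+ j) ℕ.* m ℕ.+ m                                                          ≡⟨ ℕₚ.+-comm ((1 ℕ.+ j) ℕ.* m) m ⟩
    (2 ℕ.+ j) ℕ.* m                                                                ∎
    where
    open ℕₚ.≤-Reasoning
    eq₁ : ∀ j w m → (2 ℕ.+ j) ℕ.* w ℕ.+ (2 ℕ.+ j) ℕ.* w ℕ.+ (w ℕ.+ w ℕ.+ w ℕ.+ m) ℕ.+ 5 ℕ.* (j ℕ.* w) ≡ (1 ℕ.+ j) ℕ.* (7 ℕ.* w) ℕ.+ m
    eq₁ = ℕ-solve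

  2w≤m : w ℕ.+ w ℕ.≤ m
  2w≤m = ℕₚ.≤-trans (ℕₚ.+-monoʳ-≤ w (ℕₚ.m≤m+n w (5 ℕ.* w))) (ℕₚ.≤-trans (ℕₚ.≤-reflexive (eq w)) 7w≤m)
    where
    eq : ∀ w → w ℕ.+ (w ℕ.+ 5 ℕ.* w) ≡ 7 ℕ.* w
    eq = ℕ-solve

  rewriteTop : ∀ {x c s : ℤ} → x ≤ + m + c - s → x ≤ c + + m - s
  rewriteTop {x} {c} {s} = subst (λ t → x ≤ t - s) (ℤₚ.+-comm (+ m) c)

  -- B^2 is a tent of slope 1 up to its centre m. Each further factor B turns a slope K into w K,
  -- because the step of the product is a difference of two values between which there is room for w
  -- steps of slope K; the lower end moves up by w.
  slope : ∀ j → Slope (+ ((2 ℕ.+ j) ℕ.* w)) (+ ((2 ℕ.+ j) ℕ.* m) - + w) (+ (w ℕ.^ j)) (a (2 ℕ.+ j))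
  -- By `step` the gap is the first difference of B^(3+j) at x, for x at least s / 2 below the
  -- centre. The case s = w feeds the induction of `slope`; a smaller s gives the estimate near the
  -- centre in `δ-lower`.
  drop-model : ∀ j s → s ℕ.≤ w → ∀ x → + ((2 ℕ.+ j) ℕ.* w ℕ.+ s) ≤ x → x + x ≤ + ((3 ℕ.+ j) ℕ.* m) - + s →
               a (2 ℕ.+ j) (x - + m) + + s * + (w ℕ.^ j) ≤ a (2 ℕ.+ j) (x - 1ℤ)

  slope zero x lo≤ ≤hi = ≤-by (ℤₚ.≤-refl {0ℤ}) (begin
    a 2 x - (a 2 (x - 1ℤ) + 1ℤ)                    ≡⟨ eq₁ (a 2 x) (a 2 (x - 1ℤ)) ⟩
    a 2 x - a 2 (x - 1ℤ) - 1ℤ                      ≡⟨ cong (_- 1ℤ) (step 1 x) ⟩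
    a 1 (x - 1ℤ) - a 1 (x - + m) - 1ℤ              ≡⟨ cong₂ (λ s t → s - t - 1ℤ) (a₁-one (x - 1ℤ) (≤-by (nn 2≤x) (eq₂ x)) (≤-by (nn x≤m) (eq₃ x (+ n)))) (a₁-nonpos (x - + m) (≤-by (nn x≤m) (eq₄ x (+ m)))) ⟩
    0ℤ                                             ∎)
    where
    open ≡-Reasoning
    2≤x : + 2 ≤ x
    2≤x = ℤₚ.≤-trans (ℤ.+≤+ (ℕₚ.*-monoʳ-≤ 2 1≤w)) lo≤
    x≤m : x ≤ + m
    x≤m = ℤₚ.0≤i-j⇒j≤i (half-nonneg (+ m - x) (subst (0ℤ ≤_) (eq₅ x (+ m) (+ w)) (nn ≤hi ⊞ 0≤+ w)))
      where
      eq₅ : ∀ x m w → (m + (m + 0ℤ)) - w - (x + x) + w ≡ m - x + (m - x)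
      eq₅ = solve-∀
    eq₁ : ∀ s t → s - (t + 1ℤ) ≡ s - t - 1ℤ
    eq₁ = solve-∀
    eq₂ : ∀ x → x - 1ℤ - 1ℤ ≡ x - + 2
    eq₂ = solve-∀
    eq₃ : ∀ x n → n - (x - 1ℤ) ≡ 1ℤ + n - x
    eq₃ = solve-∀
    eq₄ : ∀ x m → 0ℤ - (x - m) ≡ m - x
    eq₄ = solve-∀
  slope (suc j) x lo≤ ≤hi = ≤-by (nn (drop-model j w ℕₚ.≤-refl x (subst (λ t → + t ≤ x) (ℕₚ.+-comm w ((2 ℕ.+ j) ℕ.* w)) lo≤) ≤hi)) (begin
    a (3 ℕ.+ j) x - (a (3 ℕ.+ j) (x - 1ℤ) + + (w ℕ.* w ℕ.^ j))                 ≡⟨ cong (λ t → a (3 ℕ.+ j) x - (a (3 ℕ.+ j) (x - 1ℤ) + t)) (ℤₚ.pos-* w (w ℕ.^ j)) ⟩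
    a (3 ℕ.+ j) x - (a (3 ℕ.+ j) (x - 1ℤ) + + w * + (w ℕ.^ j))                 ≡⟨ eq₁ (a (3 ℕ.+ j) x) (a (3 ℕ.+ j) (x - 1ℤ)) (+ w * + (w ℕ.^ j)) ⟩
    a (3 ℕ.+ j) x - a (3 ℕ.+ j) (x - 1ℤ) - + w * + (w ℕ.^ j)                   ≡⟨ cong (_- + w * + (w ℕ.^ j)) (step (2 ℕ.+ j) x) ⟩
    a (2 ℕ.+ j) (x - 1ℤ) - a (2 ℕ.+ j) (x - + m) - + w * + (w ℕ.^ j)           ≡⟨ sym (eq₁ (a (2 ℕ.+ j) (x - 1ℤ)) (a (2 ℕ.+ j) (x - + m)) (+ w * + (w ℕ.^ j))) ⟩
    a (2 ℕ.+ j) (x - 1ℤ) - (a (2 ℕ.+ j) (x - + m) + + w * + (w ℕ.^ j))         ∎)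
    where
    open ≡-Reasoning
    eq₁ : ∀ s t u → s - (t + u) ≡ s - t - u
    eq₁ = solve-∀

  drop-model j s s≤w x lo≤ ≤hi = drop (symmetricUnimodal (2 ℕ.+ j)) (slope j) s x (ℤ.+≤+ 1≤w)
    (ℤ.+≤+ (ℕₚ.≤-trans (ℕₚ.+-monoˡ-≤ w s≤w) 2w≤m))
    (ℤ.+≤+ (ℕₚ.≤-trans (ℕₚ.+-monoʳ-≤ ((2 ℕ.+ j) ℕ.* w ℕ.+ (2 ℕ.+ j) ℕ.* w) (ℕₚ.+-monoˡ-≤ m (ℕₚ.+-monoˡ-≤ w (ℕₚ.+-mono-≤ s≤w s≤w)))) (room j)))
    lo≤ (rewriteTop {x + x} {+ ((2 ℕ.+ j) ℕ.* m)} {+ s} ≤hi)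

cast : ∀ {i k} → i ℕ.≤ k → 0ℤ ≤ + k - + i
cast i≤k = nn (ℤ.+≤+ i≤k)

module Differences (j n w T : ℕ) (1≤w : 1 ℕ.≤ w) (7w≤m : 7 ℕ.* w ℕ.≤ suc n) (T≤w : T ℕ.≤ w) where
  open Model n w 1≤w 7w≤m

  b : ℕ
  b = 5 ℕ.+ j

  δ-at : ∀ ℓ → δ (n ^B b) ℓ ≡ a (4 ℕ.+ j) (+ ℓ - 1ℤ) - a (4 ℕ.+ j) (+ ℓ - + m)
  δ-at ℓ = trans (at (δ-^B n (4 ℕ.+ j)) ℓ) (ext-v n (n ^B (4 ℕ.+ j)) (+ ℓ))

  δ-lower : ∀ ℓ → (4 ℕ.+ j) ℕ.* w ℕ.+ T ℕ.≤ ℓ → ℓ ℕ.+ ℓ ℕ.+ T ℕ.≤ b ℕ.* m → + T * + (w ℕ.^ (2 ℕ.+ j)) ≤ δ (n ^B b) ℓ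
  δ-lower ℓ lo≤ ≤hi = ≤-by (nn (drop-model (2 ℕ.+ j) T T≤w (+ ℓ) (ℤ.+≤+ lo≤) (≤-by (cast ≤hi) (eq₁ (+ ℓ) (+ T) (+ (b ℕ.* m))))))
    (trans (cong (_- + T * K) (δ-at ℓ)) (eq₂ (a (4 ℕ.+ j) (+ ℓ - 1ℤ)) (a (4 ℕ.+ j) (+ ℓ - + m)) (+ T * K)))
    where
    K : ℤ
    K = + (w ℕ.^ (2 ℕ.+ j))
    eq₁ : ∀ ℓ T c → c - T - (ℓ + ℓ) ≡ c - (ℓ + ℓ + T)
    eq₁ = solve-∀
    eq₂ : ∀ s t u → s - t - u ≡ s - (t + u)
    eq₂ = solve-∀

  δ-antisym : ∀ ℓ y → ℓ ℕ.+ y ≡ suc (b ℕ.* m) → δ (n ^B b) ℓ ≡ - δ (n ^B b) y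
  δ-antisym ℓ y eq = begin
    δ (n ^B b) ℓ
      ≡⟨ δ-at ℓ ⟩
    a (4 ℕ.+ j) (+ ℓ - 1ℤ) - a (4 ℕ.+ j) (+ ℓ - + m)
      ≡⟨ cong₂ _-_ (symmetric (symmetricUnimodal (4 ℕ.+ j)) (+ ℓ - 1ℤ) (+ y - + m) (eq₁ (+ ℓ) (+ y) (+ m) (+ ((4 ℕ.+ j) ℕ.* m)) eqℤ))
                   (symmetric (symmetricUnimodal (4 ℕ.+ j)) (+ ℓ - + m) (+ y - 1ℤ) (eq₂ (+ ℓ) (+ y) (+ m) (+ ((4 ℕ.+ j) ℕ.* m)) eqℤ)) ⟩
    a (4 ℕ.+ j) (+ y - + m) - a (4 ℕ.+ j) (+ y - 1ℤ)
      ≡⟨ eq₃ (a (4 ℕ.+ j) (+ y - + m)) (a (4 ℕ.+ j) (+ y - 1ℤ)) ⟩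
    - (a (4 ℕ.+ j) (+ y - 1ℤ) - a (4 ℕ.+ j) (+ y - + m))
      ≡⟨ cong -_ (sym (δ-at y)) ⟩
    - δ (n ^B b) y ∎
    where
    open ≡-Reasoning
    eqℤ : + ℓ + + y ≡ 1ℤ + (+ m + + ((4 ℕ.+ j) ℕ.* m))
    eqℤ = cong +_ eq
    regroup₁ : ∀ ℓ y m → ℓ - 1ℤ + (y - m) ≡ ℓ + y - 1ℤ - m
    regroup₁ = solve-∀
    regroup₂ : ∀ ℓ y m → ℓ - m + (y - 1ℤ) ≡ ℓ + y - 1ℤ - m
    regroup₂ = solve-∀
    cancel : ∀ m c → 1ℤ + (m + c) - 1ℤ - m ≡ c
    cancel = solve-∀
    eq₁ : ∀ ℓ y m c → ℓ + y ≡ 1ℤ + (m + c) → ℓ - 1ℤ + (y - m) ≡ c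
    eq₁ ℓ y m c p = trans (regroup₁ ℓ y m) (trans (cong (λ t → t - 1ℤ - m) p) (cancel m c))
    eq₂ : ∀ ℓ y m c → ℓ + y ≡ 1ℤ + (m + c) → ℓ - m + (y - 1ℤ) ≡ c
    eq₂ ℓ y m c p = trans (regroup₂ ℓ y m) (trans (cong (λ t → t - 1ℤ - m) p) (cancel m c))
    eq₃ : ∀ s t → s - t ≡ - (t - s)
    eq₃ = solve-∀

  δδ-at : ∀ ℓ → δ (δ (n ^B b)) ℓ ≡ (a (3 ℕ.+ j) (+ ℓ - 1ℤ - 1ℤ) - a (3 ℕ.+ j) (+ ℓ - 1ℤ - + m)) - (a (3 ℕ.+ j) (+ ℓ - + m - 1ℤ) - a (3 ℕ.+ j) (+ ℓ - + m - + m))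
  δδ-at ℓ = trans (at (δδ-^B n (3 ℕ.+ j)) ℓ) (trans (ext-v n (v n ⊛ n ^B (3 ℕ.+ j)) (+ ℓ))
    (cong₂ _-_ (ext-v n (n ^B (3 ℕ.+ j)) (+ ℓ - 1ℤ)) (ext-v n (n ^B (3 ℕ.+ j)) (+ ℓ - + m))))

  -- With a = B^(3+j) the second difference is a (ℓ - 2) - 2 a (ℓ - 1 - m) + a (ℓ - 2 m). The middle
  -- point is within bounded distance of the centre of a, and the outer ones are about m away from
  -- it, so by `peak` each outer value is lower by w · w^(1+j). `y₂` is the mirror image of ℓ - 2.
  δδ-peak : ∀ ℓ → b ℕ.* m ℕ.≤ ℓ ℕ.+ ℓ ℕ.+ T → ℓ ℕ.+ ℓ ℕ.≤ b ℕ.* m ℕ.+ T ℕ.+ 2 → δ (δ (n ^B b)) ℓ + + (w ℕ.^ (2 ℕ.+ j)) ≤ 0ℤ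
  δδ-peak ℓ lo hi = ≤-by
    (nn (peak {+ lo₀} {+ C} {+ K} su w (slope (1 ℕ.+ j)) z y₁ (≤-by (cast 3w+3≤m ⊞ 0≤+ w ⊞ 0≤+ 2) (eq₁ (+ ℓ) (+ w) (+ m))) 2z≤ lo≤) ⊞
     nn (peak {+ lo₀} {+ C} {+ K} su w (slope (1 ℕ.+ j)) z y₂ (≤-by (cast lo ⊞ cast T≤w ⊞ cast 3w+3≤m) (eq₂ (+ ℓ) (+ w) (+ T) (+ m) (+ C))) 2z≤ lo≤) ⊞ 0≤+ (w ℕ.* K))
    (trans (cong₂ (λ s t → 0ℤ - (s + t)) (trans (δδ-at ℓ) (cong₂ (λ s t → (s - a (3 ℕ.+ j) z) - (a (3 ℕ.+ j) t - a (3 ℕ.+ j) y₁))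
             (symmetric su (+ ℓ - 1ℤ - 1ℤ) y₂ (eq₃ (+ ℓ) (+ C))) (eq₄ (+ ℓ) (+ m)))) (ℤₚ.pos-* w K))
       (trans (eq₅ (a (3 ℕ.+ j) z) (a (3 ℕ.+ j) y₁) (a (3 ℕ.+ j) y₂) (+ w * + K)) (cong (λ t → a (3 ℕ.+ j) z - (a (3 ℕ.+ j) y₁ + + w * + K) + (a (3 ℕ.+ j) z - (a (3 ℕ.+ j) y₂ + + w * + K)) + t) (sym (ℤₚ.pos-* w K)))))
    where
    K lo₀ C : ℕ
    K   = w ℕ.^ (1 ℕ.+ j)
    lo₀ = (3 ℕ.+ j) ℕ.* w
    C   = (3 ℕ.+ j) ℕ.* m
    su : SymmetricUnimodal (+ C) (a (3 ℕ.+ j))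
    su = symmetricUnimodal (3 ℕ.+ j)
    z y₁ y₂ : ℤ
    z  = + ℓ - 1ℤ - + m
    y₁ = + ℓ - + m - + m
    y₂ = + C - (+ ℓ - 1ℤ - 1ℤ)
    3w+3≤m : w ℕ.+ w ℕ.+ w ℕ.+ 3 ℕ.≤ m
    3w+3≤m = ℕₚ.≤-trans (ℕₚ.+-monoʳ-≤ (w ℕ.+ w ℕ.+ w) (ℕₚ.≤-trans (ℕₚ.*-monoʳ-≤ 3 1≤w) (ℕₚ.m≤m+n (3 ℕ.* w) w))) (ℕₚ.≤-trans (ℕₚ.≤-reflexive (eq w)) 7w≤m)
      where
      eq : ∀ w → w ℕ.+ w ℕ.+ w ℕ.+ (3 ℕ.* w ℕ.+ w) ≡ 7 ℕ.* w
      eq = ℕ-solve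
    eq₁ : ∀ ℓ w m → ℓ - 1ℤ - m - (w + w) - (ℓ - m - m) ≡ m - (w + w + w + + 3) + w + + 2
    eq₁ = solve-∀
    eq₂ : ∀ ℓ w T m C → ℓ - 1ℤ - m - (w + w) - (C - (ℓ - 1ℤ - 1ℤ)) ≡ ℓ + ℓ + T - (m + (m + C)) + (w - T) + (m - (w + w + w + + 3))
    eq₂ = solve-∀
    2z≤ : z + z ≤ + C + + w
    2z≤ = ≤-by (cast hi ⊞ cast T≤w) (eq (+ ℓ) (+ w) (+ T) (+ m) (+ C))
      where
      eq : ∀ ℓ w T m C → C + w - (ℓ - 1ℤ - m + (ℓ - 1ℤ - m)) ≡ m + (m + C) + T + + 2 - (ℓ + ℓ) + (w - T)
      eq = solve-∀
    lo≤ : + lo₀ ≤ z - (+ w + + w) + 1ℤ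
    lo≤ = ℤₚ.0≤i-j⇒j≤i (half-nonneg _ (subst (0ℤ ≤_) (eq (+ ℓ) (+ w) (+ T) (+ m) (+ C) (+ lo₀)) (cast lo ⊞ cast T≤w ⊞ cast (room (1 ℕ.+ j)) ⊞ nn (ℤ.+≤+ 2w≤m))))
      where
      eq : ∀ ℓ w T m C k → ℓ + ℓ + T - (m + (m + C)) + (w - T) + (C - (k + k + (w + w + w + m))) + (m - (w + w)) ≡
           ℓ - 1ℤ - m - (w + w) + 1ℤ - k + (ℓ - 1ℤ - m - (w + w) + 1ℤ - k)
      eq = solve-∀
    eq₃ : ∀ ℓ C → ℓ - 1ℤ - 1ℤ + (C - (ℓ - 1ℤ - 1ℤ)) ≡ C
    eq₃ = solve-∀
    eq₄ : ∀ ℓ m → ℓ - m - 1ℤ ≡ ℓ - 1ℤ - m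
    eq₄ = solve-∀
    eq₅ : ∀ s t u K → 0ℤ - (u - s - (s - t) + K) ≡ s - (t + K) + (s - (u + K)) + K
    eq₅ = solve-∀

-- At least five parts

module Bd = Bounded
halve : ∀ p → ∃[ h ] (h ℕ.+ h ℕ.≤ p × p ℕ.≤ suc (h ℕ.+ h))
halve zero          = 0 , z≤n , z≤n
halve (suc zero)    = 0 , z≤n , s≤s z≤n
halve (suc (suc p)) = let h , lo , hi = halve p in
    suc h
  , s≤s (subst (ℕ._≤ suc p) (sym (ℕₚ.+-suc h h)) (s≤s lo))
  , s≤s (subst (λ t → suc p ℕ.≤ suc t) (sym (ℕₚ.+-suc h h)) (s≤s hi))

^-distribʳ-* : ∀ x y k → (x ℕ.* y) ℕ.^ k ≡ x ℕ.^ k ℕ.* y ℕ.^ k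
^-distribʳ-* x y zero    = refl
^-distribʳ-* x y (suc k) = trans (cong (x ℕ.* y ℕ.*_) (^-distribʳ-* x y k)) (eq x y (x ℕ.^ k) (y ℕ.^ k))
  where
  eq : ∀ x y s t → x ℕ.* y ℕ.* (s ℕ.* t) ≡ x ℕ.* s ℕ.* (y ℕ.* t)
  eq = ℕ-solve

abs-bounds : ∀ i K → ∣ i ∣ ℕ.≤ K → (0ℤ ≤ i + + K) × (i ≤ + K)
abs-bounds (+ i)     K le = ℤ.+≤+ z≤n , ℤ.+≤+ le
abs-bounds -[1+ i ]  K le = ℤₚ.≤-trans (nn (ℤ.+≤+ le)) (ℤₚ.≤-reflexive (ℤₚ.+-comm (+ K) -[1+ i ])) , ℤ.-≤+

0≤*⇒0≤ : ∀ p .{{_ : NonZero p}} x → 0ℤ ≤ + p * x → 0ℤ ≤ x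
0≤*⇒0≤ (suc p) (+ x)    _ = ℤ.+≤+ z≤n
0≤*⇒0≤ (suc p) -[1+ x ] ()

Err-split : ∀ b n → const (+ (b !)) ⊛ f n b ≈ n ^B b ⊕ Err b n
Err-split b n = solve 2 (λ p r → p := r :+ (p :- r)) ≈-refl (const (+ (b !)) ⊛ f n b) (n ^B b)

D-split : ∀ b n → const (+ (b !)) ⊛ D n b ≈ δ (n ^B b) ⊕ δ (Err b n)
D-split b n = ≈-trans (solve 3 (λ x k g → k :* (x :* g) := x :* (k :* g)) ≈-refl (𝟙 ⊖ X) (const (+ (b !))) (f n b)) (≈-trans (δ-cong (Err-split b n)) (δ-⊕ (n ^B b) (Err b n)))

D-value : ∀ b n ℓ → + (b !) * D n b ℓ ≡ δ (n ^B b) ℓ + δ (Err b n) ℓ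
D-value b n ℓ = trans (sym (const-⊛ (+ (b !)) (D n b) ℓ)) (trans (at (D-split b n) ℓ) (⊕-at (δ (n ^B b)) (δ (Err b n)) ℓ))

δD-value : ∀ b n ℓ → + (b !) * δ (D n b) ℓ ≡ δ (δ (n ^B b)) ℓ + δ (δ (Err b n)) ℓ
δD-value b n ℓ = trans (sym (const-⊛ (+ (b !)) (δ (D n b)) ℓ)) (trans (at split-δ ℓ) (⊕-at (δ (δ (n ^B b))) (δ (δ (Err b n))) ℓ))
  where
  split-δ : const (+ (b !)) ⊛ δ (D n b) ≈ δ (δ (n ^B b)) ⊕ δ (δ (Err b n))
  split-δ = ≈-trans (solve 3 (λ x k g → k :* (x :* g) := x :* (k :* g)) ≈-refl (𝟙 ⊖ X) (const (+ (b !))) (D n b)) (≈-trans (δ-cong (D-split b n)) (δ-⊕ (δ (n ^B b)) (δ (Err b n))))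

module Large (j : ℕ) where

  -- With w ≈ n / c₀ and indices up to M w, the errors in the first and second differences are at
  -- most T₁ w^(2+j) and T₂ w^(1+j), while the model contributes at least T₁ w^(2+j) at distance
  -- T₁ / 2 from the centre and at most - w^(2+j) near it.
  b c₀ M T₁ T₂ W₀ : ℕ
  b  = 5 ℕ.+ j
  c₀ = 7 ℕ.+ j
  M  = b ℕ.* (2 ℕ.* c₀) ℕ.+ 3
  T₁ = Bd.factor (bounded-δErr j) ℕ.* M ℕ.^ (2 ℕ.+ j)
  T₂ = Bd.factor (bounded-δδErr j) ℕ.* M ℕ.^ (1 ℕ.+ j)
  W₀ = 1 ℕ.+ T₁ ℕ.+ T₂

  module Scale (n w : ℕ) (W₀≤w : W₀ ℕ.≤ w) (c₀w≤m : c₀ ℕ.* w ℕ.≤ suc n) (m≤ : suc n ℕ.≤ c₀ ℕ.+ c₀ ℕ.* w) where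

    m : ℕ
    m = suc n

    1≤w : 1 ℕ.≤ w
    1≤w = ℕₚ.≤-trans (s≤s z≤n) W₀≤w

    T₁≤w : T₁ ℕ.≤ w
    T₁≤w = ℕₚ.≤-trans (ℕₚ.≤-trans (ℕₚ.n≤1+n T₁) (ℕₚ.m≤m+n (suc T₁) T₂)) W₀≤w

    T₂≤w : T₂ ℕ.≤ w
    T₂≤w = ℕₚ.≤-trans (ℕₚ.m≤n+m T₂ (suc T₁)) W₀≤w

    7w≤m : 7 ℕ.* w ℕ.≤ m
    7w≤m = ℕₚ.≤-trans (ℕₚ.*-monoˡ-≤ w (ℕₚ.m≤m+n 7 j)) c₀w≤m

    open Differences j n w T₁ 1≤w 7w≤m T₁≤w using (δ-lower; δ-antisym; δδ-peak)

    -- Makes the range of `δ-lower` begin no later than `suc n`, where `D-nonneg-low` ends.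
    margin : (4 ℕ.+ j) ℕ.* w ℕ.+ T₁ ℕ.≤ m
    margin = ℕₚ.≤-trans (ℕₚ.+-monoʳ-≤ ((4 ℕ.+ j) ℕ.* w) T₁≤w) (ℕₚ.≤-trans (ℕₚ.m≤m+n _ (2 ℕ.* w)) (ℕₚ.≤-trans (ℕₚ.≤-reflexive (eq j w)) c₀w≤m))
      where
      eq : ∀ j w → (4 ℕ.+ j) ℕ.* w ℕ.+ w ℕ.+ 2 ℕ.* w ≡ (7 ℕ.+ j) ℕ.* w
      eq = ℕ-solve

    -- Turns bounds by powers of the index into bounds by powers of w: since w ≥ 1, m ≤ c₀ + c₀ w ≤
    -- 2 c₀ w, which is the origin of `M`.
    range : ∀ {x} → x ℕ.≤ b ℕ.* m ℕ.+ 3 → x ℕ.≤ M ℕ.* w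
    range {x} x≤ = begin
      x                                     ≤⟨ x≤ ⟩
      b ℕ.* m ℕ.+ 3                         ≤⟨ ℕₚ.+-mono-≤ (ℕₚ.*-monoʳ-≤ b m≤2c₀w) (ℕₚ.*-monoʳ-≤ 3 1≤w) ⟩
      b ℕ.* (2 ℕ.* c₀ ℕ.* w) ℕ.+ 3 ℕ.* w    ≡⟨ eq b c₀ w ⟩
      M ℕ.* w                               ∎
      where
      open ℕₚ.≤-Reasoning
      eq : ∀ b c₀ w → b ℕ.* (2 ℕ.* c₀ ℕ.* w) ℕ.+ 3 ℕ.* w ≡ (b ℕ.* (2 ℕ.* c₀) ℕ.+ 3) ℕ.* w
      eq = ℕ-solve
      eq₂ : ∀ c₀ w → c₀ ℕ.* w ℕ.+ c₀ ℕ.* w ≡ 2 ℕ.* c₀ ℕ.* w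
      eq₂ = ℕ-solve
      m≤2c₀w : m ℕ.≤ 2 ℕ.* c₀ ℕ.* w
      m≤2c₀w = ℕₚ.≤-trans m≤ (ℕₚ.≤-trans (ℕₚ.+-monoˡ-≤ (c₀ ℕ.* w) (ℕₚ.≤-trans (ℕₚ.≤-reflexive (sym (ℕₚ.*-identityʳ c₀))) (ℕₚ.*-monoʳ-≤ c₀ 1≤w))) (ℕₚ.≤-reflexive (eq₂ c₀ w)))

    power : ∀ K k {ℓ} → suc ℓ ℕ.≤ M ℕ.* w → K ℕ.* suc ℓ ℕ.^ k ℕ.≤ K ℕ.* M ℕ.^ k ℕ.* w ℕ.^ k
    power K k le = ℕₚ.≤-trans (ℕₚ.*-monoʳ-≤ K (ℕₚ.≤-trans (ℕₚ.^-monoˡ-≤ k le) (ℕₚ.≤-reflexive (^-distribʳ-* M w k)))) (ℕₚ.≤-reflexive (sym (ℕₚ.*-assoc K _ _)))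

    error₁ : ∀ ℓ → suc ℓ ℕ.≤ b ℕ.* m ℕ.+ 3 → (0ℤ ≤ δ (Err b n) ℓ + + T₁ * + (w ℕ.^ (2 ℕ.+ j))) × (δ (Err b n) ℓ ≤ + T₁ * + (w ℕ.^ (2 ℕ.+ j)))
    error₁ ℓ le = subst (λ K → (0ℤ ≤ δ (Err b n) ℓ + K) × (δ (Err b n) ℓ ≤ K)) (ℤₚ.pos-* T₁ (w ℕ.^ (2 ℕ.+ j)))
      (abs-bounds (δ (Err b n) ℓ) _ (ℕₚ.≤-trans (Bd.bound (bounded-δErr j) n ℓ) (power (Bd.factor (bounded-δErr j)) (2 ℕ.+ j) (range le))))

    -- A power of w is to spare: T₂ ≤ w turns T₂ w^(1+j) into the w^(2+j) that `δδ-peak` provides.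
    -- In `error₁` the powers are equal, and there the half-width T₁ / 2 of the window has to match
    -- the constant.
    error₂ : ∀ ℓ → suc ℓ ℕ.≤ b ℕ.* m ℕ.+ 3 → δ (δ (Err b n)) ℓ ≤ + (w ℕ.^ (2 ℕ.+ j))
    error₂ ℓ le = proj₂ (abs-bounds (δ (δ (Err b n)) ℓ) _ (ℕₚ.≤-trans (Bd.bound (bounded-δδErr j) n ℓ)
      (ℕₚ.≤-trans (power (Bd.factor (bounded-δδErr j)) (1 ℕ.+ j) (range le)) (ℕₚ.*-monoˡ-≤ (w ℕ.^ (1 ℕ.+ j)) T₂≤w))))

    instance
      b!≢0 : NonZero (b !)
      b!≢0 = b ℕₚ.!≢0

    D-nonneg : ∀ ℓ → (4 ℕ.+ j) ℕ.* w ℕ.+ T₁ ℕ.≤ ℓ → ℓ ℕ.+ ℓ ℕ.+ T₁ ℕ.≤ b ℕ.* m → 0ℤ ≤ D n b ℓ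
    D-nonneg ℓ lo hi = 0≤*⇒0≤ (b !) (D n b ℓ) (≤-by (nn (δ-lower ℓ lo hi) ⊞ proj₁ (error₁ ℓ small))
      (trans (cong (_- 0ℤ) (D-value b n ℓ)) (eq (δ (n ^B b) ℓ) (δ (Err b n) ℓ) (+ T₁ * + (w ℕ.^ (2 ℕ.+ j))))))
      where
      small : suc ℓ ℕ.≤ b ℕ.* m ℕ.+ 3
      small = ℕₚ.≤-trans (s≤s (ℕₚ.≤-trans (ℕₚ.≤-trans (ℕₚ.m≤m+n ℓ ℓ) (ℕₚ.m≤m+n (ℓ ℕ.+ ℓ) T₁)) hi)) (ℕₚ.≤-trans (ℕₚ.≤-reflexive (ℕₚ.+-comm 1 (b ℕ.* m))) (ℕₚ.+-monoʳ-≤ (b ℕ.* m) (s≤s z≤n)))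
      eq : ∀ p r t → p + r - 0ℤ ≡ p - t + (r + t)
      eq = solve-∀

    -- Only the model is antisymmetric: it is evaluated at the mirror index y, the error at ℓ
    -- itself.
    D-nonpos : ∀ ℓ y → ℓ ℕ.+ y ≡ suc (b ℕ.* m) → (4 ℕ.+ j) ℕ.* w ℕ.+ T₁ ℕ.≤ y → y ℕ.+ y ℕ.+ T₁ ℕ.≤ b ℕ.* m → D n b ℓ ≤ 0ℤ
    D-nonpos ℓ y total lo hi = subst (_≤ 0ℤ) (ℤₚ.neg-involutive (D n b ℓ)) (ℤₚ.neg-mono-≤ (0≤*⇒0≤ (b !) (- D n b ℓ)
      (≤-by (nn (δ-lower y lo hi) ⊞ nn (proj₂ (error₁ ℓ small)))
        (trans (cong (_- 0ℤ) (trans (sym (ℤₚ.neg-distribʳ-* (+ (b !)) (D n b ℓ))) (cong -_ (trans (D-value b n ℓ) (cong (λ t → t + δ (Err b n) ℓ) (δ-antisym ℓ y total))))))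
          (eq (δ (n ^B b) y) (δ (Err b n) ℓ) (+ T₁ * + (w ℕ.^ (2 ℕ.+ j))))))))
      where
      small : suc ℓ ℕ.≤ b ℕ.* m ℕ.+ 3
      small = ℕₚ.≤-trans (s≤s (ℕₚ.≤-trans (ℕₚ.m≤m+n ℓ y) (ℕₚ.≤-reflexive total))) (ℕₚ.≤-trans (ℕₚ.≤-reflexive (ℕₚ.+-comm 2 (b ℕ.* m))) (ℕₚ.+-monoʳ-≤ (b ℕ.* m) (s≤s (s≤s z≤n))))
      eq : ∀ p r t → - (- p + r) - 0ℤ ≡ p - t + (t - r)
      eq = solve-∀

    D-decreasing : ∀ ℓ → b ℕ.* m ℕ.≤ suc ℓ ℕ.+ suc ℓ ℕ.+ T₁ → suc ℓ ℕ.+ suc ℓ ℕ.≤ b ℕ.* m ℕ.+ T₁ ℕ.+ 2 → suc (suc ℓ) ℕ.≤ b ℕ.* m ℕ.+ 3 → D n b (suc ℓ) ≤ D n b ℓ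
    D-decreasing ℓ lo hi small = ≤-by (0≤*⇒0≤ (b !) (- δ (D n b) (suc ℓ))
      (≤-by (nn (δδ-peak (suc ℓ) lo hi) ⊞ nn (error₂ (suc ℓ) small))
        (trans (cong (_- 0ℤ) (trans (sym (ℤₚ.neg-distribʳ-* (+ (b !)) (δ (D n b) (suc ℓ)))) (cong -_ (δD-value b n (suc ℓ)))))
          (eq₁ (δ (δ (n ^B b)) (suc ℓ)) (δ (δ (Err b n)) (suc ℓ)) (+ (w ℕ.^ (2 ℕ.+ j)))))))
      (trans (eq₂ (D n b (suc ℓ)) (D n b ℓ)) (cong -_ (sym (δ-suc (D n b) ℓ))))
      where
      eq₁ : ∀ p r t → - (p + r) - 0ℤ ≡ 0ℤ - (p + t) + (t - r)
      eq₁ = solve-∀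
      eq₂ : ∀ s t → t - s ≡ - (s - t)
      eq₂ = solve-∀

    T₁≤bm : T₁ ℕ.≤ b ℕ.* m
    T₁≤bm = ℕₚ.≤-trans (ℕₚ.m≤n+m T₁ _) (ℕₚ.≤-trans margin (ℕₚ.m≤m+n m _))

    -- `L` is the last index with 2 L + T₁ ≤ b m, where `D-nonneg` still applies. By reflection
    -- `D-nonpos` applies beyond `suc T₁ + L`, so the window has length `suc T₁` for every n.
    P L : ℕ
    P = b ℕ.* m ℕ.∸ T₁
    L = proj₁ (halve P)

    P+T₁ : P ℕ.+ T₁ ≡ b ℕ.* m
    P+T₁ = ℕₚ.m∸n+n≡m T₁≤bm

    2L≤P : L ℕ.+ L ℕ.≤ P
    2L≤P = proj₁ (proj₂ (halve P))

    P≤2L+1 : P ℕ.≤ suc (L ℕ.+ L)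
    P≤2L+1 = proj₂ (proj₂ (halve P))

    up : ∀ ℓ → ℓ ℕ.≤ L → 0ℤ ≤ D n b ℓ
    up ℓ ℓ≤L with ℓ ≤? n
    ... | yes ℓ≤n = D-nonneg-low n (4 ℕ.+ j) ℓ ℓ≤n
    ... | no  ℓ≰n = D-nonneg ℓ (ℕₚ.≤-trans margin (ℕₚ.≰⇒> ℓ≰n))
      (ℕₚ.≤-trans (ℕₚ.+-monoˡ-≤ T₁ (ℕₚ.≤-trans (ℕₚ.+-mono-≤ ℓ≤L ℓ≤L) 2L≤P)) (ℕₚ.≤-reflexive P+T₁))

    down : ∀ ℓ → suc T₁ ℕ.+ L ℕ.< ℓ → D n b ℓ ≤ 0ℤ
    down ℓ lt with ℓ ≤? suc ((4 ℕ.+ j) ℕ.* m)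
    ... | no  ℓ≰ = D-nonpos-high n (4 ℕ.+ j) ℓ (ℕₚ.≰⇒> ℓ≰)
    ... | yes ℓ≤ = D-nonpos ℓ y total (ℕₚ.≤-trans margin m≤y)
      (ℕₚ.+-cancelˡ-≤ (ℓ ℕ.+ ℓ) _ _ (ℕₚ.≤-trans (ℕₚ.≤-reflexive double) (ℕₚ.+-monoˡ-≤ (b ℕ.* m) far)))
      where
      complement : ∃[ k ] ℓ ℕ.+ k ≡ suc ((4 ℕ.+ j) ℕ.* m)
      complement = ℕₚ.m≤n⇒∃[o]m+o≡n ℓ≤
      y : ℕ
      y = proj₁ complement ℕ.+ m
      total : ℓ ℕ.+ y ≡ suc (b ℕ.* m)
      total = trans (sym (ℕₚ.+-assoc ℓ _ m)) (trans (cong (ℕ._+ m) (proj₂ complement)) (cong suc (ℕₚ.+-comm ((4 ℕ.+ j) ℕ.* m) m)))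
      m≤y : m ℕ.≤ y
      m≤y = ℕₚ.m≤n+m m _
      double : ℓ ℕ.+ ℓ ℕ.+ (y ℕ.+ y ℕ.+ T₁) ≡ (2 ℕ.+ T₁ ℕ.+ b ℕ.* m) ℕ.+ b ℕ.* m
      double = trans (eq₁ ℓ y T₁) (trans (cong (λ t → t ℕ.+ t ℕ.+ T₁) total) (eq₂ (b ℕ.* m) T₁))
        where
        eq₁ : ∀ ℓ y T → ℓ ℕ.+ ℓ ℕ.+ (y ℕ.+ y ℕ.+ T) ≡ ℓ ℕ.+ y ℕ.+ (ℓ ℕ.+ y) ℕ.+ T
        eq₁ = ℕ-solve
        eq₂ : ∀ s T → suc s ℕ.+ suc s ℕ.+ T ≡ (2 ℕ.+ T ℕ.+ s) ℕ.+ s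
        eq₂ = ℕ-solve
      far : 2 ℕ.+ T₁ ℕ.+ b ℕ.* m ℕ.≤ ℓ ℕ.+ ℓ
      far = begin
        2 ℕ.+ T₁ ℕ.+ b ℕ.* m                                           ≡⟨ cong (2 ℕ.+ T₁ ℕ.+_) (sym P+T₁) ⟩
        2 ℕ.+ T₁ ℕ.+ (P ℕ.+ T₁)                                        ≤⟨ ℕₚ.+-monoʳ-≤ (2 ℕ.+ T₁) (ℕₚ.+-monoˡ-≤ T₁ P≤2L+1) ⟩
        2 ℕ.+ T₁ ℕ.+ (suc (L ℕ.+ L) ℕ.+ T₁)                            ≤⟨ ℕₚ.n≤1+n _ ⟩
        suc (2 ℕ.+ T₁ ℕ.+ (suc (L ℕ.+ L) ℕ.+ T₁))                      ≡⟨ eq T₁ L ⟩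
        suc (suc T₁ ℕ.+ L) ℕ.+ suc (suc T₁ ℕ.+ L)                      ≤⟨ ℕₚ.+-mono-≤ lt lt ⟩
        ℓ ℕ.+ ℓ                                                        ∎
        where
        open ℕₚ.≤-Reasoning
        eq : ∀ T L → suc (2 ℕ.+ T ℕ.+ (suc (L ℕ.+ L) ℕ.+ T)) ≡ suc (suc T ℕ.+ L) ℕ.+ suc (suc T ℕ.+ L)
        eq = ℕ-solve

    decreasing : ∀ ℓ → L ℕ.< ℓ → ℓ ℕ.< suc T₁ ℕ.+ L → D n b (suc ℓ) ≤ D n b ℓ
    decreasing ℓ L<ℓ ℓ<  = D-decreasing ℓ lo hi small
      where
      open ℕₚ.≤-Reasoning
      lo : b ℕ.* m ℕ.≤ suc ℓ ℕ.+ suc ℓ ℕ.+ T₁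
      lo = begin
        b ℕ.* m                        ≡⟨ sym P+T₁ ⟩
        P ℕ.+ T₁                       ≤⟨ ℕₚ.+-monoˡ-≤ T₁ (ℕₚ.≤-trans P≤2L+1 (s≤s (ℕₚ.+-mono-≤ (ℕₚ.<⇒≤ L<ℓ) (ℕₚ.m≤n⇒m≤1+n (ℕₚ.<⇒≤ L<ℓ))))) ⟩
        suc ℓ ℕ.+ suc ℓ ℕ.+ T₁         ∎
      hi : suc ℓ ℕ.+ suc ℓ ℕ.≤ b ℕ.* m ℕ.+ T₁ ℕ.+ 2
      hi = begin
        suc ℓ ℕ.+ suc ℓ                            ≤⟨ ℕₚ.+-mono-≤ ℓ< ℓ< ⟩
        suc T₁ ℕ.+ L ℕ.+ (suc T₁ ℕ.+ L)            ≡⟨ eq T₁ L ⟩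
        L ℕ.+ L ℕ.+ T₁ ℕ.+ T₁ ℕ.+ 2                ≤⟨ ℕₚ.+-monoˡ-≤ 2 (ℕₚ.+-monoˡ-≤ T₁ (ℕₚ.≤-trans (ℕₚ.+-monoˡ-≤ T₁ 2L≤P) (ℕₚ.≤-reflexive P+T₁))) ⟩
        b ℕ.* m ℕ.+ T₁ ℕ.+ 2                       ∎
        where
        eq : ∀ T L → suc T ℕ.+ L ℕ.+ (suc T ℕ.+ L) ≡ L ℕ.+ L ℕ.+ T ℕ.+ T ℕ.+ 2
        eq = ℕ-solve
      small : suc (suc ℓ) ℕ.≤ b ℕ.* m ℕ.+ 3
      small = begin
        suc (suc ℓ)                     ≤⟨ s≤s ℓ< ⟩
        suc (suc T₁ ℕ.+ L)              ≡⟨ eq T₁ L ⟩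
        L ℕ.+ T₁ ℕ.+ 2                  ≤⟨ ℕₚ.+-mono-≤ (ℕₚ.≤-trans (ℕₚ.+-monoˡ-≤ T₁ (ℕₚ.≤-trans (ℕₚ.m≤m+n L L) 2L≤P)) (ℕₚ.≤-reflexive P+T₁)) (s≤s (s≤s z≤n)) ⟩
        b ℕ.* m ℕ.+ 3                   ∎
        where
        eq : ∀ T L → suc (suc T ℕ.+ L) ≡ L ℕ.+ T ℕ.+ 2
        eq = ℕ-solve

    unimodal : Unimodal (c n b)
    unimodal = unimodal-window n b (suc T₁) L up down decreasing

  unimodal-large : ∃[ N ] (∀ n → N ℕ.≤ n → Unimodal (c n b))
  -- The scale w is the integer part of m / c₀, which is at least `W₀` once n ≥ W₀ c₀.
  unimodal-large = W₀ ℕ.* c₀ , λ n N≤n → Scale.unimodal n (suc n / c₀)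
    (ℕₚ.≤-trans (ℕₚ.≤-reflexive (sym (m*n/n≡m W₀ c₀))) (/-monoˡ-≤ c₀ (ℕₚ.m≤n⇒m≤1+n N≤n)))
    (ℕₚ.≤-trans (ℕₚ.≤-reflexive (ℕₚ.*-comm c₀ (suc n / c₀))) (m/n*n≤m (suc n) c₀))
    (ℕₚ.≤-trans (ℕₚ.≤-reflexive (m≡m%n+[m/n]*n (suc n) c₀)) (ℕₚ.+-mono-≤ (ℕₚ.<⇒≤ (m%n<n (suc n) c₀)) (ℕₚ.≤-reflexive (ℕₚ.*-comm (suc n / c₀) c₀))))

-- At most four parts

-- Quasi-polynomial inequalities are proved by a table over one period and a step by the period.
periodic-induction : ∀ k (P : ℕ → Set) → (∀ {y} → y ℕ.< suc k → P y) → (∀ y → P y → P (suc k ℕ.+ y)) → ∀ y → P y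
periodic-induction k P base step = <-rec P go
  where
  go : ∀ y → (∀ {z} → z ℕ.< y → P z) → P y
  go y rec with split (suc k) y
  ... | below y<  = base y<
  ... | above z   = step z (rec (ℕₚ.m<n+m z (s≤s z≤n)))

opaque
  -- p₂₃, for instance, counts partitions into parts 2 and 3.
  p₂ p₂₃ p₂₃₄ p₁₂ p₁₂₃ : ℕ → ℕ
  p₂ 0             = 1
  p₂ 1             = 0
  p₂ (suc (suc x)) = p₂ x
  p₂₃ 0                   = 1
  p₂₃ 1                   = 0
  p₂₃ 2                   = 1
  p₂₃ (suc (suc (suc x))) = p₂ (3 ℕ.+ x) ℕ.+ p₂₃ x
  p₂₃₄ 0                         = 1
  p₂₃₄ 1                         = 0
  p₂₃₄ 2                         = 1
  p₂₃₄ 3                         = 1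
  p₂₃₄ (suc (suc (suc (suc x)))) = p₂₃ (4 ℕ.+ x) ℕ.+ p₂₃₄ x
  p₁₂ 0             = 1
  p₁₂ 1             = 1
  p₁₂ (suc (suc x)) = suc (p₁₂ x)
  p₁₂₃ 0                   = 1
  p₁₂₃ 1                   = 1
  p₁₂₃ 2                   = 2
  p₁₂₃ (suc (suc (suc x))) = p₁₂ (3 ℕ.+ x) ℕ.+ p₁₂₃ x

  p₂-alternates : ∀ x → p₂ x ℕ.+ p₂ (suc x) ≡ 1
  p₂-alternates 0             = refl
  p₂-alternates 1             = refl
  p₂-alternates (suc (suc x)) = p₂-alternates x

  -- Unfolding twice adds `p₂` at two arguments of opposite parity, exactly one of which
  -- contributes.
  p₂₃-6 : ∀ x → p₂₃ (6 ℕ.+ x) ≡ suc (p₂₃ x)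
  p₂₃-6 x = trans (sym (ℕₚ.+-assoc (p₂ x) (p₂ (suc x)) (p₂₃ x))) (cong (ℕ._+ p₂₃ x) (p₂-alternates x))

  -- The sign of `d n 3` in the lower half: at ℓ = m + 3 + y with m = 5 + 2 y + u the difference is
  -- `p₂₃` (ℓ - 6) - `p₁₂` y. Two more in y add 1 to both sides; six more in u add 1 to the right
  -- side alone.
  p₁₂≤p₂₃ : ∀ u y → p₁₂ y ℕ.≤ p₂₃ (3 ℕ.* y ℕ.+ 2 ℕ.+ u)
  p₁₂≤p₂₃ u = periodic-induction 1 _ (λ {y} y<2 → base y y<2 u) step
    where
    step : ∀ y → p₁₂ y ℕ.≤ p₂₃ (3 ℕ.* y ℕ.+ 2 ℕ.+ u) → p₁₂ (2 ℕ.+ y) ℕ.≤ p₂₃ (3 ℕ.* (2 ℕ.+ y) ℕ.+ 2 ℕ.+ u)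
    step y ih = subst (p₁₂ (2 ℕ.+ y) ℕ.≤_) (sym (trans (cong p₂₃ (eq y u)) (p₂₃-6 (3 ℕ.* y ℕ.+ 2 ℕ.+ u)))) (s≤s ih)
      where
      eq : ∀ y u → 3 ℕ.* (2 ℕ.+ y) ℕ.+ 2 ℕ.+ u ≡ 6 ℕ.+ (3 ℕ.* y ℕ.+ 2 ℕ.+ u)
      eq = ℕ-solve
    base : ∀ y → y ℕ.< 2 → ∀ u → p₁₂ y ℕ.≤ p₂₃ (3 ℕ.* y ℕ.+ 2 ℕ.+ u)
    base y y<2 = periodic-induction 5 _ (λ u<6 → from-yes (ℕₚ.allUpTo? (λ y → ℕₚ.allUpTo? (λ u → p₁₂ y ≤? p₂₃ (3 ℕ.* y ℕ.+ 2 ℕ.+ u)) 6) 2) y<2 u<6)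
      (λ u ih → subst (p₁₂ y ℕ.≤_) (sym (trans (cong p₂₃ (eq y u)) (p₂₃-6 (3 ℕ.* y ℕ.+ 2 ℕ.+ u)))) (ℕₚ.m≤n⇒m≤1+n ih))
      where
      eq : ∀ y u → 3 ℕ.* y ℕ.+ 2 ℕ.+ (6 ℕ.+ u) ≡ 6 ℕ.+ (3 ℕ.* y ℕ.+ 2 ℕ.+ u)
      eq = ℕ-solve

  -- With m = n + 1 the difference of c n 3 at ℓ = m + 3 + y is p₂₃ (ℓ - 6) + p₂ (ℓ - 3) - p₁₂ y - 1.
  -- Here m = 8 + 2 y + u, and m = 6 + 2 y + u in D₃-right.
  D₃-left : ∀ u y → p₁₂ y ℕ.+ 1 ℕ.≤ p₂₃ (3 ℕ.* y ℕ.+ 5 ℕ.+ u) ℕ.+ p₂ (3 ℕ.* y ℕ.+ 8 ℕ.+ u)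
  D₃-left u = periodic-induction 1 _ (λ {y} y<2 → base y y<2 u) (λ y ih → subst (p₁₂ (2 ℕ.+ y) ℕ.+ 1 ℕ.≤_) (sym (shift y)) (s≤s ih))
    where
    shift : ∀ y → p₂₃ (3 ℕ.* (2 ℕ.+ y) ℕ.+ 5 ℕ.+ u) ℕ.+ p₂ (3 ℕ.* (2 ℕ.+ y) ℕ.+ 8 ℕ.+ u) ≡ suc (p₂₃ (3 ℕ.* y ℕ.+ 5 ℕ.+ u) ℕ.+ p₂ (3 ℕ.* y ℕ.+ 8 ℕ.+ u))
    shift y = cong₂ ℕ._+_ (trans (cong p₂₃ (eq₁ y u)) (p₂₃-6 (3 ℕ.* y ℕ.+ 5 ℕ.+ u))) (cong p₂ (eq₂ y u))
      where
      eq₁ : ∀ y u → 3 ℕ.* (2 ℕ.+ y) ℕ.+ 5 ℕ.+ u ≡ 6 ℕ.+ (3 ℕ.* y ℕ.+ 5 ℕ.+ u)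
      eq₁ = ℕ-solve
      eq₂ : ∀ y u → 3 ℕ.* (2 ℕ.+ y) ℕ.+ 8 ℕ.+ u ≡ 6 ℕ.+ (3 ℕ.* y ℕ.+ 8 ℕ.+ u)
      eq₂ = ℕ-solve
    base : ∀ y → y ℕ.< 2 → ∀ u → p₁₂ y ℕ.+ 1 ℕ.≤ p₂₃ (3 ℕ.* y ℕ.+ 5 ℕ.+ u) ℕ.+ p₂ (3 ℕ.* y ℕ.+ 8 ℕ.+ u)
    base y y<2 = periodic-induction 5 _ (λ u<6 → from-yes (ℕₚ.allUpTo? (λ y → ℕₚ.allUpTo? (λ u → p₁₂ y ℕ.+ 1 ≤? p₂₃ (3 ℕ.* y ℕ.+ 5 ℕ.+ u) ℕ.+ p₂ (3 ℕ.* y ℕ.+ 8 ℕ.+ u)) 6) 2) y<2 u<6)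
      (λ u ih → subst (p₁₂ y ℕ.+ 1 ℕ.≤_) (sym (cong₂ ℕ._+_ (trans (cong p₂₃ (eq₁ y u)) (p₂₃-6 (3 ℕ.* y ℕ.+ 5 ℕ.+ u))) (cong p₂ (eq₂ y u)))) (ℕₚ.m≤n⇒m≤1+n ih))
      where
      eq₁ : ∀ y u → 3 ℕ.* y ℕ.+ 5 ℕ.+ (6 ℕ.+ u) ≡ 6 ℕ.+ (3 ℕ.* y ℕ.+ 5 ℕ.+ u)
      eq₁ = ℕ-solve
      eq₂ : ∀ y u → 3 ℕ.* y ℕ.+ 8 ℕ.+ (6 ℕ.+ u) ≡ 6 ℕ.+ (3 ℕ.* y ℕ.+ 8 ℕ.+ u)
      eq₂ = ℕ-solve

  D₃-right : ∀ {u} → u ℕ.< 2 → ∀ y → p₂₃ (3 ℕ.* y ℕ.+ 3 ℕ.+ u) ℕ.+ p₂ (3 ℕ.* y ℕ.+ 6 ℕ.+ u) ℕ.≤ p₁₂ y ℕ.+ 1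
  D₃-right {u} u<2 = periodic-induction 1 _ (λ y<2 → from-yes (ℕₚ.allUpTo? (λ u → ℕₚ.allUpTo? (λ y → p₂₃ (3 ℕ.* y ℕ.+ 3 ℕ.+ u) ℕ.+ p₂ (3 ℕ.* y ℕ.+ 6 ℕ.+ u) ≤? p₁₂ y ℕ.+ 1) 2) 2) u<2 y<2)
    (λ y ih → subst (ℕ._≤ p₁₂ (2 ℕ.+ y) ℕ.+ 1) (sym (cong₂ ℕ._+_ (trans (cong p₂₃ (eq₁ y u)) (p₂₃-6 (3 ℕ.* y ℕ.+ 3 ℕ.+ u))) (cong p₂ (eq₂ y u)))) (s≤s ih))
    where
    eq₁ : ∀ y u → 3 ℕ.* (2 ℕ.+ y) ℕ.+ 3 ℕ.+ u ≡ 6 ℕ.+ (3 ℕ.* y ℕ.+ 3 ℕ.+ u)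
    eq₁ = ℕ-solve
    eq₂ : ∀ y u → 3 ℕ.* (2 ℕ.+ y) ℕ.+ 6 ℕ.+ u ≡ 6 ℕ.+ (3 ℕ.* y ℕ.+ 6 ℕ.+ u)
    eq₂ = ℕ-solve

  -- Increments over 6 and 12 steps; they are themselves quasi-linear, so the inequalities below
  -- reduce to finitely many cases.
  Δp₁₂₃ Δp₂₃₄ : ℕ → ℕ
  Δp₁₂₃ y = p₁₂ (6 ℕ.+ y) ℕ.+ p₁₂ (3 ℕ.+ y)
  Δp₂₃₄ x = p₂₃ (12 ℕ.+ x) ℕ.+ p₂₃ (8 ℕ.+ x) ℕ.+ p₂₃ (4 ℕ.+ x)

  p₁₂₃-6 : ∀ y → p₁₂₃ (6 ℕ.+ y) ≡ Δp₁₂₃ y ℕ.+ p₁₂₃ y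
  p₁₂₃-6 y = sym (ℕₚ.+-assoc (p₁₂ (6 ℕ.+ y)) (p₁₂ (3 ℕ.+ y)) (p₁₂₃ y))

  p₂₃₄-12 : ∀ x → p₂₃₄ (12 ℕ.+ x) ≡ Δp₂₃₄ x ℕ.+ p₂₃₄ x
  p₂₃₄-12 x = eq (p₂₃ (12 ℕ.+ x)) (p₂₃ (8 ℕ.+ x)) (p₂₃ (4 ℕ.+ x)) (p₂₃₄ x)
    where
    eq : ∀ s t u v → s ℕ.+ (t ℕ.+ (u ℕ.+ v)) ≡ s ℕ.+ t ℕ.+ u ℕ.+ v
    eq = ℕ-solve

  p₂₃-12 : ∀ x → p₂₃ (12 ℕ.+ x) ≡ 2 ℕ.+ p₂₃ x
  p₂₃-12 x = trans (p₂₃-6 (6 ℕ.+ x)) (cong suc (p₂₃-6 x))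

  Δp₁₂₃-6 : ∀ y → Δp₁₂₃ (6 ℕ.+ y) ≡ 6 ℕ.+ Δp₁₂₃ y
  Δp₁₂₃-6 y = eq (p₁₂ y) (p₁₂ (suc y))
    where
    eq : ∀ s t → 6 ℕ.+ s ℕ.+ (4 ℕ.+ t) ≡ 6 ℕ.+ (3 ℕ.+ s ℕ.+ (1 ℕ.+ t))
    eq = ℕ-solve

  Δp₂₃₄-6 : ∀ x → Δp₂₃₄ (6 ℕ.+ x) ≡ 3 ℕ.+ Δp₂₃₄ x
  Δp₂₃₄-6 x = trans (cong₂ ℕ._+_ (cong₂ ℕ._+_ (p₂₃-6 (12 ℕ.+ x)) (p₂₃-6 (8 ℕ.+ x))) (p₂₃-6 (4 ℕ.+ x))) (eq (p₂₃ (12 ℕ.+ x)) (p₂₃ (8 ℕ.+ x)) (p₂₃ (4 ℕ.+ x)))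
    where
    eq : ∀ s t u → suc s ℕ.+ suc t ℕ.+ suc u ≡ 3 ℕ.+ (s ℕ.+ t ℕ.+ u)
    eq = ℕ-solve

  Δp₂₃₄-12 : ∀ x → Δp₂₃₄ (12 ℕ.+ x) ≡ 6 ℕ.+ Δp₂₃₄ x
  Δp₂₃₄-12 x = trans (Δp₂₃₄-6 (6 ℕ.+ x)) (cong (3 ℕ.+_) (Δp₂₃₄-6 x))

  advance : ∀ k y t → 2 ℕ.* (6 ℕ.+ y) ℕ.+ k ℕ.+ t ≡ 12 ℕ.+ (2 ℕ.* y ℕ.+ k ℕ.+ t)
  advance = ℕ-solve

  advanceʳ : ∀ s x t → x ℕ.+ (s ℕ.+ t) ≡ s ℕ.+ (x ℕ.+ t)
  advanceʳ = ℕ-solve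

  -- Six more in y add 6 to both sides, and six more in t add 3 to the right side alone, so a table
  -- of six by six decides. The offset k and the slack i are those of the two applications.
  Δ-left : ∀ k i → (∀ {y} → y ℕ.< 6 → ∀ {t} → t ℕ.< 6 → Δp₁₂₃ y ℕ.+ i ℕ.≤ Δp₂₃₄ (2 ℕ.* y ℕ.+ k ℕ.+ t)) → ∀ t y → Δp₁₂₃ y ℕ.+ i ℕ.≤ Δp₂₃₄ (2 ℕ.* y ℕ.+ k ℕ.+ t)
  Δ-left k i table t = periodic-induction 5 _ (λ {y} y<6 → base y y<6 t)
    (λ y ih → subst₂ ℕ._≤_ (cong (ℕ._+ i) (sym (Δp₁₂₃-6 y))) (sym (trans (cong Δp₂₃₄ (advance k y t)) (Δp₂₃₄-12 (2 ℕ.* y ℕ.+ k ℕ.+ t)))) (ℕₚ.+-monoʳ-≤ 6 ih))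
    where
    base : ∀ y → y ℕ.< 6 → ∀ t → Δp₁₂₃ y ℕ.+ i ℕ.≤ Δp₂₃₄ (2 ℕ.* y ℕ.+ k ℕ.+ t)
    base y y<6 = periodic-induction 5 _ (table y<6)
      (λ t ih → subst (Δp₁₂₃ y ℕ.+ i ℕ.≤_) (sym (trans (cong Δp₂₃₄ (advanceʳ 6 (2 ℕ.* y ℕ.+ k) t)) (Δp₂₃₄-6 (2 ℕ.* y ℕ.+ k ℕ.+ t)))) (ℕₚ.≤-trans ih (ℕₚ.m≤n+m _ 3)))

  -- The sign of `d n 4` up to its centre: at ℓ = m + 6 + y with m = 6 + y + t the difference is
  -- `p₂₃₄` (ℓ - 10) - `p₁₂₃` y.
  p₁₂₃≤p₂₃₄ : ∀ t y → p₁₂₃ y ℕ.≤ p₂₃₄ (2 ℕ.* y ℕ.+ 2 ℕ.+ t)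
  p₁₂₃≤p₂₃₄ t = periodic-induction 5 _ (λ {y} y<6 → base y y<6 t) step
    where
    step : ∀ y → p₁₂₃ y ℕ.≤ p₂₃₄ (2 ℕ.* y ℕ.+ 2 ℕ.+ t) → p₁₂₃ (6 ℕ.+ y) ℕ.≤ p₂₃₄ (2 ℕ.* (6 ℕ.+ y) ℕ.+ 2 ℕ.+ t)
    step y ih = subst₂ ℕ._≤_ (sym (p₁₂₃-6 y)) (sym (trans (cong p₂₃₄ (advance 2 y t)) (p₂₃₄-12 (2 ℕ.* y ℕ.+ 2 ℕ.+ t))))
      (ℕₚ.+-mono-≤ (subst (ℕ._≤ Δp₂₃₄ (2 ℕ.* y ℕ.+ 2 ℕ.+ t)) (ℕₚ.+-identityʳ _)
        (Δ-left 2 0 (from-yes (ℕₚ.allUpTo? (λ y → ℕₚ.allUpTo? (λ t → Δp₁₂₃ y ℕ.+ 0 ≤? Δp₂₃₄ (2 ℕ.* y ℕ.+ 2 ℕ.+ t)) 6) 6)) t y)) ih)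
    base : ∀ y → y ℕ.< 6 → ∀ t → p₁₂₃ y ℕ.≤ p₂₃₄ (2 ℕ.* y ℕ.+ 2 ℕ.+ t)
    base y y<6 = periodic-induction 11 _ (from-yes (ℕₚ.allUpTo? (λ y → ℕₚ.allUpTo? (λ t → p₁₂₃ y ≤? p₂₃₄ (2 ℕ.* y ℕ.+ 2 ℕ.+ t)) 12) 6) y<6)
      (λ t ih → subst (p₁₂₃ y ℕ.≤_) (sym (trans (cong p₂₃₄ (advanceʳ 12 (2 ℕ.* y ℕ.+ 2) t)) (p₂₃₄-12 (2 ℕ.* y ℕ.+ 2 ℕ.+ t)))) (ℕₚ.≤-trans ih (ℕₚ.m≤n+m _ (Δp₂₃₄ (2 ℕ.* y ℕ.+ 2 ℕ.+ t)))))

  -- The difference of c n 4 at ℓ = m + 6 + y, where m = 8 + y + t; in D₄-right it is taken at 2 m and 2 m - 1.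
  D₄-left : ∀ t y → p₁₂₃ y ℕ.+ p₁₂ (3 ℕ.+ y) ℕ.+ 1 ℕ.≤ p₂₃₄ (2 ℕ.* y ℕ.+ 4 ℕ.+ t) ℕ.+ p₂₃ (2 ℕ.* y ℕ.+ 8 ℕ.+ t) ℕ.+ p₂ (2 ℕ.* y ℕ.+ 11 ℕ.+ t)
  D₄-left t = periodic-induction 5 _ (λ {y} y<6 → base y y<6 t) step
    where
    Claim : ℕ → ℕ → Set
    Claim y t = p₁₂₃ y ℕ.+ p₁₂ (3 ℕ.+ y) ℕ.+ 1 ℕ.≤ p₂₃₄ (2 ℕ.* y ℕ.+ 4 ℕ.+ t) ℕ.+ p₂₃ (2 ℕ.* y ℕ.+ 8 ℕ.+ t) ℕ.+ p₂ (2 ℕ.* y ℕ.+ 11 ℕ.+ t)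
    step : ∀ y → Claim y t → Claim (6 ℕ.+ y) t
    step y ih = subst₂ ℕ._≤_
      (trans (eq₁ (Δp₁₂₃ y) (p₁₂₃ y) (p₁₂ (3 ℕ.+ y))) (cong (λ s → s ℕ.+ p₁₂ (9 ℕ.+ y) ℕ.+ 1) (sym (p₁₂₃-6 y))))
      (trans (eq₂ (Δp₂₃₄ (2 ℕ.* y ℕ.+ 4 ℕ.+ t)) (p₂₃₄ (2 ℕ.* y ℕ.+ 4 ℕ.+ t)) (p₂₃ (2 ℕ.* y ℕ.+ 8 ℕ.+ t)) (p₂ (2 ℕ.* y ℕ.+ 11 ℕ.+ t)))
        (sym (cong₂ ℕ._+_ (cong₂ ℕ._+_ (trans (cong p₂₃₄ (advance 4 y t)) (p₂₃₄-12 (2 ℕ.* y ℕ.+ 4 ℕ.+ t))) (trans (cong p₂₃ (advance 8 y t)) (p₂₃-12 (2 ℕ.* y ℕ.+ 8 ℕ.+ t)))) (cong p₂ (advance 11 y t)))))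
      (ℕₚ.+-mono-≤ (ℕₚ.+-monoʳ-≤ 2 (Δ-left 4 1 (from-yes (ℕₚ.allUpTo? (λ y → ℕₚ.allUpTo? (λ t → Δp₁₂₃ y ℕ.+ 1 ≤? Δp₂₃₄ (2 ℕ.* y ℕ.+ 4 ℕ.+ t)) 6) 6)) t y)) ih)
      where
      eq₁ : ∀ Δ s u → 2 ℕ.+ (Δ ℕ.+ 1) ℕ.+ (s ℕ.+ u ℕ.+ 1) ≡ Δ ℕ.+ s ℕ.+ (3 ℕ.+ u) ℕ.+ 1
      eq₁ = ℕ-solve
      eq₂ : ∀ Δ s u v → 2 ℕ.+ Δ ℕ.+ (s ℕ.+ u ℕ.+ v) ≡ Δ ℕ.+ s ℕ.+ (2 ℕ.+ u) ℕ.+ v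
      eq₂ = ℕ-solve
    base : ∀ y → y ℕ.< 6 → ∀ t → Claim y t
    base y y<6 = periodic-induction 11 _ (from-yes (ℕₚ.allUpTo? (λ y → ℕₚ.allUpTo? (λ t → p₁₂₃ y ℕ.+ p₁₂ (3 ℕ.+ y) ℕ.+ 1 ≤? p₂₃₄ (2 ℕ.* y ℕ.+ 4 ℕ.+ t) ℕ.+ p₂₃ (2 ℕ.* y ℕ.+ 8 ℕ.+ t) ℕ.+ p₂ (2 ℕ.* y ℕ.+ 11 ℕ.+ t)) 12) 6) y<6)
      (λ t ih → ℕₚ.≤-trans ih (ℕₚ.+-mono-≤ (ℕₚ.+-mono-≤
        (subst (p₂₃₄ (2 ℕ.* y ℕ.+ 4 ℕ.+ t) ℕ.≤_) (sym (trans (cong p₂₃₄ (advanceʳ 12 (2 ℕ.* y ℕ.+ 4) t)) (p₂₃₄-12 (2 ℕ.* y ℕ.+ 4 ℕ.+ t)))) (ℕₚ.m≤n+m _ (Δp₂₃₄ (2 ℕ.* y ℕ.+ 4 ℕ.+ t))))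
        (subst (p₂₃ (2 ℕ.* y ℕ.+ 8 ℕ.+ t) ℕ.≤_) (sym (trans (cong p₂₃ (advanceʳ 12 (2 ℕ.* y ℕ.+ 8) t)) (p₂₃-12 (2 ℕ.* y ℕ.+ 8 ℕ.+ t)))) (ℕₚ.m≤n+m _ 2)))
        (ℕₚ.≤-reflexive (cong p₂ (sym (advanceʳ 12 (2 ℕ.* y ℕ.+ 11) t))))))

  D₄-right₀ : ∀ y → p₂₃₄ (2 ℕ.* y ℕ.+ 2 ℕ.+ 0) ℕ.+ p₂₃ (2 ℕ.* y ℕ.+ 6 ℕ.+ 0) ℕ.≤ p₁₂₃ y ℕ.+ p₁₂ (3 ℕ.+ y)
  D₄-right₀ = periodic-induction 5 _ (from-yes (ℕₚ.allUpTo? (λ y → p₂₃₄ (2 ℕ.* y ℕ.+ 2 ℕ.+ 0) ℕ.+ p₂₃ (2 ℕ.* y ℕ.+ 6 ℕ.+ 0) ≤? p₁₂₃ y ℕ.+ p₁₂ (3 ℕ.+ y)) 6)) step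
    where
    -- The summands 2 and 3 are the increments of `p₂₃` over 12 steps and of `p₁₂` over 6 steps.
    Δ-right : ∀ y → Δp₂₃₄ (2 ℕ.* y ℕ.+ 2 ℕ.+ 0) ℕ.+ 2 ℕ.≤ Δp₁₂₃ y ℕ.+ 3
    Δ-right = periodic-induction 5 _ (from-yes (ℕₚ.allUpTo? (λ y → Δp₂₃₄ (2 ℕ.* y ℕ.+ 2 ℕ.+ 0) ℕ.+ 2 ≤? Δp₁₂₃ y ℕ.+ 3) 6))
      (λ y ih → subst₂ ℕ._≤_ (cong (ℕ._+ 2) (sym (trans (cong Δp₂₃₄ (advance 2 y 0)) (Δp₂₃₄-12 (2 ℕ.* y ℕ.+ 2 ℕ.+ 0))))) (cong (ℕ._+ 3) (sym (Δp₁₂₃-6 y))) (ℕₚ.+-monoʳ-≤ 6 ih))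
    step : ∀ y → p₂₃₄ (2 ℕ.* y ℕ.+ 2 ℕ.+ 0) ℕ.+ p₂₃ (2 ℕ.* y ℕ.+ 6 ℕ.+ 0) ℕ.≤ p₁₂₃ y ℕ.+ p₁₂ (3 ℕ.+ y) → p₂₃₄ (2 ℕ.* (6 ℕ.+ y) ℕ.+ 2 ℕ.+ 0) ℕ.+ p₂₃ (2 ℕ.* (6 ℕ.+ y) ℕ.+ 6 ℕ.+ 0) ℕ.≤ p₁₂₃ (6 ℕ.+ y) ℕ.+ p₁₂ (9 ℕ.+ y)
    step y ih = subst₂ ℕ._≤_
      (trans (eq₁ (Δp₂₃₄ (2 ℕ.* y ℕ.+ 2 ℕ.+ 0)) (p₂₃₄ (2 ℕ.* y ℕ.+ 2 ℕ.+ 0)) (p₂₃ (2 ℕ.* y ℕ.+ 6 ℕ.+ 0)))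
        (sym (cong₂ ℕ._+_ (trans (cong p₂₃₄ (advance 2 y 0)) (p₂₃₄-12 (2 ℕ.* y ℕ.+ 2 ℕ.+ 0))) (trans (cong p₂₃ (advance 6 y 0)) (p₂₃-12 (2 ℕ.* y ℕ.+ 6 ℕ.+ 0))))))
      (trans (eq₂ (Δp₁₂₃ y) (p₁₂₃ y) (p₁₂ (3 ℕ.+ y))) (cong (ℕ._+ p₁₂ (9 ℕ.+ y)) (sym (p₁₂₃-6 y))))
      (ℕₚ.+-mono-≤ (Δ-right y) ih)
      where
      eq₁ : ∀ Δ s u → Δ ℕ.+ 2 ℕ.+ (s ℕ.+ u) ≡ Δ ℕ.+ s ℕ.+ (2 ℕ.+ u)
      eq₁ = ℕ-solve
      eq₂ : ∀ Δ s u → Δ ℕ.+ 3 ℕ.+ (s ℕ.+ u) ≡ Δ ℕ.+ s ℕ.+ (3 ℕ.+ u)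
      eq₂ = ℕ-solve

  D₄-right₁ : ∀ y → p₂₃₄ (2 ℕ.* y ℕ.+ 2 ℕ.+ 1) ℕ.+ p₂₃ (2 ℕ.* y ℕ.+ 6 ℕ.+ 1) ℕ.+ p₂ (2 ℕ.* y ℕ.+ 9 ℕ.+ 1) ℕ.≤ p₁₂₃ y ℕ.+ p₁₂ (3 ℕ.+ y) ℕ.+ 1
  D₄-right₁ = periodic-induction 5 _ (from-yes (ℕₚ.allUpTo? (λ y → p₂₃₄ (2 ℕ.* y ℕ.+ 2 ℕ.+ 1) ℕ.+ p₂₃ (2 ℕ.* y ℕ.+ 6 ℕ.+ 1) ℕ.+ p₂ (2 ℕ.* y ℕ.+ 9 ℕ.+ 1) ≤? p₁₂₃ y ℕ.+ p₁₂ (3 ℕ.+ y) ℕ.+ 1) 6)) step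
    where
    Δ-right : ∀ y → Δp₂₃₄ (2 ℕ.* y ℕ.+ 2 ℕ.+ 1) ℕ.+ 2 ℕ.≤ Δp₁₂₃ y ℕ.+ 3
    Δ-right = periodic-induction 5 _ (from-yes (ℕₚ.allUpTo? (λ y → Δp₂₃₄ (2 ℕ.* y ℕ.+ 2 ℕ.+ 1) ℕ.+ 2 ≤? Δp₁₂₃ y ℕ.+ 3) 6))
      (λ y ih → subst₂ ℕ._≤_ (cong (ℕ._+ 2) (sym (trans (cong Δp₂₃₄ (advance 2 y 1)) (Δp₂₃₄-12 (2 ℕ.* y ℕ.+ 2 ℕ.+ 1))))) (cong (ℕ._+ 3) (sym (Δp₁₂₃-6 y))) (ℕₚ.+-monoʳ-≤ 6 ih))
    step : ∀ y → p₂₃₄ (2 ℕ.* y ℕ.+ 2 ℕ.+ 1) ℕ.+ p₂₃ (2 ℕ.* y ℕ.+ 6 ℕ.+ 1) ℕ.+ p₂ (2 ℕ.* y ℕ.+ 9 ℕ.+ 1) ℕ.≤ p₁₂₃ y ℕ.+ p₁₂ (3 ℕ.+ y) ℕ.+ 1 →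
           p₂₃₄ (2 ℕ.* (6 ℕ.+ y) ℕ.+ 2 ℕ.+ 1) ℕ.+ p₂₃ (2 ℕ.* (6 ℕ.+ y) ℕ.+ 6 ℕ.+ 1) ℕ.+ p₂ (2 ℕ.* (6 ℕ.+ y) ℕ.+ 9 ℕ.+ 1) ℕ.≤ p₁₂₃ (6 ℕ.+ y) ℕ.+ p₁₂ (9 ℕ.+ y) ℕ.+ 1
    step y ih = subst₂ ℕ._≤_
      (trans (eq₁ (Δp₂₃₄ (2 ℕ.* y ℕ.+ 2 ℕ.+ 1)) (p₂₃₄ (2 ℕ.* y ℕ.+ 2 ℕ.+ 1)) (p₂₃ (2 ℕ.* y ℕ.+ 6 ℕ.+ 1)) (p₂ (2 ℕ.* y ℕ.+ 9 ℕ.+ 1)))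
        (sym (cong₂ ℕ._+_ (cong₂ ℕ._+_ (trans (cong p₂₃₄ (advance 2 y 1)) (p₂₃₄-12 (2 ℕ.* y ℕ.+ 2 ℕ.+ 1))) (trans (cong p₂₃ (advance 6 y 1)) (p₂₃-12 (2 ℕ.* y ℕ.+ 6 ℕ.+ 1)))) (cong p₂ (advance 9 y 1)))))
      (trans (eq₂ (Δp₁₂₃ y) (p₁₂₃ y) (p₁₂ (3 ℕ.+ y))) (cong (λ s → s ℕ.+ p₁₂ (9 ℕ.+ y) ℕ.+ 1) (sym (p₁₂₃-6 y))))
      (ℕₚ.+-mono-≤ (Δ-right y) ih)
      where
      eq₁ : ∀ Δ s u v → Δ ℕ.+ 2 ℕ.+ (s ℕ.+ u ℕ.+ v) ≡ Δ ℕ.+ s ℕ.+ (2 ℕ.+ u) ℕ.+ v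
      eq₁ = ℕ-solve
      eq₂ : ∀ Δ s u → Δ ℕ.+ 3 ℕ.+ (s ℕ.+ u ℕ.+ 1) ≡ Δ ℕ.+ s ℕ.+ (3 ℕ.+ u) ℕ.+ 1
      eq₂ = ℕ-solve

  p₂≤1 : ∀ x → p₂ x ℕ.≤ 1
  p₂≤1 0             = s≤s z≤n
  p₂≤1 1             = z≤n
  p₂≤1 (suc (suc x)) = p₂≤1 x

  p₁₂≤2 : ∀ {y} → y ℕ.< 3 → p₁₂ y ℕ.≤ 2
  p₁₂≤2 = from-yes (ℕₚ.allUpTo? (λ y → p₁₂ y ≤? 2) 3)

  3≤p₂₃ : ∀ x → 3 ℕ.≤ p₂₃ (18 ℕ.+ x)
  3≤p₂₃ x = subst (3 ℕ.≤_) (sym (trans (p₂₃-6 (12 ℕ.+ x)) (cong suc (p₂₃-12 x)))) (s≤s (s≤s (s≤s z≤n)))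

-- Expansion of the differences in powers of q^(n+1)

↑ : (ℕ → ℕ) → Series
↑ p ℓ = + p ℓ

-- The two hypotheses say that (1 - q^(k+1)) g = a; multiplication by `G k` inverts this.
G-char : ∀ k {g a} → (∀ {x} → x ℕ.< suc k → g x ≡ a x) → (∀ x → g (suc k ℕ.+ x) ≡ a (suc k ℕ.+ x) + g x) → G k ⊛ a ≈ g
G-char k {g} {a} small large = begin
  G k ⊛ a                              ≈⟨ ⊛-congˡ (≈-sym clear) ⟩
  G k ⊛ ((𝟙 ⊖ q^ (suc k)) ⊛ g)         ≈⟨ solve 3 (λ h p g → h :* (p :* g) := p :* h :* g) ≈-refl (G k) (𝟙 ⊖ q^ (suc k)) g ⟩
  (𝟙 ⊖ q^ (suc k)) ⊛ G k ⊛ g           ≈⟨ ⊛-congʳ (G-inverse k) ⟩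
  𝟙 ⊛ g                                ≈⟨ 1⊛ g ⟩
  g                                    ∎
  where
  open ≈-Reasoning
  value : ∀ ℓ → ((𝟙 ⊖ q^ (suc k)) ⊛ g) ℓ ≡ g ℓ - (q^ (suc k) ⊛ g) ℓ
  value ℓ = trans (at (solve 2 (λ p g → (con 1ℤ :- p) :* g := g :- p :* g) ≈-refl (q^ (suc k)) g) ℓ) (⊖-at g (q^ (suc k) ⊛ g) ℓ)
  cancel : ∀ s t → s + t - t ≡ s
  cancel = solve-∀
  pointwise-clear : ∀ ℓ → Split (suc k) ℓ → ((𝟙 ⊖ q^ (suc k)) ⊛ g) ℓ ≡ a ℓ
  pointwise-clear ℓ (below lt) = trans (value ℓ) (trans (cong (λ t → g ℓ - t) (q^⊛-< (suc k) g lt)) (trans (ℤₚ.+-identityʳ (g ℓ)) (small lt)))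
  pointwise-clear _ (above x)  = trans (value (suc k ℕ.+ x)) (trans (cong₂ _-_ (large x) (q^⊛-+ (suc k) g x)) (cancel (a (suc k ℕ.+ x)) (g x)))
  clear : (𝟙 ⊖ q^ (suc k)) ⊛ g ≈ a
  clear = pointwise λ ℓ → pointwise-clear ℓ (split (suc k) ℓ)

opaque
  unfolding p₂

  G₁≈p₂ : G 1 ≈ ↑ p₂
  G₁≈p₂ = ≈-trans (solve 1 (λ g → g := g :* con 1ℤ) ≈-refl (G 1)) (G-char 1 {↑ p₂} {𝟙}
    (λ { {0} _ → refl ; {1} _ → refl ; {suc (suc _)} (s≤s (s≤s ())) }) (λ x → sym (ℤₚ.+-identityˡ (+ p₂ x))))

  G₂⊛p₂≈p₂₃ : G 2 ⊛ ↑ p₂ ≈ ↑ p₂₃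
  G₂⊛p₂≈p₂₃ = G-char 2 (λ { {0} _ → refl ; {1} _ → refl ; {2} _ → refl ; {suc (suc (suc _))} (s≤s (s≤s (s≤s ()))) }) (λ x → refl)

  G₃⊛p₂₃≈p₂₃₄ : G 3 ⊛ ↑ p₂₃ ≈ ↑ p₂₃₄
  G₃⊛p₂₃≈p₂₃₄ = G-char 3 (λ { {0} _ → refl ; {1} _ → refl ; {2} _ → refl ; {3} _ → refl ; {suc (suc (suc (suc _)))} (s≤s (s≤s (s≤s (s≤s ())))) }) (λ x → refl)

  G₁⊛G₀≈p₁₂ : G 1 ⊛ G 0 ≈ ↑ p₁₂
  G₁⊛G₀≈p₁₂ = G-char 1 (λ { {0} _ → refl ; {1} _ → refl ; {suc (suc _)} (s≤s (s≤s ())) }) (λ x → cong (_+ + p₁₂ x) (sym (G₀≡1 (2 ℕ.+ x))))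

  G₂⊛p₁₂≈p₁₂₃ : G 2 ⊛ ↑ p₁₂ ≈ ↑ p₁₂₃
  G₂⊛p₁₂≈p₁₂₃ = G-char 2 (λ { {0} _ → refl ; {1} _ → refl ; {2} _ → refl ; {suc (suc (suc _))} (s≤s (s≤s (s≤s ()))) }) (λ x → refl)

d₂-series : ∀ n → d n 2 ≈ q^ 3 ⊛ ↑ p₂ ⊖ q^ (suc n) ⊛ (q^ 1 ⊛ G 0) ⊕ q^ (suc n) ⊛ (q^ (suc n) ⊛ G 1)
d₂-series n = begin
  d n 2
    ≈⟨ ≈-trans (d-suc n 1) (⊛-congˡ (⊛-congˡ (d-one n))) ⟩
  (X ⊛ (X ⊛ 𝟙) ⊖ Q) ⊛ (G 1 ⊛ (X ⊖ Q))
    ≈⟨ solve 3 (λ X Q g → (X :* (X :* con 1ℤ) :- Q) :* (g :* (X :- Q)) :=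
         X :* (X :* (X :* con 1ℤ)) :* g :- Q :* (X :* con 1ℤ :* ((con 1ℤ :+ X :* (con 1ℤ :+ X :* con 0ℤ)) :* g)) :+ Q :* (Q :* g)) ≈-refl X Q (G 1) ⟩
  q^ 3 ⊛ G 1 ⊖ Q ⊛ (q^ 1 ⊛ (S 2 ⊛ G 1)) ⊕ Q ⊛ (Q ⊛ G 1)
    ≈⟨ ⊕-cong (⊕-cong (⊛-congˡ G₁≈p₂) (⊝-cong (⊛-congˡ (⊛-congˡ (≈-sym (G₀≈SG 1)))))) ≈-refl ⟩
  q^ 3 ⊛ ↑ p₂ ⊖ Q ⊛ (q^ 1 ⊛ G 0) ⊕ Q ⊛ (Q ⊛ G 1) ∎
  where
  open ≈-Reasoning
  Q = q^ (suc n)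

-- In the term linear in q^(n+1) the numerator q^3 + q^4 + q^5 cancels the denominator 1 - q^3 down
-- to 1 - q, which leaves parts 1 and 2. Of the higher terms only their order matters, at least 2 m
-- + 1, so `W` stays unspecified: up to index 2 m, beyond the centre of `e n 3`, they contribute
-- nothing.
d₃-series : ∀ n → ∃[ W ] d n 3 ≈ q^ 6 ⊛ ↑ p₂₃ ⊖ q^ (suc n) ⊛ (q^ 3 ⊛ ↑ p₁₂) ⊕ q^ (suc n) ⊛ (q^ (suc n) ⊛ (q^ 1 ⊛ W))
d₃-series n = W , (begin
  d n 3
    ≈⟨ ≈-trans (d-suc n 2) (⊛-congˡ (⊛-congˡ (≈-trans (d-suc n 1) (⊛-congˡ (⊛-congˡ (d-one n)))))) ⟩
  (X ⊛ (X ⊛ (X ⊛ 𝟙)) ⊖ X ⊛ q) ⊛ (G 2 ⊛ ((X ⊛ (X ⊛ 𝟙) ⊖ X ⊛ q) ⊛ (G 1 ⊛ (X ⊖ X ⊛ q))))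
    ≈⟨ solve 4 (λ X q g h → (X :* (X :* (X :* con 1ℤ)) :- X :* q) :* (h :* ((X :* (X :* con 1ℤ) :- X :* q) :* (g :* (X :- X :* q)))) :=
         X :* (X :* (X :* (X :* (X :* (X :* con 1ℤ))))) :* (h :* g)
         :- X :* q :* (X :* (X :* (X :* con 1ℤ)) :* (g :* ((con 1ℤ :+ X :* (con 1ℤ :+ X :* (con 1ℤ :+ X :* con 0ℤ))) :* h)))
         :+ X :* q :* (X :* q :* (X :* con 1ℤ :* ((con 1ℤ :+ X :+ X :* X :- q) :* g :* h)))) ≈-refl X q (G 1) (G 2) ⟩
  q^ 6 ⊛ (G 2 ⊛ G 1) ⊖ X ⊛ q ⊛ (q^ 3 ⊛ (G 1 ⊛ (S 3 ⊛ G 2))) ⊕ X ⊛ q ⊛ (X ⊛ q ⊛ (q^ 1 ⊛ W))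
    ≈⟨ ⊕-cong (⊕-cong (⊛-congˡ (≈-trans (⊛-congˡ G₁≈p₂) G₂⊛p₂≈p₂₃)) (⊝-cong (⊛-congˡ (⊛-congˡ (≈-trans (⊛-congˡ (≈-sym (G₀≈SG 2))) G₁⊛G₀≈p₁₂))))) ≈-refl ⟩
  q^ 6 ⊛ ↑ p₂₃ ⊖ X ⊛ q ⊛ (q^ 3 ⊛ ↑ p₁₂) ⊕ X ⊛ q ⊛ (X ⊛ q ⊛ (q^ 1 ⊛ W)) ∎)
  where
  open ≈-Reasoning
  q W : Series
  q = q^ n
  W = (const 1ℤ ⊕ X ⊕ X ⊛ X ⊖ q) ⊛ G 1 ⊛ G 2

d₄-series : ∀ n → ∃[ W ] d n 4 ≈ q^ 10 ⊛ ↑ p₂₃₄ ⊖ q^ (suc n) ⊛ (q^ 6 ⊛ ↑ p₁₂₃) ⊕ q^ (suc n) ⊛ (q^ (suc n) ⊛ (q^ 1 ⊛ W))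
d₄-series n = W , (begin
  d n 4
    ≈⟨ ≈-trans (d-suc n 3) (⊛-congˡ (⊛-congˡ (≈-trans (d-suc n 2) (⊛-congˡ (⊛-congˡ (≈-trans (d-suc n 1) (⊛-congˡ (⊛-congˡ (d-one n))))))))) ⟩
  (X ⊛ (X ⊛ (X ⊛ (X ⊛ 𝟙))) ⊖ X ⊛ q) ⊛ (G 3 ⊛ ((X ⊛ (X ⊛ (X ⊛ 𝟙)) ⊖ X ⊛ q) ⊛ (G 2 ⊛ ((X ⊛ (X ⊛ 𝟙) ⊖ X ⊛ q) ⊛ (G 1 ⊛ (X ⊖ X ⊛ q))))))
    ≈⟨ solve 5 (λ X q g h k →
         (X :* (X :* (X :* (X :* con 1ℤ))) :- X :* q) :* (k :* ((X :* (X :* (X :* con 1ℤ)) :- X :* q) :* (h :* ((X :* (X :* con 1ℤ) :- X :* q) :* (g :* (X :- X :* q)))))) :=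
         X :* (X :* (X :* (X :* (X :* (X :* (X :* (X :* (X :* (X :* con 1ℤ))))))))) :* (k :* (h :* g))
         :- X :* q :* (X :* (X :* (X :* (X :* (X :* (X :* con 1ℤ))))) :* (h :* (g :* ((con 1ℤ :+ X :* (con 1ℤ :+ X :* (con 1ℤ :+ X :* (con 1ℤ :+ X :* con 0ℤ)))) :* k))))
         :+ X :* q :* (X :* q :* (X :* con 1ℤ :* ((X :* X :+ X :* X :* X :+ con (+ 2) :* X :* X :* X :* X :+ X :* X :* X :* X :* X :+ X :* X :* X :* X :* X :* X
              :- q :* (X :+ X :* X :+ X :* X :* X :+ X :* X :* X :* X) :+ q :* q :* X) :* g :* h :* k)))) ≈-refl X q (G 1) (G 2) (G 3) ⟩
  q^ 10 ⊛ (G 3 ⊛ (G 2 ⊛ G 1)) ⊖ X ⊛ q ⊛ (q^ 6 ⊛ (G 2 ⊛ (G 1 ⊛ (S 4 ⊛ G 3)))) ⊕ X ⊛ q ⊛ (X ⊛ q ⊛ (q^ 1 ⊛ W))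
    ≈⟨ ⊕-cong (⊕-cong (⊛-congˡ (≈-trans (⊛-congˡ (≈-trans (⊛-congˡ G₁≈p₂) G₂⊛p₂≈p₂₃)) G₃⊛p₂₃≈p₂₃₄))
         (⊝-cong (⊛-congˡ (⊛-congˡ (≈-trans (⊛-congˡ (≈-trans (⊛-congˡ (≈-sym (G₀≈SG 3))) G₁⊛G₀≈p₁₂)) G₂⊛p₁₂≈p₁₂₃))))) ≈-refl ⟩
  q^ 10 ⊛ ↑ p₂₃₄ ⊖ X ⊛ q ⊛ (q^ 6 ⊛ ↑ p₁₂₃) ⊕ X ⊛ q ⊛ (X ⊛ q ⊛ (q^ 1 ⊛ W)) ∎)
  where
  open ≈-Reasoning
  q W : Series
  q = q^ n
  W = (X ⊛ X ⊕ X ⊛ X ⊛ X ⊕ const (+ 2) ⊛ X ⊛ X ⊛ X ⊛ X ⊕ X ⊛ X ⊛ X ⊛ X ⊛ X ⊕ X ⊛ X ⊛ X ⊛ X ⊛ X ⊛ X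
       ⊖ q ⊛ (X ⊕ X ⊛ X ⊕ X ⊛ X ⊛ X ⊕ X ⊛ X ⊛ X ⊛ X) ⊕ q ⊛ q ⊛ X) ⊛ G 1 ⊛ G 2 ⊛ G 3

remainder : ∀ {x y} → x ℕ.≤ y → ∃[ k ] y ≡ x ℕ.+ k
remainder x≤y = let k , eq = ℕₚ.m≤n⇒∃[o]m+o≡n x≤y in k , sym eq

expand-at : ∀ s a b w {x y} → (q^ s ⊛ w) y ≡ 0ℤ → ∀ {ℓ} → x ≡ ℓ → ℓ ≡ s ℕ.+ y → (a ⊖ q^ s ⊛ b ⊕ q^ s ⊛ (q^ s ⊛ w)) ℓ ≡ a x - b y
expand-at s a b w {y = y} zero-tail refl refl = trans (⊕-at (a ⊖ q^ s ⊛ b) (q^ s ⊛ (q^ s ⊛ w)) (s ℕ.+ y))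
  (trans (cong₂ _+_ (trans (⊖-at a (q^ s ⊛ b) (s ℕ.+ y)) (cong (λ t → a (s ℕ.+ y) - t) (q^⊛-+ s b y))) (trans (q^⊛-+ s (q^ s ⊛ w) y) zero-tail)) (ℤₚ.+-identityʳ _))

-- The extra factor q admits y = m, that is, the index 2 m, the centre of `e n 4`.
tail-zero : ∀ m w {y} → y ℕ.≤ m → (q^ m ⊛ (q^ 1 ⊛ w)) y ≡ 0ℤ
tail-zero m w y≤m with ℕₚ.m≤n⇒m<n∨m≡n y≤m
... | inj₁ y<m  = q^⊛-< m (q^ 1 ⊛ w) y<m
... | inj₂ refl = trans (cong (q^ m ⊛ (q^ 1 ⊛ w)) (sym (ℕₚ.+-identityʳ m))) (trans (q^⊛-+ m (q^ 1 ⊛ w) 0) (q^⊛-< 1 w (s≤s z≤n)))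

-- Signs of the differences for at most four parts

module Explicit (n : ℕ) where

  m : ℕ
  m = suc n

  d₂-at : ∀ k → k ℕ.< m → ∀ {x} → m ℕ.+ k ≡ 3 ℕ.+ x → d n 2 (m ℕ.+ k) ≡ + p₂ x - (q^ 1 ⊛ G 0) k
  d₂-at k k<m {x} eq = trans (at (d₂-series n) (m ℕ.+ k)) (trans (expand-at m (q^ 3 ⊛ ↑ p₂) (q^ 1 ⊛ G 0) (G 1) (q^⊛-< m (G 1) k<m) refl refl)
    (cong (_- (q^ 1 ⊛ G 0) k) (trans (cong (q^ 3 ⊛ ↑ p₂) eq) (q^⊛-+ 3 (↑ p₂) x))))

  d₃-at : ∀ k → k ℕ.≤ m → d n 3 (m ℕ.+ k) ≡ (q^ 6 ⊛ ↑ p₂₃) (m ℕ.+ k) - (q^ 3 ⊛ ↑ p₁₂) k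
  d₃-at k k≤m = let W , eq = d₃-series n in
    trans (at eq (m ℕ.+ k)) (expand-at m (q^ 6 ⊛ ↑ p₂₃) (q^ 3 ⊛ ↑ p₁₂) (q^ 1 ⊛ W) (tail-zero m W k≤m) refl refl)

  d₄-at : ∀ k → k ℕ.≤ m → d n 4 (m ℕ.+ k) ≡ (q^ 10 ⊛ ↑ p₂₃₄) (m ℕ.+ k) - (q^ 6 ⊛ ↑ p₁₂₃) k
  d₄-at k k≤m = let W , eq = d₄-series n in
    trans (at eq (m ℕ.+ k)) (expand-at m (q^ 10 ⊛ ↑ p₂₃₄) (q^ 6 ⊛ ↑ p₁₂₃) (q^ 1 ⊛ W) (tail-zero m W k≤m) refl refl)

  at-shift : ∀ s p {ℓ x} → ℓ ≡ s ℕ.+ x → (q^ s ⊛ ↑ p) ℓ ≡ + p x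
  at-shift s p {x = x} refl = q^⊛-+ s (↑ p) x

  ↑-nonneg : ∀ s p ℓ → 0ℤ ≤ (q^ s ⊛ ↑ p) ℓ
  ↑-nonneg s p ℓ = q^⊛-nonneg s ℓ λ i _ → 0≤+ (p i)

  D₁-at-0 : D n 1 (m ℕ.+ 0) ≡ -1ℤ
  D₁-at-0 = trans (at (D-one n) (m ℕ.+ 0)) (trans (⊖-at 𝟙 (q^ m) (m ℕ.+ 0)) (cong (λ t → 0ℤ - t) (q^-at-+ m 0)))

  D₁-at-suc : ∀ k → D n 1 (m ℕ.+ suc k) ≡ 0ℤ
  D₁-at-suc k = trans (at (D-one n) (m ℕ.+ suc k)) (trans (⊖-at 𝟙 (q^ m) (m ℕ.+ suc k)) (cong (λ t → 0ℤ - t) (q^-at-+ m (suc k))))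

  D-split-at : ∀ b ℓ → D n (suc b) ℓ ≡ D n b ℓ + d n (suc b) ℓ
  D-split-at b ℓ = trans (at (D-suc n b) ℓ) (⊕-at (D n b) (d n (suc b)) ℓ)

  D₂-at : ∀ k → k ℕ.< m → ∀ {x} → m ℕ.+ k ≡ 3 ℕ.+ x → D n 2 (m ℕ.+ k) ≡ + p₂ x - 1ℤ
  D₂-at zero k<m {x} eq = trans (D-split-at 1 (m ℕ.+ 0)) (trans (cong₂ _+_ D₁-at-0 (d₂-at 0 k<m {x} eq))
    (trans (cong (λ t → -1ℤ + (+ p₂ x - t)) (q^⊛-< 1 (G 0) (s≤s z≤n))) (shuffle (+ p₂ x))))
    where
    shuffle : ∀ t → -1ℤ + (t - 0ℤ) ≡ t - 1ℤ
    shuffle = solve-∀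
  D₂-at (suc k) k<m {x} eq = trans (D-split-at 1 (m ℕ.+ suc k)) (trans (cong₂ _+_ (D₁-at-suc k) (d₂-at (suc k) k<m {x} eq))
    (trans (ℤₚ.+-identityˡ _) (cong (λ t → + p₂ x - t) (trans (q^⊛-+ 1 (G 0) k) (G₀≡1 k)))))

  d₂-lower : ∀ z → z ℕ.≤ m → 0ℤ ≤ d n 2 z
  d₂-lower z z≤m with split m z
  ... | below (s≤s z≤n′) = d-nonneg-low n 1 z z≤n′
  ... | above zero    = subst (0ℤ ≤_) (sym value) (↑-nonneg 3 p₂ (m ℕ.+ 0))
    where
    value : d n 2 (m ℕ.+ 0) ≡ (q^ 3 ⊛ ↑ p₂) (m ℕ.+ 0)
    value = trans (at (d₂-series n) (m ℕ.+ 0)) (trans (expand-at m (q^ 3 ⊛ ↑ p₂) (q^ 1 ⊛ G 0) (G 1) (q^⊛-< m (G 1) (s≤s z≤n)) refl refl)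
      (trans (cong (λ t → (q^ 3 ⊛ ↑ p₂) (m ℕ.+ 0) - t) (q^⊛-< 1 (G 0) (s≤s z≤n))) (ℤₚ.+-identityʳ _)))
  ... | above (suc k) = contradiction z≤m (ℕₚ.<⇒≱ (ℕₚ.m<m+n m (s≤s z≤n)))

  d₃-lower : ∀ z → z ℕ.+ z ℕ.≤ suc (3 ℕ.* m) → 0ℤ ≤ d n 3 z
  d₃-lower z 2z≤ with split m z
  ... | below (s≤s z≤n′) = d-nonneg-low n 2 z z≤n′
  ... | above k = subst (0ℤ ≤_) (sym (d₃-at k k≤m)) (value (split 3 k) 2k≤)
    where
    2k≤ : k ℕ.+ k ℕ.≤ suc m
    2k≤ = ℕₚ.+-cancelˡ-≤ (m ℕ.+ m) _ _ (subst₂ ℕ._≤_ (eq₁ m k) (eq₂ m) 2z≤)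
      where
      eq₁ : ∀ m k → m ℕ.+ k ℕ.+ (m ℕ.+ k) ≡ m ℕ.+ m ℕ.+ (k ℕ.+ k)
      eq₁ = ℕ-solve
      eq₂ : ∀ m → suc (3 ℕ.* m) ≡ m ℕ.+ m ℕ.+ suc m
      eq₂ = ℕ-solve
    k≤m : k ℕ.≤ m
    k≤m = ℕₚ.≮⇒≥ λ m<k → ℕₚ.<⇒≱ (ℕₚ.+-mono-< m<k m<k) (ℕₚ.≤-trans 2k≤ (ℕₚ.≤-trans (ℕₚ.≤-reflexive (ℕₚ.+-comm 1 m)) (ℕₚ.+-monoʳ-≤ m (s≤s z≤n))))
    value : ∀ {k} → Split 3 k → k ℕ.+ k ℕ.≤ suc m → 0ℤ ≤ (q^ 6 ⊛ ↑ p₂₃) (m ℕ.+ k) - (q^ 3 ⊛ ↑ p₁₂) k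
    value {k} (below k<3) _ = subst (λ t → 0ℤ ≤ (q^ 6 ⊛ ↑ p₂₃) (m ℕ.+ k) - t) (sym (q^⊛-< 3 (↑ p₁₂) k<3)) (subst (0ℤ ≤_) (sym (ℤₚ.+-identityʳ _)) (↑-nonneg 6 p₂₃ (m ℕ.+ k)))
    value (above y) le with remainder (subst (ℕ._≤ m) (eq y) (ℕₚ.≤-pred le))
      where
      eq : ∀ y → 2 ℕ.+ y ℕ.+ (3 ℕ.+ y) ≡ 5 ℕ.+ 2 ℕ.* y
      eq = ℕ-solve
    ... | u , m≡ = subst (0ℤ ≤_) (cong₂ _-_ (sym (at-shift 6 p₂₃ (trans (cong (ℕ._+ (3 ℕ.+ y)) m≡) (eq y u)))) (sym (q^⊛-+ 3 (↑ p₁₂) y))) (cast (p₁₂≤p₂₃ u y))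
      where
      eq : ∀ y u → 5 ℕ.+ 2 ℕ.* y ℕ.+ u ℕ.+ (3 ℕ.+ y) ≡ 6 ℕ.+ (3 ℕ.* y ℕ.+ 2 ℕ.+ u)
      eq = ℕ-solve

  d₄-lower : ∀ z → z ℕ.≤ m ℕ.+ m → 0ℤ ≤ d n 4 z
  d₄-lower z z≤ with split m z
  ... | below (s≤s z≤n′) = d-nonneg-low n 3 z z≤n′
  ... | above k = subst (0ℤ ≤_) (sym (d₄-at k k≤m)) (value (split 6 k) k≤m)
    where
    k≤m : k ℕ.≤ m
    k≤m = ℕₚ.+-cancelˡ-≤ m _ _ z≤
    value : ∀ {k} → Split 6 k → k ℕ.≤ m → 0ℤ ≤ (q^ 10 ⊛ ↑ p₂₃₄) (m ℕ.+ k) - (q^ 6 ⊛ ↑ p₁₂₃) k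
    value {k} (below k<6) _ = subst (λ t → 0ℤ ≤ (q^ 10 ⊛ ↑ p₂₃₄) (m ℕ.+ k) - t) (sym (q^⊛-< 6 (↑ p₁₂₃) k<6)) (subst (0ℤ ≤_) (sym (ℤₚ.+-identityʳ _)) (↑-nonneg 10 p₂₃₄ (m ℕ.+ k)))
    value (above y) le with remainder le
    ... | t , m≡ = subst (0ℤ ≤_) (cong₂ _-_ (sym (at-shift 10 p₂₃₄ (trans (cong (ℕ._+ (6 ℕ.+ y)) m≡) (eq y t)))) (sym (q^⊛-+ 6 (↑ p₁₂₃) y))) (cast (p₁₂₃≤p₂₃₄ t y))
      where
      eq : ∀ y t → 6 ℕ.+ y ℕ.+ t ℕ.+ (6 ℕ.+ y) ≡ 10 ℕ.+ (2 ℕ.* y ℕ.+ 2 ℕ.+ t)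
      eq = ℕ-solve

  d₂-upper : ∀ ℓ → m ℕ.< ℓ → d n 2 ℓ ≤ 0ℤ
  d₂-upper ℓ m<ℓ = d-nonpos n 2 ℓ λ y eq → d₂-lower y (ℕₚ.+-cancelˡ-≤ (suc m) _ _ (ℕₚ.≤-trans (ℕₚ.+-monoˡ-≤ y m<ℓ) (ℕₚ.≤-reflexive (trans eq (eq₁ m)))))
    where
    eq₁ : ∀ m → suc (2 ℕ.* m) ≡ suc m ℕ.+ m
    eq₁ = ℕ-solve

  d₃-upper : ∀ ℓ → suc (3 ℕ.* m) ℕ.≤ ℓ ℕ.+ ℓ → d n 3 ℓ ≤ 0ℤ
  d₃-upper ℓ le = d-nonpos n 3 ℓ λ y eq → d₃-lower y (ℕₚ.+-cancelˡ-≤ (ℓ ℕ.+ ℓ) _ _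
    (ℕₚ.≤-trans (ℕₚ.≤-reflexive (trans (eq₁ ℓ y) (cong₂ ℕ._+_ eq eq))) (ℕₚ.+-monoˡ-≤ (suc (3 ℕ.* m)) le)))
    where
    eq₁ : ∀ ℓ y → ℓ ℕ.+ ℓ ℕ.+ (y ℕ.+ y) ≡ ℓ ℕ.+ y ℕ.+ (ℓ ℕ.+ y)
    eq₁ = ℕ-solve

  d₄-upper : ∀ ℓ → m ℕ.+ m ℕ.< ℓ → d n 4 ℓ ≤ 0ℤ
  d₄-upper ℓ lt = d-nonpos n 4 ℓ λ y eq → d₄-lower y (ℕₚ.+-cancelˡ-≤ (suc (m ℕ.+ m)) _ _ (ℕₚ.≤-trans (ℕₚ.+-monoˡ-≤ y lt) (ℕₚ.≤-reflexive (trans eq (eq₁ m)))))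
    where
    eq₁ : ∀ m → suc (4 ℕ.* m) ≡ suc (m ℕ.+ m) ℕ.+ (m ℕ.+ m)
    eq₁ = ℕ-solve

  D₁-upper : ∀ ℓ → m ℕ.≤ ℓ → D n 1 ℓ ≤ 0ℤ
  D₁-upper ℓ m≤ℓ with remainder m≤ℓ
  ... | zero  , refl = subst (_≤ 0ℤ) (sym D₁-at-0) ℤ.-≤+
  ... | suc k , refl = ℤₚ.≤-reflexive (D₁-at-suc k)

  unimodal-1 : Unimodal (c n 1)
  unimodal-1 = unimodal-cut n 1 n (D-nonneg-low n 0) D₁-upper

  D₂-upper : ∀ ℓ → m ℕ.< ℓ → D n 2 ℓ ≤ 0ℤ
  D₂-upper ℓ m<ℓ = subst (_≤ 0ℤ) (sym (D-split-at 1 ℓ)) (ℤₚ.+-mono-≤ (D₁-upper ℓ (ℕₚ.<⇒≤ m<ℓ)) (d₂-upper ℓ m<ℓ))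

  -- The threshold 30 is a round number above 23, the largest of the lower bounds on n that the
  -- cases of two, three and four parts draw from it.
  unimodal-2 : 30 ℕ.≤ n → Unimodal (c n 2)
  unimodal-2 30≤n = unimodal-cut n 2 n (D-nonneg-low n 1) down
    where
    down : ∀ ℓ → n ℕ.< ℓ → D n 2 ℓ ≤ 0ℤ
    down ℓ n<ℓ with ℕₚ.m≤n⇒m<n∨m≡n n<ℓ
    ... | inj₁ m<ℓ = D₂-upper ℓ m<ℓ
    ... | inj₂ refl with remainder (ℕₚ.≤-trans (ℕₚ.m≤m+n 2 28) 30≤n)
    ...   | k , n≡ = subst (λ ℓ → D n 2 ℓ ≤ 0ℤ) (ℕₚ.+-identityʳ m)
              (subst (_≤ 0ℤ) (sym (D₂-at 0 (s≤s z≤n) {k ℕ.+ 0} (cong (λ t → suc t ℕ.+ 0) n≡))) (ℤₚ.i≤j⇒i-j≤0 (ℤ.+≤+ (p₂≤1 (k ℕ.+ 0)))))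

  D₃-at : ∀ k → k ℕ.< m → ∀ {x x′} → m ℕ.+ k ≡ 3 ℕ.+ x → m ℕ.+ k ≡ 6 ℕ.+ x′ → D n 3 (m ℕ.+ k) ≡ + p₂ x - 1ℤ + (+ p₂₃ x′ - (q^ 3 ⊛ ↑ p₁₂) k)
  D₃-at k k<m {x} {x′} eq eq′ = trans (D-split-at 2 (m ℕ.+ k)) (cong₂ _+_ (D₂-at k k<m {x} eq)
    (trans (d₃-at k (ℕₚ.<⇒≤ k<m)) (cong (_- (q^ 3 ⊛ ↑ p₁₂) k) (at-shift 6 p₂₃ eq′))))

  -- `h` is the integer part of (m - 4) / 2, and the cut is made at m + h + 1, a little before 3 m /
  -- 2, the centre of `e n 3`.
  module Three (p z h : ℕ) (n≡ : n ≡ 3 ℕ.+ p) (n≡′ : n ≡ 11 ℕ.+ z) (2h≤p : h ℕ.+ h ℕ.≤ p) (p≤2h+1 : p ℕ.≤ suc (h ℕ.+ h)) where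

    m≡ : m ≡ 4 ℕ.+ p
    m≡ = cong suc n≡
    m≡′ : m ≡ 12 ℕ.+ z
    m≡′ = cong suc n≡′
    4+2h≤m : 4 ℕ.+ (h ℕ.+ h) ℕ.≤ m
    4+2h≤m = ℕₚ.≤-trans (ℕₚ.+-monoʳ-≤ 4 2h≤p) (ℕₚ.≤-reflexive (sym m≡))
    m≤5+2h : m ℕ.≤ 5 ℕ.+ (h ℕ.+ h)
    m≤5+2h = ℕₚ.≤-trans (ℕₚ.≤-reflexive m≡) (ℕₚ.+-monoʳ-≤ 4 p≤2h+1)
    2+h<m : 2 ℕ.+ h ℕ.< m
    2+h<m = ℕₚ.≤-trans (ℕₚ.+-mono-≤ {3} {4} {h} (s≤s (s≤s (s≤s z≤n))) (ℕₚ.m≤m+n h h)) 4+2h≤m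
    up-mid : ∀ {k} → Split 3 k → k ℕ.≤ suc h → 0ℤ ≤ D n 3 (m ℕ.+ k)
    up-mid {k} (below k<3) k≤ = subst (0ℤ ≤_)
      (sym (trans (D₃-at k (ℕₚ.≤-<-trans k≤ (ℕₚ.<-trans (ℕₚ.n<1+n _) 2+h<m)) (cong (ℕ._+ k) m≡′) (cong (ℕ._+ k) m≡′)) (cong₂ (λ s t → + p₂ x - 1ℤ + (s - t)) (cong +_ (p₂₃-6 (z ℕ.+ k))) (q^⊛-< 3 (↑ p₁₂) k<3))))
      (subst (0ℤ ≤_) (eq (+ p₂ x) (+ p₂₃ (z ℕ.+ k))) (0≤+ (p₂ x ℕ.+ p₂₃ (z ℕ.+ k))))
      where
      x : ℕ
      x = 9 ℕ.+ (z ℕ.+ k)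
      eq : ∀ s t → s + t ≡ s - 1ℤ + (1ℤ + t - 0ℤ)
      eq = solve-∀
    up-mid (above y) k≤ with remainder (ℕₚ.≤-trans (ℕₚ.≤-trans (ℕₚ.≤-reflexive (eq y)) (ℕₚ.+-monoʳ-≤ 4 (ℕₚ.+-mono-≤ (ℕₚ.≤-pred k≤) (ℕₚ.≤-pred k≤)))) 4+2h≤m)
      where
      eq : ∀ y → 8 ℕ.+ 2 ℕ.* y ≡ 4 ℕ.+ (2 ℕ.+ y ℕ.+ (2 ℕ.+ y))
      eq = ℕ-solve
    ... | u , m≡₂ = subst (0ℤ ≤_)
      (sym (trans (D₃-at (3 ℕ.+ y) (ℕₚ.≤-<-trans k≤ (ℕₚ.<-trans (ℕₚ.n<1+n _) 2+h<m)) (trans (cong (ℕ._+ (3 ℕ.+ y)) m≡₂) (eq₁ y u)) (trans (cong (ℕ._+ (3 ℕ.+ y)) m≡₂) (eq₂ y u)))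
        (cong (λ t → + p₂ (3 ℕ.* y ℕ.+ 8 ℕ.+ u) - 1ℤ + (+ p₂₃ (3 ℕ.* y ℕ.+ 5 ℕ.+ u) - t)) (q^⊛-+ 3 (↑ p₁₂) y))))
      (subst (0ℤ ≤_) (eq₃ (+ p₂ (3 ℕ.* y ℕ.+ 8 ℕ.+ u)) (+ p₂₃ (3 ℕ.* y ℕ.+ 5 ℕ.+ u)) (+ p₁₂ y)) (cast (D₃-left u y)))
      where
      eq₁ : ∀ y u → 8 ℕ.+ 2 ℕ.* y ℕ.+ u ℕ.+ (3 ℕ.+ y) ≡ 3 ℕ.+ (3 ℕ.* y ℕ.+ 8 ℕ.+ u)
      eq₁ = ℕ-solve
      eq₂ : ∀ y u → 8 ℕ.+ 2 ℕ.* y ℕ.+ u ℕ.+ (3 ℕ.+ y) ≡ 6 ℕ.+ (3 ℕ.* y ℕ.+ 5 ℕ.+ u)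
      eq₂ = ℕ-solve
      eq₃ : ∀ s t r → t + s - (r + 1ℤ) ≡ s - 1ℤ + (t - r)
      eq₃ = solve-∀
    up : ∀ ℓ → ℓ ℕ.≤ m ℕ.+ suc h → 0ℤ ≤ D n 3 ℓ
    up ℓ ℓ≤ with split m ℓ
    ... | below (s≤s ℓ≤n) = D-nonneg-low n 2 ℓ ℓ≤n
    ... | above k         = up-mid (split 3 k) (ℕₚ.+-cancelˡ-≤ m _ _ ℓ≤)
    -- At index m + h + 2, just after the cut, ℓ has not yet passed the centre of `e n 3`, and
    -- `d₃-upper` does not apply; hence the table in `D₃-right`. From the next index on `D₂-upper`
    -- and `d₃-upper` suffice.
    turn : ∀ {k} → Split 3 k → k ≡ 2 ℕ.+ h → D n 3 (m ℕ.+ k) ≤ 0ℤ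
    turn (below k<3) refl = contradiction (ℕₚ.≤-trans 2≤p (ℕₚ.≤-trans p≤2h+1 (s≤s (ℕₚ.+-mono-≤ h≤0 h≤0)))) λ { (s≤s ()) }
      where
      2≤p : 2 ℕ.≤ p
      2≤p = ℕₚ.≤-trans (ℕₚ.m≤m+n 2 (6 ℕ.+ z)) (ℕₚ.≤-reflexive (ℕₚ.+-cancelˡ-≡ 4 _ _ (trans (sym m≡′) m≡)))
      h≤0 : h ℕ.≤ 0
      h≤0 = ℕₚ.≤-pred (ℕₚ.≤-pred (ℕₚ.≤-pred k<3))
    turn (above y) eq with ℕₚ.suc-injective (ℕₚ.suc-injective eq)
    ... | refl with remainder 4+2h≤m
    ...   | u , m≡₂ = subst (_≤ 0ℤ)
      (sym (trans (D₃-at (3 ℕ.+ y) 2+h<m (trans (cong (ℕ._+ (3 ℕ.+ y)) m≡₂) (eq₁ y u)) (trans (cong (ℕ._+ (3 ℕ.+ y)) m≡₂) (eq₂ y u)))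
        (cong (λ t → + p₂ (3 ℕ.* y ℕ.+ 6 ℕ.+ u) - 1ℤ + (+ p₂₃ (3 ℕ.* y ℕ.+ 3 ℕ.+ u) - t)) (q^⊛-+ 3 (↑ p₁₂) y))))
      (≤-by (cast (D₃-right u<2 y)) (eq₃ (+ p₂ (3 ℕ.* y ℕ.+ 6 ℕ.+ u)) (+ p₂₃ (3 ℕ.* y ℕ.+ 3 ℕ.+ u)) (+ p₁₂ y)))
      where
      u<2 : u ℕ.< 2
      u<2 = s≤s (ℕₚ.+-cancelˡ-≤ (4 ℕ.+ (suc y ℕ.+ suc y)) _ _ (ℕₚ.≤-trans (ℕₚ.≤-reflexive (sym m≡₂)) (ℕₚ.≤-trans m≤5+2h (ℕₚ.≤-reflexive (ℕₚ.+-comm 1 _)))))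
      eq₁ : ∀ y u → 4 ℕ.+ (suc y ℕ.+ suc y) ℕ.+ u ℕ.+ (3 ℕ.+ y) ≡ 3 ℕ.+ (3 ℕ.* y ℕ.+ 6 ℕ.+ u)
      eq₁ = ℕ-solve
      eq₂ : ∀ y u → 4 ℕ.+ (suc y ℕ.+ suc y) ℕ.+ u ℕ.+ (3 ℕ.+ y) ≡ 6 ℕ.+ (3 ℕ.* y ℕ.+ 3 ℕ.+ u)
      eq₂ = ℕ-solve
      eq₃ : ∀ s t r → 0ℤ - (s - 1ℤ + (t - r)) ≡ r + 1ℤ - (t + s)
      eq₃ = solve-∀
    down : ∀ ℓ → m ℕ.+ suc h ℕ.< ℓ → D n 3 ℓ ≤ 0ℤ
    down ℓ lt with remainder lt
    ... | zero , refl = subst (λ ℓ → D n 3 ℓ ≤ 0ℤ) (trans (ℕₚ.+-suc m (suc h)) (sym (ℕₚ.+-identityʳ _))) (turn (split 3 (2 ℕ.+ h)) refl)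
    ... | suc i , refl = subst (_≤ 0ℤ) (sym (D-split-at 2 ℓ′)) (ℤₚ.+-mono-≤ (D₂-upper ℓ′ m<ℓ) (d₃-upper ℓ′ 3m<2ℓ))
      where
      ℓ′ : ℕ
      ℓ′ = suc (m ℕ.+ suc h) ℕ.+ suc i
      m<ℓ : m ℕ.< ℓ′
      m<ℓ = s≤s (ℕₚ.≤-trans (ℕₚ.m≤m+n m (suc h)) (ℕₚ.m≤m+n _ (suc i)))
      3m<2ℓ : suc (3 ℕ.* m) ℕ.≤ ℓ′ ℕ.+ ℓ′
      3m<2ℓ = ℕₚ.≤-trans (ℕₚ.≤-reflexive (eq₁ m)) (ℕₚ.≤-trans (ℕₚ.+-monoʳ-≤ (suc (m ℕ.+ m)) m≤5+2h) (ℕₚ.≤-trans (ℕₚ.m≤m+n _ (i ℕ.+ i)) (ℕₚ.≤-reflexive (eq₂ m h i))))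
        where
        eq₁ : ∀ m → suc (3 ℕ.* m) ≡ suc (m ℕ.+ m) ℕ.+ m
        eq₁ = ℕ-solve
        eq₂ : ∀ m h i → suc (m ℕ.+ m) ℕ.+ (5 ℕ.+ (h ℕ.+ h)) ℕ.+ (i ℕ.+ i) ≡ suc (m ℕ.+ suc h) ℕ.+ suc i ℕ.+ (suc (m ℕ.+ suc h) ℕ.+ suc i)
        eq₂ = ℕ-solve

    unimodal : Unimodal (c n 3)
    unimodal = unimodal-cut n 3 (m ℕ.+ suc h) up down

  unimodal-3 : 30 ℕ.≤ n → Unimodal (c n 3)
  unimodal-3 30≤n =
    let p , n≡            = remainder (ℕₚ.≤-trans (ℕₚ.m≤m+n 3 27) 30≤n)
        z , n≡′           = remainder (ℕₚ.≤-trans (ℕₚ.m≤m+n 11 19) 30≤n)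
        h , 2h≤p , p≤2h+1 = halve p
    in Three.unimodal p z h n≡ n≡′ 2h≤p p≤2h+1

  D₄-at : ∀ k → k ℕ.< m → ∀ {x x′ x″} → m ℕ.+ k ≡ 3 ℕ.+ x → m ℕ.+ k ≡ 6 ℕ.+ x′ → m ℕ.+ k ≡ 10 ℕ.+ x″ →
          D n 4 (m ℕ.+ k) ≡ + p₂ x - 1ℤ + (+ p₂₃ x′ - (q^ 3 ⊛ ↑ p₁₂) k) + (+ p₂₃₄ x″ - (q^ 6 ⊛ ↑ p₁₂₃) k)
  D₄-at k k<m {x} {x′} eq eq′ eq″ = trans (D-split-at 3 (m ℕ.+ k)) (cong₂ _+_ (D₃-at k k<m {x} {x′} eq eq′)
    (trans (d₄-at k (ℕₚ.<⇒≤ k<m)) (cong (_- (q^ 6 ⊛ ↑ p₁₂₃) k) (at-shift 10 p₂₃₄ eq″))))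

  q³p₁₂≤2 : ∀ {k} → Split 3 k → k ℕ.< 6 → (q^ 3 ⊛ ↑ p₁₂) k ≤ + 2
  q³p₁₂≤2 (below k<3) _                    = subst (_≤ + 2) (sym (q^⊛-< 3 (↑ p₁₂) k<3)) (0≤+ 2)
  q³p₁₂≤2 (above y) (s≤s (s≤s (s≤s y<3))) = subst (_≤ + 2) (sym (q^⊛-+ 3 (↑ p₁₂) y)) (ℤ.+≤+ (p₁₂≤2 y<3))

  -- The cut is at 2 n = 2 m - 2. The indices 2 m - 1 and 2 m, the latter being the centre of
  -- `e n 4`, are settled by explicit values; beyond them `D₂-upper`, `d₃-upper` and `d₄-upper` add
  -- up.
  module Four (30≤n : 30 ℕ.≤ n) (z : ℕ) (n≡ : n ≡ 23 ℕ.+ z) where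

    m≡ : m ≡ 24 ℕ.+ z
    m≡ = cong suc n≡
    up-mid : ∀ {k} → Split 6 k → k ℕ.< n → 0ℤ ≤ D n 4 (m ℕ.+ k)
    -- The negative terms are 1 and, as k < 6, at most 2. They are paid for by `p₂₃` ≥ 3, which
    -- `3≤p₂₃` gives from argument 18 = 24 - 6 on; hence m ≥ 24.
    up-mid {k} (below k<6) k<n = subst (0ℤ ≤_)
      (sym (trans (D₄-at k (ℕₚ.m<n⇒m<1+n k<n) {21 ℕ.+ (z ℕ.+ k)} {18 ℕ.+ (z ℕ.+ k)} {14 ℕ.+ (z ℕ.+ k)} (cong (ℕ._+ k) m≡) (cong (ℕ._+ k) m≡) (cong (ℕ._+ k) m≡))
        (cong (λ t → + p₂ (21 ℕ.+ (z ℕ.+ k)) - 1ℤ + (+ p₂₃ (18 ℕ.+ (z ℕ.+ k)) - (q^ 3 ⊛ ↑ p₁₂) k) + (+ p₂₃₄ (14 ℕ.+ (z ℕ.+ k)) - t)) (q^⊛-< 6 (↑ p₁₂₃) k<6))))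
      (≤-by (0≤+ (p₂ (21 ℕ.+ (z ℕ.+ k))) ⊞ 0≤+ (p₂₃₄ (14 ℕ.+ (z ℕ.+ k))) ⊞ cast (3≤p₂₃ (z ℕ.+ k)) ⊞ nn (q³p₁₂≤2 (split 3 k) k<6))
        (eq (+ p₂ (21 ℕ.+ (z ℕ.+ k))) (+ p₂₃ (18 ℕ.+ (z ℕ.+ k))) ((q^ 3 ⊛ ↑ p₁₂) k) (+ p₂₃₄ (14 ℕ.+ (z ℕ.+ k)))))
      where
      eq : ∀ s t r u → s - 1ℤ + (t - r) + (u - 0ℤ) - 0ℤ ≡ s + u + (t - + 3) + (+ 2 - r)
      eq = solve-∀
    up-mid (above y) k<n with remainder k<n
    ... | t , n≡₂ = subst (0ℤ ≤_)
      (sym (trans (D₄-at (6 ℕ.+ y) (ℕₚ.m<n⇒m<1+n k<n) {2 ℕ.* y ℕ.+ 11 ℕ.+ t} {2 ℕ.* y ℕ.+ 8 ℕ.+ t} {2 ℕ.* y ℕ.+ 4 ℕ.+ t} (trans m+k (eq₁ y t)) (trans m+k (eq₂ y t)) (trans m+k (eq₃ y t)))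
        (cong₂ (λ r r′ → + p₂ (2 ℕ.* y ℕ.+ 11 ℕ.+ t) - 1ℤ + (+ p₂₃ (2 ℕ.* y ℕ.+ 8 ℕ.+ t) - r) + (+ p₂₃₄ (2 ℕ.* y ℕ.+ 4 ℕ.+ t) - r′)) (q^⊛-+ 3 (↑ p₁₂) (3 ℕ.+ y)) (q^⊛-+ 6 (↑ p₁₂₃) y))))
      (≤-by (cast (D₄-left t y)) (eq₄ (+ p₂ (2 ℕ.* y ℕ.+ 11 ℕ.+ t)) (+ p₂₃ (2 ℕ.* y ℕ.+ 8 ℕ.+ t)) (+ p₂₃₄ (2 ℕ.* y ℕ.+ 4 ℕ.+ t)) (+ p₁₂ (3 ℕ.+ y)) (+ p₁₂₃ y)))
      where
      m+k : m ℕ.+ (6 ℕ.+ y) ≡ suc (7 ℕ.+ y ℕ.+ t) ℕ.+ (6 ℕ.+ y)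
      m+k = cong (λ n → suc n ℕ.+ (6 ℕ.+ y)) n≡₂
      eq₁ : ∀ y t → suc (7 ℕ.+ y ℕ.+ t) ℕ.+ (6 ℕ.+ y) ≡ 3 ℕ.+ (2 ℕ.* y ℕ.+ 11 ℕ.+ t)
      eq₁ = ℕ-solve
      eq₂ : ∀ y t → suc (7 ℕ.+ y ℕ.+ t) ℕ.+ (6 ℕ.+ y) ≡ 6 ℕ.+ (2 ℕ.* y ℕ.+ 8 ℕ.+ t)
      eq₂ = ℕ-solve
      eq₃ : ∀ y t → suc (7 ℕ.+ y ℕ.+ t) ℕ.+ (6 ℕ.+ y) ≡ 10 ℕ.+ (2 ℕ.* y ℕ.+ 4 ℕ.+ t)
      eq₃ = ℕ-solve
      eq₄ : ∀ s t u r r′ → s - 1ℤ + (t - r) + (u - r′) - 0ℤ ≡ u + t + s - (r′ + r + 1ℤ)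
      eq₄ = solve-∀
    up : ∀ ℓ → ℓ ℕ.≤ n ℕ.+ n → 0ℤ ≤ D n 4 ℓ
    up ℓ ℓ≤ with split m ℓ
    ... | below (s≤s ℓ≤n) = D-nonneg-low n 3 ℓ ℓ≤n
    ... | above k         = up-mid (split 6 k) (ℕₚ.+-cancelˡ-≤ n _ _ (subst (ℕ._≤ n ℕ.+ n) (sym (ℕₚ.+-suc n k)) ℓ≤))
    6≤n : 6 ℕ.≤ n
    6≤n = ℕₚ.≤-trans (ℕₚ.m≤m+n 6 24) 30≤n
    before-middle : D n 4 (m ℕ.+ n) ≤ 0ℤ
    before-middle with remainder 6≤n
    ... | y , n≡₂ = subst (λ k → D n 4 (m ℕ.+ k) ≤ 0ℤ) (sym n≡₂) (subst (_≤ 0ℤ)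
      (sym (trans (D₄-at (6 ℕ.+ y) (s≤s (ℕₚ.≤-reflexive (sym n≡₂))) {2 ℕ.* y ℕ.+ 9 ℕ.+ 1} {2 ℕ.* y ℕ.+ 6 ℕ.+ 1} {2 ℕ.* y ℕ.+ 2 ℕ.+ 1} (trans m+k (eq₁ y)) (trans m+k (eq₂ y)) (trans m+k (eq₃ y)))
        (cong₂ (λ r r′ → + p₂ (2 ℕ.* y ℕ.+ 9 ℕ.+ 1) - 1ℤ + (+ p₂₃ (2 ℕ.* y ℕ.+ 6 ℕ.+ 1) - r) + (+ p₂₃₄ (2 ℕ.* y ℕ.+ 2 ℕ.+ 1) - r′)) (q^⊛-+ 3 (↑ p₁₂) (3 ℕ.+ y)) (q^⊛-+ 6 (↑ p₁₂₃) y))))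
      (≤-by (cast (D₄-right₁ y)) (eq₄ (+ p₂ (2 ℕ.* y ℕ.+ 9 ℕ.+ 1)) (+ p₂₃ (2 ℕ.* y ℕ.+ 6 ℕ.+ 1)) (+ p₂₃₄ (2 ℕ.* y ℕ.+ 2 ℕ.+ 1)) (+ p₁₂ (3 ℕ.+ y)) (+ p₁₂₃ y))))
      where
      m+k : m ℕ.+ (6 ℕ.+ y) ≡ suc (6 ℕ.+ y) ℕ.+ (6 ℕ.+ y)
      m+k = cong (λ n → suc n ℕ.+ (6 ℕ.+ y)) n≡₂
      eq₁ : ∀ y → suc (6 ℕ.+ y) ℕ.+ (6 ℕ.+ y) ≡ 3 ℕ.+ (2 ℕ.* y ℕ.+ 9 ℕ.+ 1)
      eq₁ = ℕ-solve
      eq₂ : ∀ y → suc (6 ℕ.+ y) ℕ.+ (6 ℕ.+ y) ≡ 6 ℕ.+ (2 ℕ.* y ℕ.+ 6 ℕ.+ 1)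
      eq₂ = ℕ-solve
      eq₃ : ∀ y → suc (6 ℕ.+ y) ℕ.+ (6 ℕ.+ y) ≡ 10 ℕ.+ (2 ℕ.* y ℕ.+ 2 ℕ.+ 1)
      eq₃ = ℕ-solve
      eq₄ : ∀ s t u r r′ → 0ℤ - (s - 1ℤ + (t - r) + (u - r′)) ≡ r′ + r + 1ℤ - (u + t + s)
      eq₄ = solve-∀
    -- `D₂-at` ends just before 2 m, so the summands with at most two parts enter through the sign
    -- in `D₂-upper`, and `D₄-right₀` compares only the contributions of three and four parts.
    middle : D n 4 (m ℕ.+ m) ≤ 0ℤ
    middle with remainder (ℕₚ.m≤n⇒m≤1+n 6≤n)
    ... | y , m≡₂ = subst (_≤ 0ℤ) (sym (trans (D-split-at 3 (m ℕ.+ m)) (cong (_+ d n 4 (m ℕ.+ m)) (D-split-at 2 (m ℕ.+ m)))))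
      (≤-by (nn (D₂-upper (m ℕ.+ m) (ℕₚ.m<m+n m (s≤s z≤n))) ⊞ cast (D₄-right₀ y))
        (trans (cong₂ (λ s t → 0ℤ - (D n 2 (m ℕ.+ m) + s + t)) value₃ value₄) (eq₃ (D n 2 (m ℕ.+ m)) (+ p₂₃ (2 ℕ.* y ℕ.+ 6 ℕ.+ 0)) (+ p₂₃₄ (2 ℕ.* y ℕ.+ 2 ℕ.+ 0)) (+ p₁₂ (3 ℕ.+ y)) (+ p₁₂₃ y))))
      where
      m+m : m ℕ.+ m ≡ 6 ℕ.+ y ℕ.+ (6 ℕ.+ y)
      m+m = cong (λ m → m ℕ.+ m) m≡₂
      eq₁ : ∀ y → 6 ℕ.+ y ℕ.+ (6 ℕ.+ y) ≡ 6 ℕ.+ (2 ℕ.* y ℕ.+ 6 ℕ.+ 0)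
      eq₁ = ℕ-solve
      eq₂ : ∀ y → 6 ℕ.+ y ℕ.+ (6 ℕ.+ y) ≡ 10 ℕ.+ (2 ℕ.* y ℕ.+ 2 ℕ.+ 0)
      eq₂ = ℕ-solve
      eq₃ : ∀ s t u r r′ → 0ℤ - (s + (t - r) + (u - r′)) ≡ 0ℤ - s + (r′ + r - (u + t))
      eq₃ = solve-∀
      value₃ : d n 3 (m ℕ.+ m) ≡ + p₂₃ (2 ℕ.* y ℕ.+ 6 ℕ.+ 0) - + p₁₂ (3 ℕ.+ y)
      value₃ = trans (d₃-at m ℕₚ.≤-refl) (cong₂ _-_ (at-shift 6 p₂₃ (trans m+m (eq₁ y))) (at-shift 3 p₁₂ m≡₂))
      value₄ : d n 4 (m ℕ.+ m) ≡ + p₂₃₄ (2 ℕ.* y ℕ.+ 2 ℕ.+ 0) - + p₁₂₃ y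
      value₄ = trans (d₄-at m ℕₚ.≤-refl) (cong₂ _-_ (at-shift 10 p₂₃₄ (trans m+m (eq₂ y))) (at-shift 6 p₁₂₃ m≡₂))
    after-middle : ∀ ℓ → m ℕ.+ m ℕ.< ℓ → D n 4 ℓ ≤ 0ℤ
    after-middle ℓ lt = subst (_≤ 0ℤ) (sym (trans (D-split-at 3 ℓ) (cong (_+ d n 4 ℓ) (D-split-at 2 ℓ))))
      (ℤₚ.+-mono-≤ (ℤₚ.+-mono-≤ (D₂-upper ℓ (ℕₚ.≤-<-trans (ℕₚ.m≤m+n m m) lt)) (d₃-upper ℓ 3m<2ℓ)) (d₄-upper ℓ lt))
      where
      3m<2ℓ : suc (3 ℕ.* m) ℕ.≤ ℓ ℕ.+ ℓ
      3m<2ℓ = ℕₚ.≤-trans (s≤s (ℕₚ.≤-trans (ℕₚ.m≤m+n (3 ℕ.* m) m) (ℕₚ.≤-reflexive (eq m)))) (ℕₚ.+-mono-≤ lt (ℕₚ.<⇒≤ lt))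
        where
        eq : ∀ m → 3 ℕ.* m ℕ.+ m ≡ m ℕ.+ m ℕ.+ (m ℕ.+ m)
        eq = ℕ-solve
    down : ∀ ℓ → n ℕ.+ n ℕ.< ℓ → D n 4 ℓ ≤ 0ℤ
    down ℓ lt with ℕₚ.m≤n⇒m<n∨m≡n lt
    ... | inj₂ refl = before-middle
    ... | inj₁ lt′ with ℕₚ.m≤n⇒m<n∨m≡n lt′
    ...   | inj₂ eq = subst (λ ℓ → D n 4 ℓ ≤ 0ℤ) (trans (cong suc (ℕₚ.+-suc n n)) eq) middle
    ...   | inj₁ lt″ = after-middle ℓ (subst (ℕ._< ℓ) (cong suc (sym (ℕₚ.+-suc n n))) lt″)

    unimodal : Unimodal (c n 4)
    unimodal = unimodal-cut n 4 (n ℕ.+ n) up down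

  unimodal-4 : 30 ℕ.≤ n → Unimodal (c n 4)
  unimodal-4 30≤n = let z , n≡ = remainder (ℕₚ.≤-trans (ℕₚ.m≤m+n 23 7) 30≤n) in Four.unimodal 30≤n z n≡

theorem1 : ∀ (b : ℕ) → 1 ℕ.≤ b → ∃[ N ] (∀ (n : ℕ) → N ℕ.≤ n → Unimodal (c n b))
theorem1 1 _ = 0 , λ n _ → Explicit.unimodal-1 n
theorem1 2 _ = 30 , Explicit.unimodal-2
theorem1 3 _ = 30 , Explicit.unimodal-3
theorem1 4 _ = 30 , Explicit.unimodal-4
theorem1 (suc (suc (suc (suc (suc j))))) _ = Large.unimodal-large j
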